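{- For any fixed integer $s\geq 2$ and all sufficiently large $t$ (depending on $s$), $$\frac{2^s}{s+1}t-O_s\left(\sqrt{t\ln t}\right)\leq r'_2(K_{s,t})=CR(K_{s,t},K_3)\leq \frac{2^s}{s+1}t+O_s(1).$$ That is, for every integer $s\ge 2$ there exist constants $C_s>0$ and $t_s$ such that for all integers $t\geq t_s$ one has $r'_2(K_{s,t})=CR(K_{s,t},K_3)$ and $\frac{2^s}{s+1}t-C_s\sqrt{t\ln t}\leq r'_2(K_{s,t})\leq \frac{2^s}{s+1}t+C_s$.
   Context: An edge-colored graph $G$ on $p$ vertices with edge-coloring $\chi$ is called orderable if there exist an ordering $(v_1,\ldots,v_p)$ of $V(G)$ and a list $(c_1,\ldots,c_{p-1})$ of not necessarily distinct colors such that for every edge $v_iv_j\in E(G)$ with $i<j$ we have $\chi(v_iv_j)=c_i$. An edge-colored graph is rainbow if all its edges have pairwise different colors. For a graph $G$, $r'_2(G)$ is the minimum integer $n$ such that every 2-edge-coloring of $K_n$ (each edge gets one of two given colors) contains an orderable copy of $G$. For graphs $G,H$, $CR(G,H)$ is the minimum integer $n$ such that every edge-coloring of $K_n$ with any number of colors contains either an orderable copy of $G$ or a rainbow copy of $H$. Copies are (not necessarily induced) subgraphs with the inherited coloring. -}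

module Defs where

open import Data.Nat as ℕ using (ℕ; zero; suc; pred)
open import Data.Nat.Properties as ℕₚ using ()
open import Data.Integer using (+_)
open import Data.Rational as ℚ using (ℚ; 0ℚ; 1ℚ)
open import Data.Fin using (Fin; toℕ; _<_; inject≤)
open import Data.Fin.Permutation using (Permutation′; _⟨$⟩ʳ_)
open import Data.Product using (Σ; ∃; _×_; _,_)
open import Data.Sum using (_⊎_; inj₁; inj₂; swap)
open import Function.Definitions using (Injective)
open import Relation.Binary.Core using (Rel)
open import Relation.Binary.Definitions using (Symmetric; Irreflexive)
open import Relation.Binary.PropositionalEquality
  using (_≡_; _≢_; refl; ≢-sym)
open import Relation.Nullary using (¬_)
open import Level using (0ℓ)

------------------------------------------------------------------------
-- Graphs

record Graph : Set₁ where
  field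
    order  : ℕ
    Adj    : Rel (Fin order) 0ℓ
    sym    : Symmetric Adj
    irrefl : Irreflexive _≡_ Adj

  Vertex : Set
  Vertex = Fin order

K : ℕ → Graph
K n = record
  { order  = n
  ; Adj    = _≢_
  ; sym    = ≢-sym
  ; irrefl = λ x≡y x≢y → x≢y x≡y
  }

-- The complete bipartite graph with parts {0,…,s-1} and {s,…,s+t-1}.
Kᵇ : ℕ → ℕ → Graph
Kᵇ s t = record
  { order  = s ℕ.+ t
  ; Adj    = λ u v → (toℕ u ℕ.< s × s ℕ.≤ toℕ v) ⊎ (toℕ v ℕ.< s × s ℕ.≤ toℕ u)
  ; sym    = swap
  ; irrefl = λ { refl (inj₁ (u<s , s≤u)) → ℕₚ.<⇒≱ u<s s≤u
               ; refl (inj₂ (u<s , s≤u)) → ℕₚ.<⇒≱ u<s s≤u }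
  }

-- `colour-sym` says that uv and vu are one edge.  Applied twice it also shows
-- that the colour does not depend on the proof of adjacency.
record EdgeColouring (G : Graph) (A : Set) : Set where
  open Graph G
  field
    colour     : ∀ {u v} → Adj u v → A
    colour-sym : ∀ {u v} (e : Adj u v) (e′ : Adj v u) → colour e ≡ colour e′

-- A copy of G in H, as a not necessarily induced subgraph.
record Copy (G H : Graph) : Set where
  private
    module G = Graph G
    module H = Graph H
  field
    map       : G.Vertex → H.Vertex
    injective : Injective _≡_ _≡_ map
    map-adj   : ∀ {u v} → G.Adj u v → H.Adj (map u) (map v)

inherited : ∀ {G H A} → EdgeColouring H A → Copy G H → EdgeColouring G A
inherited χ f = record
  { colour     = λ e → colour (map-adj e)
  ; colour-sym = λ e e′ → colour-sym (map-adj e) (map-adj e′)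
  }
  where
  open EdgeColouring χ
  open Copy f

module _ {G : Graph} {A : Set} (χ : EdgeColouring G A) where
  open Graph G
  open EdgeColouring χ

  -- The list c has length p - 1; every i that is followed by some j in the
  -- ordering is one of the first p - 1 positions.
  Orderable : Set
  Orderable =
    Σ (Permutation′ order) λ v →
    Σ (Fin (pred order) → A) λ c →
    ∀ (i : Fin (pred order)) (j : Fin order) →
      let i′ = inject≤ i ℕₚ.pred[n]≤n in
      i′ < j → (e : Adj (v ⟨$⟩ʳ i′) (v ⟨$⟩ʳ j)) → colour e ≡ c i

  Rainbow : Set
  Rainbow = ∀ {u v x y} (e : Adj u v) (e′ : Adj x y) →
    ¬ ((u ≡ x × v ≡ y) ⊎ (u ≡ y × v ≡ x)) → colour e ≢ colour e′

OrderableCopy : ∀ {H A} → EdgeColouring H A → Graph → Set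
OrderableCopy {H} χ G = Σ (Copy G H) λ f → Orderable (inherited χ f)

RainbowCopy : ∀ {H A} → EdgeColouring H A → Graph → Set
RainbowCopy {H} χ G = Σ (Copy G H) λ f → Rainbow (inherited χ f)

------------------------------------------------------------------------
-- Ramsey-type numbers, given by their graphs as functions: existence of the
-- minimum is not built in.

IsMinimum : (ℕ → Set) → ℕ → Set
IsMinimum P n = P n × (∀ m → P m → n ℕ.≤ m)

-- r′₂(G) = n
r′₂[_]≔_ : Graph → ℕ → Set
r′₂[ G ]≔ n = IsMinimum
  (λ m → (χ : EdgeColouring (K m) (Fin 2)) → OrderableCopy χ G) n

-- CR(G, H) = n; the number k of colours is arbitrary.
CR[_,_]≔_ : Graph → Graph → ℕ → Set
CR[ G , H ]≔ n = IsMinimum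
  (λ m → ∀ k (χ : EdgeColouring (K m) (Fin k)) → OrderableCopy χ G ⊎ RainbowCopy χ H) n

------------------------------------------------------------------------
-- Real upper bounds.  A real number x is represented by its closed lower cut
-- { q ∈ ℚ | q ≤ x }.

Cut : Set₁
Cut = ℚ → Set

infix 4 _≤ᶜ_

_≤ᶜ_ : ℚ → Cut → Set
q ≤ᶜ x = x q

fromℕ : ℕ → ℚ
fromℕ n = + n ℚ./ 1

-- q ^ k / k !
expTerm : ℚ → ℕ → ℚ
expTerm q zero    = 1ℚ
expTerm q (suc k) = expTerm q k ℚ.* (q ℚ.* (+ 1 ℚ./ suc k))

-- Σ_{k ≤ n} q ^ k / k !
expSum : ℚ → ℕ → ℚ
expSum q zero    = expTerm q zero
expSum q (suc n) = expSum q n ℚ.+ expTerm q (suc n)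

-- For t ≥ 1: q ≤ ln t iff q < 0 or exp q ≤ t, and for q ≥ 0 the number exp q is
-- the supremum of the partial sums of its series.  (Meaningless for t = 0.)
ln : ℕ → Cut
ln t q = 0ℚ ℚ.≤ q → ∀ n → expSum q n ℚ.≤ fromℕ t

infixr 7 _·_
infix  8 √_

-- c · x, for c ≥ 0 and x ≥ 0.
_·_ : ℚ → Cut → Cut
(c · x) q = ∃ λ r → r ≤ᶜ x × q ℚ.≤ c ℚ.* r

-- The square root of x ≥ 0: q ≤ √ x iff q < 0 or q² ≤ x.
√_ : Cut → Cut
(√ x) q = 0ℚ ℚ.≤ q → q ℚ.* q ≤ᶜ x

{-# OPTIONS --safe #-}

-- An s-tuple of vertices spans an orderable K_{s,t} with t further vertices
-- if for suitable colours c₁, …, c_s each of these sees the tuple in the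
-- colours c₁, …, c_j, x, …, x for some j and x; s + 1 of the 2 ^ s vectors of two
-- colours are of this form.
--
-- Upper bound: take c_i = red.  A vertex with d red and e blue edges sees a random
-- tuple as required with probability about Σ_j d^j e^(s-j) / n^s, which is
-- smallest for d = e and then equals (s + 1) / 2 ^ s.
--
-- Lower bound: in a random colouring the number of vertices that fit a given tuple
-- and given colours is concentrated at (s + 1) m / 2 ^ s, so that a union bound with
-- exponential moments applies.
--
-- Equality: let a colouring without rainbow triangle be given and let M be a minimal
-- module with at least s vertices.  The vertices outside M fit all tuples inside M,
-- which is a gain unless almost all vertices are in M.  In this case one vertex
-- outside M and s - 1 inside gain a constant factor.  If M contains all vertices
-- then by Gallai's argument all but boundedly many edges at every vertex have two
-- colours.  An edge of a third colour joins two vertices that are twins for almost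
-- all others, and tuples containing both again gain a constant factor.  Without
-- such an edge there are only two colours.
module Submission where

-- For the equality, the order n of the complete graph is known only up to an error of order √(t ln
-- t). A structural case can therefore be settled only by a gain linear in t, that is, by a fraction
-- of the vertices strictly above (s + 1) / 2 ^ s. The one case without gain is that of two colours,
-- and there the property that defines r′₂ applies with the same n; hence the two numbers agree
-- exactly, and the lower bound on n has to come before the equality.
--
-- The random colouring is found by conditional expectations. For a fixed tuple an edge influences
-- the factor of at most one vertex, so the potential is exactly averaged by the two colours of the
-- edge. Each hit is weighted by 1 + 1 / k. In numbers of hits, the union bound over tuples and
-- colours costs about k ln t, and the second-order error of the moment costs about t / k; both are
-- of order √(t ln t) for k near √(t / ln t).
--
-- Minima of Ramsey type are constructed by exhaustive search, and all estimates are made in natural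
-- numbers until the very end.

-- Rational arithmetic and the estimate exp (L / 2) ≤ 2 ^ L.

module RationalBounds where
  open import Defs

  open import Data.Nat as ℕ using (ℕ; zero; suc)
  import Data.Nat.Properties as ℕₚ
  open import Data.Nat.Tactic.RingSolver using (solve-∀)
  open import Data.Integer as ℤ using (+_)
  import Data.Integer.Properties as ℤₚ
  open import Data.Rational using (ℚ; 0ℚ; 1ℚ; ½; _+_; _*_; _≤_; _/_; nonNegative; fromℚᵘ)
  open import Data.Rational.Properties
  open import Data.Rational.Solver using (module +-*-Solver)
  open import Data.Rational.Unnormalised as ℚᵘ using (ℚᵘ; mkℚᵘ; *≡*; *≤*)
  import Data.Rational.Unnormalised.Properties as ℚᵘₚ
  open import Relation.Binary.PropositionalEquality

  fromℚᵘ-homo-+ : ∀ p q → fromℚᵘ p + fromℚᵘ q ≡ fromℚᵘ (p ℚᵘ.+ q)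
  fromℚᵘ-homo-+ p q = toℚᵘ-injective (ℚᵘₚ.≃-trans (toℚᵘ-homo-+ (fromℚᵘ p) (fromℚᵘ q))
    (ℚᵘₚ.≃-trans (ℚᵘₚ.+-cong (toℚᵘ-fromℚᵘ p) (toℚᵘ-fromℚᵘ q)) (ℚᵘₚ.≃-sym (toℚᵘ-fromℚᵘ (p ℚᵘ.+ q)))))

  fromℚᵘ-homo-* : ∀ p q → fromℚᵘ p * fromℚᵘ q ≡ fromℚᵘ (p ℚᵘ.* q)
  fromℚᵘ-homo-* p q = toℚᵘ-injective (ℚᵘₚ.≃-trans (toℚᵘ-homo-* (fromℚᵘ p) (fromℚᵘ q))
    (ℚᵘₚ.≃-trans (ℚᵘₚ.*-cong (toℚᵘ-fromℚᵘ p) (toℚᵘ-fromℚᵘ q)) (ℚᵘₚ.≃-sym (toℚᵘ-fromℚᵘ (p ℚᵘ.* q)))))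

  fromℚᵘ-mono-≤ : ∀ {p q} → p ℚᵘ.≤ q → fromℚᵘ p ≤ fromℚᵘ q
  fromℚᵘ-mono-≤ {p} {q} p≤q = toℚᵘ-cancel-≤
    (ℚᵘₚ.≤-respˡ-≃ (ℚᵘₚ.≃-sym (toℚᵘ-fromℚᵘ p)) (ℚᵘₚ.≤-respʳ-≃ (ℚᵘₚ.≃-sym (toℚᵘ-fromℚᵘ q)) p≤q))

  fromℕ-+ : ∀ a b → fromℕ (a ℕ.+ b) ≡ fromℕ a + fromℕ b
  fromℕ-+ a b = trans (fromℚᵘ-cong {mkℚᵘ (+ (a ℕ.+ b)) 0} {mkℚᵘ (+ a) 0 ℚᵘ.+ mkℚᵘ (+ b) 0}
      (*≡* (cong (ℤ._* + 1) (sym (cong₂ ℤ._+_ (ℤₚ.*-identityʳ (+ a)) (ℤₚ.*-identityʳ (+ b)))))))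
    (sym (fromℚᵘ-homo-+ (mkℚᵘ (+ a) 0) (mkℚᵘ (+ b) 0)))

  fromℕ-* : ∀ a b → fromℕ (a ℕ.* b) ≡ fromℕ a * fromℕ b
  fromℕ-* a b = trans (fromℚᵘ-cong {mkℚᵘ (+ (a ℕ.* b)) 0} {mkℚᵘ (+ a) 0 ℚᵘ.* mkℚᵘ (+ b) 0}
      (*≡* (cong (ℤ._* + 1) (ℤₚ.pos-* a b))))
    (sym (fromℚᵘ-homo-* (mkℚᵘ (+ a) 0) (mkℚᵘ (+ b) 0)))

  fromℕ-mono-≤ : ∀ {a b} → a ℕ.≤ b → fromℕ a ≤ fromℕ b
  fromℕ-mono-≤ {a} {b} a≤b = fromℚᵘ-mono-≤ {mkℚᵘ (+ a) 0} {mkℚᵘ (+ b) 0}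
    (*≤* (subst₂ ℤ._≤_ (sym (ℤₚ.*-identityʳ (+ a))) (sym (ℤₚ.*-identityʳ (+ b))) (ℤ.+≤+ a≤b)))

  /-*-cancel : ∀ a d → (+ a / suc d) * fromℕ (suc d) ≡ fromℕ a
  /-*-cancel a d = trans (fromℚᵘ-homo-* (mkℚᵘ (+ a) d) (mkℚᵘ (+ suc d) 0))
    (fromℚᵘ-cong {mkℚᵘ (+ a) d ℚᵘ.* mkℚᵘ (+ suc d) 0} {mkℚᵘ (+ a) 0}
      (*≡* (trans (ℤₚ.*-identityʳ (+ a ℤ.* + suc d)) (cong (λ x → + a ℤ.* + x) (sym (ℕₚ.*-identityʳ (suc d)))))))

  0≤/ : ∀ a d → 0ℚ ≤ + a / suc d
  0≤/ a d = fromℚᵘ-mono-≤ {mkℚᵘ (+ 0) 0} {mkℚᵘ (+ a) d}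
    (*≤* (subst (ℤ._≤_ (+ 0 ℤ.* + suc d)) (sym (ℤₚ.*-identityʳ (+ a))) (ℤ.+≤+ ℕ.z≤n)))

  0≤fromℕ : ∀ a → 0ℚ ≤ fromℕ a
  0≤fromℕ a = 0≤/ a 0

  *-mono-≤-0≤ : ∀ {p q r s} → 0ℚ ≤ p → 0ℚ ≤ s → p ≤ q → r ≤ s → p * r ≤ q * s
  *-mono-≤-0≤ {p} {q} {r} {s} 0≤p 0≤s p≤q r≤s = ≤-trans
    (*-monoˡ-≤-nonNeg p {{nonNegative 0≤p}} r≤s) (*-monoʳ-≤-nonNeg s {{nonNegative 0≤s}} p≤q)

  0≤* : ∀ {p q} → 0ℚ ≤ p → 0ℚ ≤ q → 0ℚ ≤ p * q
  0≤* {p} {q} 0≤p 0≤q = ≤-trans (≤-reflexive (sym (*-zeroʳ p))) (*-monoˡ-≤-nonNeg p {{nonNegative 0≤p}} 0≤q)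

  -- The coefficient of x ^ k in the series of (1 - x) ^ (- L).
  multichoose : ℕ → ℕ → ℕ
  multichoose L zero = 1
  multichoose zero (suc k) = 0
  multichoose (suc L) (suc k) = multichoose L (suc k) ℕ.+ multichoose (suc L) k

  -- The recursion in `k` that matches the factor 1 / (k + 1) in `expTerm`, up to the shift from `L`
  -- to `suc L`, which `multichoose-mono` absorbs.
  multichoose-absorb : ∀ L k → suc k ℕ.* multichoose L (suc k) ≡ L ℕ.* multichoose (suc L) k
  multichoose-absorb zero k = ℕₚ.*-zeroʳ (suc k)
  multichoose-absorb (suc L) zero = begin
    1 ℕ.* (multichoose L 1 ℕ.+ 1) ≡⟨ ℕₚ.*-distribˡ-+ 1 (multichoose L 1) 1 ⟩
    1 ℕ.* multichoose L 1 ℕ.+ 1 ≡⟨ cong (ℕ._+ 1) (multichoose-absorb L zero) ⟩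
    L ℕ.* 1 ℕ.+ 1 ≡⟨ ℕₚ.+-comm (L ℕ.* 1) 1 ⟩
    suc L ℕ.* 1 ∎
    where open ≡-Reasoning
  multichoose-absorb (suc L) (suc k) = begin
    suc (suc k) ℕ.* (x ℕ.+ y) ≡⟨ ℕₚ.*-distribˡ-+ (suc (suc k)) x y ⟩
    suc (suc k) ℕ.* x ℕ.+ suc (suc k) ℕ.* y ≡⟨ cong (ℕ._+ suc (suc k) ℕ.* y) (multichoose-absorb L (suc k)) ⟩
    L ℕ.* y ℕ.+ suc (suc k) ℕ.* y ≡⟨ lemma L k y ⟩
    suc L ℕ.* y ℕ.+ suc k ℕ.* y ≡⟨ cong (suc L ℕ.* y ℕ.+_) (multichoose-absorb (suc L) k) ⟩
    suc L ℕ.* y ℕ.+ suc L ℕ.* z ≡⟨ ℕₚ.*-distribˡ-+ (suc L) y z ⟨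
    suc L ℕ.* (y ℕ.+ z) ∎
    where
    open ≡-Reasoning
    x = multichoose L (suc (suc k))
    y = multichoose (suc L) (suc k)
    z = multichoose (suc (suc L)) k
    lemma : ∀ L k y → L ℕ.* y ℕ.+ suc (suc k) ℕ.* y ≡ suc L ℕ.* y ℕ.+ suc k ℕ.* y
    lemma = solve-∀

  multichoose-mono : ∀ L k → multichoose L k ℕ.≤ multichoose (suc L) k
  multichoose-mono L zero = ℕₚ.≤-refl
  multichoose-mono L (suc k) = ℕₚ.m≤m+n _ _

  -- 2 ^ n times the n-th partial sum of the series of (1 - x) ^ (- L) at x = 1 / 2.
  binomialSum : ℕ → ℕ → ℕ
  binomialSum L zero = 1
  binomialSum L (suc n) = 2 ℕ.* binomialSum L n ℕ.+ multichoose L (suc n)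

  -- Truncation of (1 - x) (1 - x) ^ (- (L + 1)) = (1 - x) ^ (- L) at x = 1 / 2, cleared of
  -- denominators.
  binomialSum-step : ∀ L n → binomialSum (suc L) (suc n) ≡ binomialSum L (suc n) ℕ.+ binomialSum (suc L) n
  binomialSum-step L zero = cong (2 ℕ.+_) (refl {x = multichoose L 1 ℕ.+ 1})
  binomialSum-step L (suc n) = begin
    2 ℕ.* binomialSum (suc L) (suc n) ℕ.+ (x ℕ.+ y)
      ≡⟨ cong (λ w → 2 ℕ.* w ℕ.+ (x ℕ.+ y)) (binomialSum-step L n) ⟩
    2 ℕ.* (binomialSum L (suc n) ℕ.+ binomialSum (suc L) n) ℕ.+ (x ℕ.+ y)
      ≡⟨ lemma (binomialSum L (suc n)) (binomialSum (suc L) n) x y ⟩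
    2 ℕ.* binomialSum L (suc n) ℕ.+ x ℕ.+ (2 ℕ.* binomialSum (suc L) n ℕ.+ y) ∎
    where
    open ≡-Reasoning
    x = multichoose L (suc (suc n))
    y = multichoose (suc L) (suc n)
    lemma : ∀ a b x y → 2 ℕ.* (a ℕ.+ b) ℕ.+ (x ℕ.+ y) ≡ 2 ℕ.* a ℕ.+ x ℕ.+ (2 ℕ.* b ℕ.+ y)
    lemma = solve-∀

  binomialSum-≤ : ∀ L n → binomialSum L n ℕ.≤ 2 ℕ.^ (L ℕ.+ n)
  binomialSum-≤ L zero = ℕₚ.m^n>0 2 (L ℕ.+ 0)
  binomialSum-≤ zero (suc n) = ℕₚ.≤-trans (ℕₚ.≤-reflexive (ℕₚ.+-identityʳ _)) (ℕₚ.*-monoʳ-≤ 2 (binomialSum-≤ zero n))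
  binomialSum-≤ (suc L) (suc n) = begin
    binomialSum (suc L) (suc n) ≡⟨ binomialSum-step L n ⟩
    binomialSum L (suc n) ℕ.+ binomialSum (suc L) n ≤⟨ ℕₚ.+-mono-≤ (binomialSum-≤ L (suc n)) (binomialSum-≤ (suc L) n) ⟩
    2 ℕ.^ (L ℕ.+ suc n) ℕ.+ 2 ℕ.^ (suc L ℕ.+ n) ≡⟨ cong (λ e → 2 ℕ.^ (L ℕ.+ suc n) ℕ.+ 2 ℕ.^ e) (sym (ℕₚ.+-suc L n)) ⟩
    2 ℕ.^ (L ℕ.+ suc n) ℕ.+ 2 ℕ.^ (L ℕ.+ suc n) ≡⟨ cong (2 ℕ.^ (L ℕ.+ suc n) ℕ.+_) (ℕₚ.+-identityʳ _) ⟨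
    2 ℕ.^ (suc L ℕ.+ suc n) ∎
    where open ℕₚ.≤-Reasoning

  ½^_ : ℕ → ℚ
  ½^ zero = 1ℚ
  ½^ suc n = ½^ n * ½

  0≤½^ : ∀ n → 0ℚ ≤ ½^ n
  0≤½^ zero = 0≤fromℕ 1
  0≤½^ (suc n) = 0≤* (0≤½^ n) (0≤/ 1 1)

  2^*½^ : ∀ n → fromℕ (2 ℕ.^ n) * ½^ n ≡ 1ℚ
  2^*½^ zero = refl
  2^*½^ (suc n) = begin
    fromℕ (2 ℕ.* 2 ℕ.^ n) * (½^ n * ½) ≡⟨ cong (_* (½^ n * ½)) (fromℕ-* 2 (2 ℕ.^ n)) ⟩
    fromℕ 2 * fromℕ (2 ℕ.^ n) * (½^ n * ½) ≡⟨ solve 4 (λ a b c d → a :* b :* (c :* d) := (d :* a) :* (b :* c)) refl (fromℕ 2) (fromℕ (2 ℕ.^ n)) (½^ n) ½ ⟩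
    ½ * fromℕ 2 * (fromℕ (2 ℕ.^ n) * ½^ n) ≡⟨ cong₂ _*_ (/-*-cancel 1 1) (2^*½^ n) ⟩
    1ℚ * 1ℚ ≡⟨⟩
    1ℚ ∎
    where
    open ≡-Reasoning
    open +-*-Solver

  /2≡*½ : ∀ a → + a / 2 ≡ fromℕ a * ½
  /2≡*½ a = begin
    + a / 2 ≡⟨ *-identityʳ (+ a / 2) ⟨
    (+ a / 2) * (fromℕ 2 * ½) ≡⟨ *-assoc (+ a / 2) (fromℕ 2) ½ ⟨
    (+ a / 2) * fromℕ 2 * ½ ≡⟨ cong (_* ½) (/-*-cancel a 1) ⟩
    fromℕ a * ½ ∎
    where open ≡-Reasoning

  -- exp (1 / 2) ≤ 2 in the form of a comparison of coefficients.
  expTerm-≤ : ∀ L k → expTerm (+ L / 2) k ≤ fromℕ (multichoose L k) * ½^ k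
  expTerm-≤ L zero = ≤-refl
  expTerm-≤ L (suc k) = begin
    expTerm q k * (q * inv)
      ≤⟨ *-monoʳ-≤-nonNeg (q * inv) {{nonNegative (0≤* (0≤/ L 1) (0≤/ 1 k))}} (expTerm-≤ L k) ⟩
    fromℕ b * ½^ k * (q * inv)
      ≡⟨ cong (λ x → fromℕ b * ½^ k * (x * inv)) (/2≡*½ L) ⟩
    fromℕ b * ½^ k * (fromℕ L * ½ * inv)
      ≡⟨ solve 5 (λ b h l c i → b :* h :* (l :* c :* i) := (l :* b) :* (i :* (h :* c))) refl (fromℕ b) (½^ k) (fromℕ L) ½ inv ⟩
    fromℕ L * fromℕ b * (inv * ½^ suc k)
      ≡⟨ cong (_* (inv * ½^ suc k)) (fromℕ-* L b) ⟨
    fromℕ (L ℕ.* b) * (inv * ½^ suc k)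
      ≤⟨ *-monoʳ-≤-nonNeg (inv * ½^ suc k) {{nonNegative (0≤* (0≤/ 1 k) (0≤½^ (suc k)))}} (fromℕ-mono-≤
           (ℕₚ.≤-trans (ℕₚ.*-monoʳ-≤ L (multichoose-mono L k)) (ℕₚ.≤-reflexive (sym (multichoose-absorb L k))))) ⟩
    fromℕ (suc k ℕ.* b′) * (inv * ½^ suc k)
      ≡⟨ cong (_* (inv * ½^ suc k)) (fromℕ-* (suc k) b′) ⟩
    fromℕ (suc k) * fromℕ b′ * (inv * ½^ suc k)
      ≡⟨ solve 4 (λ s b i h → s :* b :* (i :* h) := (i :* s) :* (b :* h)) refl (fromℕ (suc k)) (fromℕ b′) inv (½^ suc k) ⟩
    inv * fromℕ (suc k) * (fromℕ b′ * ½^ suc k)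
      ≡⟨ cong (_* (fromℕ b′ * ½^ suc k)) (/-*-cancel 1 k) ⟩
    1ℚ * (fromℕ b′ * ½^ suc k)
      ≡⟨ *-identityˡ _ ⟩
    fromℕ b′ * ½^ suc k ∎
    where
    open ≤-Reasoning
    open +-*-Solver
    q = + L / 2
    inv = + 1 / suc k
    b = multichoose L k
    b′ = multichoose L (suc k)

  expSum-≤ : ∀ L n → expSum (+ L / 2) n ≤ fromℕ (binomialSum L n) * ½^ n
  expSum-≤ L zero = ≤-refl
  expSum-≤ L (suc n) = begin
    expSum q n + expTerm q (suc n)
      ≤⟨ +-mono-≤ (expSum-≤ L n) (expTerm-≤ L (suc n)) ⟩
    fromℕ S * ½^ n + fromℕ b * ½^ suc n
      ≡⟨ cong (λ x → fromℕ S * x + fromℕ b * ½^ suc n) (trans (sym (*-identityʳ (½^ n))) refl) ⟩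
    fromℕ S * (½^ n * (½ * fromℕ 2)) + fromℕ b * (½^ n * ½)
      ≡⟨ solve 5 (λ s h c t b → s :* (h :* (c :* t)) :+ b :* (h :* c) := (t :* s :+ b) :* (h :* c)) refl (fromℕ S) (½^ n) ½ (fromℕ 2) (fromℕ b) ⟩
    (fromℕ 2 * fromℕ S + fromℕ b) * ½^ suc n
      ≡⟨ cong (λ x → (x + fromℕ b) * ½^ suc n) (fromℕ-* 2 S) ⟨
    (fromℕ (2 ℕ.* S) + fromℕ b) * ½^ suc n
      ≡⟨ cong (_* ½^ suc n) (fromℕ-+ (2 ℕ.* S) b) ⟨
    fromℕ (binomialSum L (suc n)) * ½^ suc n ∎
    where
    open ≤-Reasoning
    open +-*-Solver
    q = + L / 2
    S = binomialSum L n
    b = multichoose L (suc n)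

  -- All partial sums of exp (L / 2) stay below (1 - 1 / 2) ^ (- L) = 2 ^ L. The loss against the
  -- true logarithm is a constant factor, which the error term tolerates.
  ln-≥ : ∀ {L t} → 2 ℕ.^ L ℕ.≤ t → (+ L / 2) ≤ᶜ ln t
  ln-≥ {L} {t} 2^L≤t _ n = begin
    expSum (+ L / 2) n ≤⟨ expSum-≤ L n ⟩
    fromℕ (binomialSum L n) * ½^ n ≤⟨ *-monoʳ-≤-nonNeg (½^ n) {{nonNegative (0≤½^ n)}} (fromℕ-mono-≤ bound) ⟩
    fromℕ (t ℕ.* 2 ℕ.^ n) * ½^ n ≡⟨ cong (_* ½^ n) (fromℕ-* t (2 ℕ.^ n)) ⟩
    fromℕ t * fromℕ (2 ℕ.^ n) * ½^ n ≡⟨ *-assoc (fromℕ t) (fromℕ (2 ℕ.^ n)) (½^ n) ⟩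
    fromℕ t * (fromℕ (2 ℕ.^ n) * ½^ n) ≡⟨ cong (fromℕ t *_) (2^*½^ n) ⟩
    fromℕ t * 1ℚ ≡⟨ *-identityʳ (fromℕ t) ⟩
    fromℕ t ∎
    where
    open ≤-Reasoning
    bound : binomialSum L n ℕ.≤ t ℕ.* 2 ℕ.^ n
    bound = ℕₚ.≤-trans (binomialSum-≤ L n)
      (ℕₚ.≤-trans (ℕₚ.≤-reflexive (ℕₚ.^-distribˡ-+-* 2 L n)) (ℕₚ.*-monoˡ-≤ (2 ℕ.^ n) 2^L≤t))

-- From inequalities between natural numbers to the cuts of the theorem.

module RealBounds where
  open import Defs
  open RationalBounds

  open import Data.Nat as ℕ using (ℕ; suc)
  import Data.Nat.Properties as ℕₚ
  open import Data.Integer using (+_)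
  open import Data.Rational using (ℚ; 0ℚ; ½; _+_; _*_; _-_; -_; _≤_; _<_; _/_; _≤?_; _<?_; Positive; positive)
  import Data.Rational.Properties as ℚₚ
  open import Data.Rational.Solver using (module +-*-Solver)
  open import Data.Product using (_,_)
  open import Relation.Nullary.Decidable using (from-yes)
  open import Relation.Binary.PropositionalEquality
  open ℚₚ.≤-Reasoning

  0<fromℕ-suc : ∀ n → 0ℚ < fromℕ (suc n)
  0<fromℕ-suc n = ℚₚ.<-≤-trans (from-yes (0ℚ <? fromℕ 1)) (fromℕ-mono-≤ (ℕ.s≤s (ℕ.z≤n {n})))

  ≤+⇒-≤ : ∀ {p q r} → p ≤ q + r → p - q ≤ r
  ≤+⇒-≤ {p} {q} {r} p≤q+r = begin
    p - q ≤⟨ ℚₚ.+-monoˡ-≤ (- q) p≤q+r ⟩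
    q + r - q ≡⟨ solve 2 (λ q r → q :+ r :- q := r) refl q r ⟩
    r ∎
    where open +-*-Solver

  module _ (P : ℕ) where
    private instance
      fromℕ-suc-positive : Positive (fromℕ (suc P))
      fromℕ-suc-positive = positive (0<fromℕ-suc P)

    clear-denominator : ∀ Q t → fromℕ (suc P) * ((+ Q / suc P) * fromℕ t) ≡ fromℕ (Q ℕ.* t)
    clear-denominator Q t = begin-equality
      fromℕ (suc P) * ((+ Q / suc P) * fromℕ t)
        ≡⟨ solve 3 (λ p q t → p :* (q :* t) := (q :* p) :* t) refl (fromℕ (suc P)) (+ Q / suc P) (fromℕ t) ⟩
      (+ Q / suc P) * fromℕ (suc P) * fromℕ t
        ≡⟨ cong (_* fromℕ t) (/-*-cancel Q P) ⟩
      fromℕ Q * fromℕ t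
        ≡⟨ fromℕ-* Q t ⟨
      fromℕ (Q ℕ.* t) ∎
      where open +-*-Solver

    upper-bound : ∀ Q t n C → suc P ℕ.* n ℕ.≤ Q ℕ.* t ℕ.+ C →
      fromℕ n ≤ (+ Q / suc P) * fromℕ t + fromℕ C
    upper-bound Q t n C Pn≤ = ℚₚ.*-cancelˡ-≤-pos (fromℕ (suc P)) (begin
      fromℕ (suc P) * fromℕ n ≡⟨ fromℕ-* (suc P) n ⟨
      fromℕ (suc P ℕ.* n) ≤⟨ fromℕ-mono-≤ (ℕₚ.≤-trans Pn≤ (ℕₚ.+-monoʳ-≤ (Q ℕ.* t) (ℕₚ.m≤n*m C (suc P)))) ⟩
      fromℕ (Q ℕ.* t ℕ.+ suc P ℕ.* C) ≡⟨ fromℕ-+ (Q ℕ.* t) (suc P ℕ.* C) ⟩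
      fromℕ (Q ℕ.* t) + fromℕ (suc P ℕ.* C) ≡⟨ cong₂ _+_ (sym (clear-denominator Q t)) (fromℕ-* (suc P) C) ⟩
      fromℕ (suc P) * ((+ Q / suc P) * fromℕ t) + fromℕ (suc P) * fromℕ C
                                                      ≡⟨ ℚₚ.*-distribˡ-+ (fromℕ (suc P)) ((+ Q / suc P) * fromℕ t) (fromℕ C) ⟨
      fromℕ (suc P) * ((+ Q / suc P) * fromℕ t + fromℕ C) ∎)

    lower-bound : ∀ Q t n C y → Q ℕ.* t ℕ.≤ suc P ℕ.* n ℕ.+ suc P ℕ.* (C ℕ.* y) →
      (+ Q / suc P) * fromℕ t - fromℕ n ≤ fromℕ (2 ℕ.* C) * (+ y / 2)
    lower-bound Q t n C y Qt≤ = ≤+⇒-≤ (ℚₚ.*-cancelˡ-≤-pos (fromℕ (suc P)) (begin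
      fromℕ (suc P) * ((+ Q / suc P) * fromℕ t)
        ≡⟨ clear-denominator Q t ⟩
      fromℕ (Q ℕ.* t)
        ≤⟨ fromℕ-mono-≤ (ℕₚ.≤-trans Qt≤ (ℕₚ.≤-reflexive (sym (ℕₚ.*-distribˡ-+ (suc P) n (C ℕ.* y))))) ⟩
      fromℕ (suc P ℕ.* (n ℕ.+ C ℕ.* y))
        ≡⟨ fromℕ-* (suc P) (n ℕ.+ C ℕ.* y) ⟩
      fromℕ (suc P) * fromℕ (n ℕ.+ C ℕ.* y)
        ≡⟨ cong (fromℕ (suc P) *_) (fromℕ-+ n (C ℕ.* y)) ⟩
      fromℕ (suc P) * (fromℕ n + fromℕ (C ℕ.* y))
        ≡⟨ cong (λ z → fromℕ (suc P) * (fromℕ n + z)) halve ⟩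
      fromℕ (suc P) * (fromℕ n + fromℕ (2 ℕ.* C) * (+ y / 2)) ∎))
      where
      halve : fromℕ (C ℕ.* y) ≡ fromℕ (2 ℕ.* C) * (+ y / 2)
      halve = begin-equality
        fromℕ (C ℕ.* y) ≡⟨ fromℕ-* C y ⟩
        fromℕ C * fromℕ y ≡⟨ cong (fromℕ C *_) (/-*-cancel y 1) ⟨
        fromℕ C * ((+ y / 2) * fromℕ 2) ≡⟨ solve 3 (λ c y t → c :* (y :* t) := (t :* c) :* y) refl (fromℕ C) (+ y / 2) (fromℕ 2) ⟩
        fromℕ 2 * fromℕ C * (+ y / 2) ≡⟨ cong (_* (+ y / 2)) (fromℕ-* 2 C) ⟨
        fromℕ (2 ℕ.* C) * (+ y / 2) ∎
        where open +-*-Solver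

  -- The witness below ln t is L / 2. Halving `y` as well leaves room, because (1 / 2)² ≤ 1 / 2.
  √-≥ : ∀ {t L y} → 2 ℕ.^ L ℕ.≤ t → y ℕ.* y ℕ.≤ t ℕ.* L → (+ y / 2) ≤ᶜ √ (fromℕ t · ln t)
  √-≥ {t} {L} {y} 2^L≤t y²≤tL _ = + L / 2 , ln-≥ {L} {t} 2^L≤t , (begin
    (+ y / 2) * (+ y / 2) ≡⟨ cong₂ _*_ (/2≡*½ y) (/2≡*½ y) ⟩
    fromℕ y * ½ * (fromℕ y * ½) ≡⟨ solve 2 (λ y h → (y :* h) :* (y :* h) := (y :* y) :* (h :* h)) refl (fromℕ y) ½ ⟩
    fromℕ y * fromℕ y * (½ * ½) ≡⟨ cong (_* (½ * ½)) (fromℕ-* y y) ⟨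
    fromℕ (y ℕ.* y) * (½ * ½) ≤⟨ *-mono-≤-0≤ (0≤fromℕ (y ℕ.* y)) (from-yes (0ℚ ≤? ½))
                                                     (fromℕ-mono-≤ y²≤tL) (from-yes (½ * ½ ≤? ½)) ⟩
    fromℕ (t ℕ.* L) * ½ ≡⟨ cong (_* ½) (fromℕ-* t L) ⟩
    fromℕ t * fromℕ L * ½ ≡⟨ ℚₚ.*-assoc (fromℕ t) (fromℕ L) ½ ⟩
    fromℕ t * (fromℕ L * ½) ≡⟨ cong (fromℕ t *_) (/2≡*½ L) ⟨
    fromℕ t * (+ L / 2) ∎)
    where open +-*-Solver

open import Data.Nat hiding (_≟_)
open import Data.Nat.Properties hiding (_≟_; suc-injective)
open import Data.Nat.Tactic.RingSolver using (solve-∀)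
open import Data.Bool using (Bool; true; false)
open import Data.Fin using (Fin; zero; suc)
open import Data.List using (List; []; _∷_; length)
open import Data.List.Relation.Unary.Any using (here; there)
open import Data.Product using (∃; Σ; _×_; _,_; proj₁; proj₂)
open import Data.Sum using (_⊎_; inj₁; inj₂; [_,_]′)
open import Data.Vec using (Vec; []; _∷_; tabulate; lookup; map; replicate)
open import Data.Vec.Relation.Unary.All as All using (All; []; _∷_)
import Data.Vec.Relation.Unary.All.Properties as Allₚ
open import Function using (_∘_; id)
open import Function.Definitions using (Injective)
open import Relation.Nullary using (Dec; yes; no; does; ¬_; contradiction)
open import Relation.Nullary.Decidable
  using (map′; dec-true; dec-false; does-⇔; ¬?; _×-dec_; _⊎-dec_; _→-dec_; decidable-stable; from-yes)
open import Relation.Binary.PropositionalEquality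
open import Algebra.Properties.Semiring.Sum +-*-semiring
  using (sum; sum-cong-≗; ∑-distrib-+; ∑-comm; *-distribˡ-sum)

-- Exhaustive search, sums over tuples, and the count of switching tuples.

module FiniteSums where
  import Data.Fin.Properties as Finₚ
  import Data.List.Membership.DecPropositional as DecMembership
  open import Data.List.Membership.Propositional using (_∉_)
  open import Data.Unit using (⊤; tt)

  -- Quantifying over all decidable predicates lets searches be nested, so that vectors and matrices
  -- of colours can be searched too.
  Searchable : Set → Set₁
  Searchable A = ∀ {P : A → Set} → (∀ x → Dec (P x)) → Dec (∃ P)

  search-Fin : ∀ {n} → Searchable (Fin n)
  search-Fin = Finₚ.any?

  search-Vec : ∀ {A} → Searchable A → ∀ n → Searchable (Vec A n)
  search-Vec search zero P? = map′ ([] ,_) (λ { ([] , p) → p }) (P? [])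
  search-Vec search (suc n) P? =
    map′ (λ (x , xs , p) → x ∷ xs , p) (λ { (x ∷ xs , p) → x , xs , p })
      (search λ x → search-Vec search n λ xs → P? (x ∷ xs))

  sum-mono : ∀ {n} {f g : Fin n → ℕ} → (∀ i → f i ≤ g i) → sum f ≤ sum g
  sum-mono {zero} f≤g = z≤n
  sum-mono {suc n} f≤g = +-mono-≤ (f≤g zero) (sum-mono (f≤g ∘ suc))

  sum-const : ∀ n c → sum {n} (λ _ → c) ≡ n * c
  sum-const zero c = refl
  sum-const (suc n) c = cong (c +_) (sum-const n c)

  *-sum : ∀ {n} c (f : Fin n → ℕ) → sum (λ i → c * f i) ≡ c * sum f
  *-sum c f = sym (*-distribˡ-sum c f)

  sum-* : ∀ {n} c (f : Fin n → ℕ) → sum (λ i → f i * c) ≡ sum f * c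
  sum-* c f = trans (sum-cong-≗ (λ i → *-comm (f i) c)) (trans (*-sum c f) (*-comm c _))

  𝟙 : Bool → ℕ
  𝟙 true = 1
  𝟙 false = 0

  𝟙≤1 : ∀ b → 𝟙 b ≤ 1
  𝟙≤1 true = ≤-refl
  𝟙≤1 false = z≤n

  𝟙-mono : ∀ {P : Set} (P? : Dec P) {m} → m ≤ 1 → (1 ≤ m → P) → m ≤ 𝟙 (does P?)
  𝟙-mono P? {zero} m≤1 p = z≤n
  𝟙-mono P? {suc zero} m≤1 p rewrite dec-true P? (p ≤-refl) = ≤-refl
  𝟙-mono P? {suc (suc m)} (s≤s ()) p

  𝟙-true : ∀ {P : Set} (P? : Dec P) → P → 1 ≤ 𝟙 (does P?)
  𝟙-true P? p rewrite dec-true P? p = ≤-refl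

  𝟙-≤ : ∀ {P : Set} (P? : Dec P) {m} → (P → 1 ≤ m) → 𝟙 (does P?) ≤ m
  𝟙-≤ (yes p) f = f p
  𝟙-≤ (no _) f = z≤n

  does⇒ : ∀ {P : Set} (P? : Dec P) → does P? ≡ true → P
  does⇒ (yes p) _ = p

  member≤sum : ∀ {n} (f : Fin n → ℕ) i → f i ≤ sum f
  member≤sum f zero = m≤m+n (f zero) _
  member≤sum f (suc i) = ≤-trans (member≤sum (f ∘ suc) i) (m≤n+m _ (f zero))

  sum-𝟙≟ : ∀ {n} (z : Fin n) → sum (λ a → 𝟙 (does (a Finₚ.≟ z))) ≡ 1
  sum-𝟙≟ {suc n} zero = cong suc (trans (sum-const n 0) (*-zeroʳ n))
  sum-𝟙≟ {suc n} (suc z) = sum-𝟙≟ z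

  ∑ᵗ : ∀ {n} s → (Vec (Fin n) s → ℕ) → ℕ
  ∑ᵗ zero F = F []
  ∑ᵗ (suc s) F = sum λ a → ∑ᵗ s λ as → F (a ∷ as)

  ∑ᵗ-mono : ∀ {n} s {F G : Vec (Fin n) s → ℕ} → (∀ a → F a ≤ G a) → ∑ᵗ s F ≤ ∑ᵗ s G
  ∑ᵗ-mono zero F≤G = F≤G []
  ∑ᵗ-mono (suc s) F≤G = sum-mono λ a → ∑ᵗ-mono s λ as → F≤G (a ∷ as)

  ∑ᵗ-cong : ∀ {n} s {F G : Vec (Fin n) s → ℕ} → (∀ a → F a ≡ G a) → ∑ᵗ s F ≡ ∑ᵗ s G
  ∑ᵗ-cong zero F≡G = F≡G []
  ∑ᵗ-cong (suc s) F≡G = sum-cong-≗ λ a → ∑ᵗ-cong s λ as → F≡G (a ∷ as)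

  ∑ᵗ-const : ∀ {n} s c → ∑ᵗ {n} s (λ _ → c) ≡ n ^ s * c
  ∑ᵗ-const zero c = sym (+-identityʳ c)
  ∑ᵗ-const {n} (suc s) c = begin
    sum {n} (λ _ → ∑ᵗ s (λ _ → c)) ≡⟨ sum-const n _ ⟩
    n * ∑ᵗ s (λ _ → c) ≡⟨ cong (n *_) (∑ᵗ-const s c) ⟩
    n * (n ^ s * c) ≡⟨ *-assoc n (n ^ s) c ⟨
    n ^ suc s * c ∎
    where open ≡-Reasoning

  ∑ᵗ-+ : ∀ {n} s (F G : Vec (Fin n) s → ℕ) → ∑ᵗ s (λ a → F a + G a) ≡ ∑ᵗ s F + ∑ᵗ s G
  ∑ᵗ-+ zero F G = refl
  ∑ᵗ-+ (suc s) F G =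
    trans (sum-cong-≗ λ a → ∑ᵗ-+ s (λ as → F (a ∷ as)) (λ as → G (a ∷ as)))
      (∑-distrib-+ (λ a → ∑ᵗ s (λ as → F (a ∷ as))) (λ a → ∑ᵗ s (λ as → G (a ∷ as))))

  ∑ᵗ-* : ∀ {n} s c (F : Vec (Fin n) s → ℕ) → ∑ᵗ s (λ a → c * F a) ≡ c * ∑ᵗ s F
  ∑ᵗ-* zero c F = refl
  ∑ᵗ-* (suc s) c F =
    trans (sum-cong-≗ λ a → ∑ᵗ-* s c (λ as → F (a ∷ as))) (*-sum c λ a → ∑ᵗ s λ as → F (a ∷ as))

  ∑ᵗ-sum : ∀ {n m} s (F : Fin m → Vec (Fin n) s → ℕ) →
    ∑ᵗ s (λ a → sum λ w → F w a) ≡ sum (λ w → ∑ᵗ s (F w))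
  ∑ᵗ-sum zero F = refl
  ∑ᵗ-sum (suc s) F =
    trans (sum-cong-≗ λ a → ∑ᵗ-sum s (λ w as → F w (a ∷ as))) (∑-comm λ a w → ∑ᵗ s λ as → F w (a ∷ as))

  ∑ᵗ-bound : ∀ {n} s {F : Vec (Fin n) s → ℕ} {B} → (∀ a → F a ≤ B) → ∑ᵗ s F ≤ n ^ s * B
  ∑ᵗ-bound s {B = B} F≤B = ≤-trans (∑ᵗ-mono s F≤B) (≤-reflexive (∑ᵗ-const s B))

  module _ {n : ℕ} where
    open DecMembership (Finₚ._≟_ {n}) using (_∈?_)

    Fresh : ∀ {s} → List (Fin n) → Vec (Fin n) s → Set
    Fresh Z [] = ⊤
    Fresh Z (a ∷ as) = a ∉ Z × Fresh (a ∷ Z) as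

    fresh? : ∀ {s} Z (as : Vec (Fin n) s) → Dec (Fresh Z as)
    fresh? Z [] = yes tt
    fresh? Z (a ∷ as) = ¬? (a ∈? Z) ×-dec fresh? (a ∷ Z) as

    sum-𝟙∈ : ∀ Z → sum (λ a → 𝟙 (does (a ∈? Z))) ≤ length Z
    sum-𝟙∈ [] = ≤-reflexive (trans (sum-const n 0) (*-zeroʳ n))
    sum-𝟙∈ (z ∷ Z) = begin
      sum (λ a → 𝟙 (does (a ∈? (z ∷ Z)))) ≤⟨ sum-mono split ⟩
      sum (λ a → 𝟙 (does (a Finₚ.≟ z)) + 𝟙 (does (a ∈? Z))) ≡⟨ ∑-distrib-+ (λ a → 𝟙 (does (a Finₚ.≟ z))) (λ a → 𝟙 (does (a ∈? Z))) ⟩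
      sum (λ a → 𝟙 (does (a Finₚ.≟ z))) + sum (λ a → 𝟙 (does (a ∈? Z)))
                                                            ≤⟨ +-mono-≤ (≤-reflexive (sum-𝟙≟ z)) (sum-𝟙∈ Z) ⟩
      suc (length Z) ∎
      where
      open ≤-Reasoning
      split : ∀ a → 𝟙 (does (a ∈? (z ∷ Z))) ≤ 𝟙 (does (a Finₚ.≟ z)) + 𝟙 (does (a ∈? Z))
      split a with a Finₚ.≟ z | a ∈? Z
      ... | yes _ | yes _ = s≤s z≤n
      ... | yes _ | no _ = ≤-refl
      ... | no _ | yes _ = ≤-refl
      ... | no _ | no _ = ≤-refl

    -- Each of the `s` entries has fewer than |Z| + s forbidden values, so at most s (|Z| + s) n ^
    -- (s - 1) tuples are not `Fresh`; for these only the bound `B` is available. The factor `n` on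
    -- the left avoids the exponent s - 1.
    sum-fresh-bounded : ∀ s Z (F : Vec (Fin n) s → ℕ) {B τ} →
      (∀ a → F a ≤ B) → (∀ a → Fresh Z a → F a ≤ τ) →
      n * ∑ᵗ s F ≤ n ^ s * (τ * n + B * (s * (length Z + s)))
    sum-fresh-bounded zero Z F {B} {τ} F≤B F≤τ = begin
      n * F [] ≤⟨ *-monoʳ-≤ n (F≤τ [] tt) ⟩
      n * τ ≡⟨ lemma n τ B ⟩
      1 * (τ * n + B * 0) ∎
      where
      open ≤-Reasoning
      lemma : ∀ n τ B → n * τ ≡ 1 * (τ * n + B * 0)
      lemma = solve-∀
    sum-fresh-bounded (suc s) Z F {B} {τ} F≤B F≤τ = begin
      n * sum (λ a → ∑ᵗ s (F ∘ (a ∷_))) ≡⟨ *-sum n (λ a → ∑ᵗ s (F ∘ (a ∷_))) ⟨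
      sum (λ a → n * ∑ᵗ s (F ∘ (a ∷_))) ≤⟨ sum-mono each ⟩
      sum (λ a → X + 𝟙 (does (a ∈? Z)) * Y)
        ≡⟨ ∑-distrib-+ (λ a → X) (λ a → 𝟙 (does (a ∈? Z)) * Y) ⟩
      sum {n} (λ a → X) + sum (λ a → 𝟙 (does (a ∈? Z)) * Y)
        ≡⟨ cong₂ _+_ (sum-const n X) (sum-* Y (λ a → 𝟙 (does (a ∈? Z)))) ⟩
      n * X + sum (λ a → 𝟙 (does (a ∈? Z))) * Y
        ≤⟨ +-monoʳ-≤ (n * X) (*-monoˡ-≤ Y (sum-𝟙∈ Z)) ⟩
      n * X + length Z * Y
        ≤⟨ m≤m+n _ (suc s * Y) ⟩
      n * X + length Z * Y + suc s * Y
        ≡⟨ lemma n (n ^ s) τ B s (length Z) ⟩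
      n * n ^ s * (τ * n + B * (suc s * (length Z + suc s))) ∎
      where
      open ≤-Reasoning
      X = n ^ s * (τ * n + B * (s * (suc (length Z) + s)))
      Y = n * n ^ s * B
      lemma : ∀ n p τ B s z →
        n * (p * (τ * n + B * (s * (suc z + s)))) + z * (n * p * B) + suc s * (n * p * B)
        ≡ n * p * (τ * n + B * (suc s * (z + suc s)))
      lemma = solve-∀
      each : ∀ a → n * ∑ᵗ s (F ∘ (a ∷_)) ≤ X + 𝟙 (does (a ∈? Z)) * Y
      each a with a ∈? Z
      ... | no a∉Z = ≤-trans
        (sum-fresh-bounded s (a ∷ Z) (F ∘ (a ∷_)) (F≤B ∘ (a ∷_)) (λ as fr → F≤τ (a ∷ as) (a∉Z , fr)))
        (m≤m+n X 0)
      ... | yes _ = begin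
        n * ∑ᵗ s (F ∘ (a ∷_)) ≤⟨ *-monoʳ-≤ n (∑ᵗ-bound s (F≤B ∘ (a ∷_))) ⟩
        n * (n ^ s * B) ≡⟨ *-assoc n (n ^ s) B ⟨
        Y ≤⟨ m≤n+m Y X ⟩
        X + Y ≡⟨ cong (X +_) (+-identityʳ Y) ⟨
        X + (Y + 0) ∎

    fresh-large : ∀ s Z (F : Vec (Fin n) s → ℕ) {B τ} → (∀ a → F a ≤ B) →
      n ^ s * (τ * n + B * (s * (length Z + s))) < n * ∑ᵗ s F →
      ∃ λ a → Fresh Z a × τ < F a
    fresh-large s Z F {τ = τ} F≤B large
      with search-Vec search-Fin s (λ a → fresh? Z a ×-dec (τ <? F a))
    ... | yes found = found
    ... | no none = contradiction
      (sum-fresh-bounded s Z F F≤B λ a fr → ≮⇒≥ λ τ<Fa → none (a , fr , τ<Fa))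
      (<⇒≱ large)

  -- Weighted count of the tuples of which an initial segment lies in R and the
  -- rest in B.
  module _ {n : ℕ} (R B : Fin n → Bool) where

    allIn : ∀ {s} → Vec (Fin n) s → ℕ
    allIn [] = 1
    allIn (a ∷ as) = 𝟙 (B a) * allIn as

    switch : ∀ {s} → Vec (Fin n) s → ℕ
    switch [] = 1
    switch (a ∷ as) = 𝟙 (R a) * switch as + 𝟙 (B a) * allIn as

    allIn≤1 : ∀ {s} (as : Vec (Fin n) s) → allIn as ≤ 1
    allIn≤1 [] = ≤-refl
    allIn≤1 (a ∷ as) = *-mono-≤ (𝟙≤1 (B a)) (allIn≤1 as)

    switch≤1 : (∀ a → R a ≡ true → B a ≡ false) → ∀ {s} (as : Vec (Fin n) s) → switch as ≤ 1
    switch≤1 disj [] = ≤-refl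
    switch≤1 disj (a ∷ as) with R a in Ra
    ... | false = *-mono-≤ (𝟙≤1 (B a)) (allIn≤1 as)
    ... | true rewrite disj a Ra | +-identityʳ (switch as) | +-identityʳ (switch as) = switch≤1 disj as

    ∑ᵗ-allIn : ∀ s → ∑ᵗ s allIn ≡ sum (𝟙 ∘ B) ^ s
    ∑ᵗ-allIn zero = refl
    ∑ᵗ-allIn (suc s) = begin
      sum (λ a → ∑ᵗ s (λ as → 𝟙 (B a) * allIn as)) ≡⟨ sum-cong-≗ (λ a → ∑ᵗ-* s (𝟙 (B a)) allIn) ⟩
      sum (λ a → 𝟙 (B a) * ∑ᵗ s allIn) ≡⟨ sum-* (∑ᵗ s allIn) (𝟙 ∘ B) ⟩
      sum (𝟙 ∘ B) * ∑ᵗ s allIn ≡⟨ cong (sum (𝟙 ∘ B) *_) (∑ᵗ-allIn s) ⟩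
      sum (𝟙 ∘ B) * sum (𝟙 ∘ B) ^ s ∎
      where open ≡-Reasoning

  -- The sum of d ^ j * e ^ (s - j) over 0 ≤ j ≤ s.
  mixed : ℕ → ℕ → ℕ → ℕ
  mixed d e zero = 1
  mixed d e (suc s) = d * mixed d e s + e * e ^ s

  ∑ᵗ-switch : ∀ {n} (R B : Fin n → Bool) s →
    ∑ᵗ s (switch R B) ≡ mixed (sum (𝟙 ∘ R)) (sum (𝟙 ∘ B)) s
  ∑ᵗ-switch R B zero = refl
  ∑ᵗ-switch R B (suc s) = begin
    sum (λ a → ∑ᵗ s (λ as → 𝟙 (R a) * switch R B as + 𝟙 (B a) * allIn R B as))
      ≡⟨ sum-cong-≗ (λ a → trans (∑ᵗ-+ s (λ as → 𝟙 (R a) * switch R B as) (λ as → 𝟙 (B a) * allIn R B as))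
           (cong₂ _+_ (∑ᵗ-* s (𝟙 (R a)) (switch R B)) (∑ᵗ-* s (𝟙 (B a)) (allIn R B)))) ⟩
    sum (λ a → 𝟙 (R a) * ∑ᵗ s (switch R B) + 𝟙 (B a) * ∑ᵗ s (allIn R B))
      ≡⟨ ∑-distrib-+ (λ a → 𝟙 (R a) * ∑ᵗ s (switch R B)) (λ a → 𝟙 (B a) * ∑ᵗ s (allIn R B)) ⟩
    sum (λ a → 𝟙 (R a) * ∑ᵗ s (switch R B)) + sum (λ a → 𝟙 (B a) * ∑ᵗ s (allIn R B))
      ≡⟨ cong₂ _+_ (sum-* (∑ᵗ s (switch R B)) (𝟙 ∘ R)) (sum-* (∑ᵗ s (allIn R B)) (𝟙 ∘ B)) ⟩
    sum (𝟙 ∘ R) * ∑ᵗ s (switch R B) + sum (𝟙 ∘ B) * ∑ᵗ s (allIn R B)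
      ≡⟨ cong₂ (λ x y → sum (𝟙 ∘ R) * x + sum (𝟙 ∘ B) * y) (∑ᵗ-switch R B s) (∑ᵗ-allIn R B s) ⟩
    mixed (sum (𝟙 ∘ R)) (sum (𝟙 ∘ B)) (suc s) ∎
    where open ≡-Reasoning

-- The inequality that produces the fraction (s + 1) / 2 ^ s.

module Averaging where
  open FiniteSums

  rearrangement : ∀ {a b c d} → a ≤ b → c ≤ d → a * d + b * c ≤ a * c + b * d
  rearrangement {a} {c = c} a≤b c≤d with m≤n⇒∃[o]m+o≡n a≤b | m≤n⇒∃[o]m+o≡n c≤d
  ... | x , refl | y , refl =
    ≤-trans (m≤m+n _ (x * y)) (≤-reflexive (lemma a x c y))
    where
    lemma : ∀ a x c y → a * (c + y) + (a + x) * c + x * y ≡ a * c + (a + x) * (c + y)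
    lemma = solve-∀

  chebyshev-powers : ∀ d e s → d * e ^ s + e * d ^ s ≤ d ^ suc s + e ^ suc s
  chebyshev-powers d e s with ≤-total d e
  ... | inj₁ d≤e = rearrangement d≤e (^-monoˡ-≤ s d≤e)
  ... | inj₂ e≤d = begin
    d * e ^ s + e * d ^ s ≡⟨ +-comm (d * e ^ s) (e * d ^ s) ⟩
    e * d ^ s + d * e ^ s ≤⟨ rearrangement e≤d (^-monoˡ-≤ s e≤d) ⟩
    e * e ^ s + d * d ^ s ≡⟨ +-comm (e * e ^ s) (d * d ^ s) ⟩
    d * d ^ s + e * e ^ s ∎
    where open ≤-Reasoning

  -- The recursion of `mixed` with the roles of `d` and `e` exchanged; adding both recursions gives
  -- `mixed-average`.
  mixed-e : ∀ d e s → e * mixed d e s + d * d ^ s ≡ mixed d e (suc s)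
  mixed-e d e zero = lemma d e
    where
    lemma : ∀ d e → e * 1 + d * 1 ≡ d * 1 + e * 1
    lemma = solve-∀
  mixed-e d e (suc s) = begin
    e * (d * mixed d e s + e * e ^ s) + d * (d * d ^ s)
      ≡⟨ lemma d e (mixed d e s) (e ^ s) (d ^ s) ⟩
    d * (e * mixed d e s + d * d ^ s) + e * (e * e ^ s)
      ≡⟨ cong (λ x → d * x + e * (e * e ^ s)) (mixed-e d e s) ⟩
    mixed d e (suc (suc s)) ∎
    where
    open ≡-Reasoning
    lemma : ∀ d e m x y → e * (d * m + e * x) + d * (d * y) ≡ d * (e * m + d * y) + e * (e * x)
    lemma = solve-∀

  mixed-average : ∀ d e s → 2 * mixed d e (suc s) ≡ (d + e) * mixed d e s + (d ^ suc s + e ^ suc s)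
  mixed-average d e s = begin
    2 * mixed d e (suc s)
      ≡⟨ cong (mixed d e (suc s) +_) (trans (+-identityʳ _) (sym (mixed-e d e s))) ⟩
    d * mixed d e s + e * e ^ s + (e * mixed d e s + d * d ^ s)
      ≡⟨ lemma d e (mixed d e s) (d ^ suc s) (e ^ suc s) ⟩
    (d + e) * mixed d e s + (d ^ suc s + e ^ suc s) ∎
    where
    open ≡-Reasoning
    lemma : ∀ d e m x y → d * m + y + (e * m + x) ≡ (d + e) * m + (x + y)
    lemma = solve-∀

  -- The terms d ^ j e ^ (s - j) and d ^ (s - j) e ^ j together are at most d ^ s + e ^ s. The
  -- induction needs this only in the form of `chebyshev-powers`.
  mixed-powers : ∀ d e s → 2 * mixed d e s ≤ suc s * (d ^ s + e ^ s)
  mixed-powers d e zero = ≤-refl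
  mixed-powers d e (suc s) = *-cancelˡ-≤ 2 (begin
    2 * (2 * mixed d e (suc s))
      ≡⟨ cong (2 *_) (mixed-average d e s) ⟩
    2 * ((d + e) * mixed d e s + T)
      ≡⟨ lemma₁ (d + e) (mixed d e s) T ⟩
    (d + e) * (2 * mixed d e s) + 2 * T
      ≤⟨ +-monoˡ-≤ (2 * T) (*-monoʳ-≤ (d + e) (mixed-powers d e s)) ⟩
    (d + e) * (suc s * (d ^ s + e ^ s)) + 2 * T
      ≡⟨ lemma₂ d e s (d ^ s) (e ^ s) ⟩
    suc s * (T + (d * e ^ s + e * d ^ s)) + 2 * T
      ≤⟨ +-monoˡ-≤ (2 * T) (*-monoʳ-≤ (suc s) (+-monoʳ-≤ T (chebyshev-powers d e s))) ⟩
    suc s * (T + T) + 2 * T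
      ≡⟨ lemma₃ s T ⟩
    2 * (suc (suc s) * T) ∎)
    where
    open ≤-Reasoning
    T = d ^ suc s + e ^ suc s
    lemma₁ : ∀ a m T → 2 * (a * m + T) ≡ a * (2 * m) + 2 * T
    lemma₁ = solve-∀
    lemma₂ : ∀ d e s x y → (d + e) * (suc s * (x + y)) + 2 * (d * x + e * y)
      ≡ suc s * (d * x + e * y + (d * y + e * x)) + 2 * (d * x + e * y)
    lemma₂ = solve-∀
    lemma₃ : ∀ s T → suc s * (T + T) + 2 * T ≡ 2 * (suc (suc s) * T)
    lemma₃ = solve-∀

  -- Equality holds for d = e. Inserting the bound of `mixed-powers` into `mixed-average` gives (s +
  -- 2) (d + e) `mixed d e s` ≤ 2 (s + 1) `mixed d e (suc s)`, the ratio needed for the induction.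
  mixed-≥ : ∀ d e s → suc s * (d + e) ^ s ≤ 2 ^ s * mixed d e s
  mixed-≥ d e zero = ≤-refl
  mixed-≥ d e (suc s) = *-cancelˡ-≤ (suc s) (begin
    suc s * (suc (suc s) * ((d + e) * (d + e) ^ s))
      ≡⟨ lemma₁ s (d + e) ((d + e) ^ s) ⟩
    suc (suc s) * (d + e) * (suc s * (d + e) ^ s)
      ≤⟨ *-monoʳ-≤ (suc (suc s) * (d + e)) (mixed-≥ d e s) ⟩
    suc (suc s) * (d + e) * (2 ^ s * mixed d e s)
      ≡⟨ lemma₂ (suc (suc s)) (d + e) (2 ^ s) (mixed d e s) ⟩
    2 ^ s * (suc (suc s) * ((d + e) * mixed d e s))
      ≤⟨ *-monoʳ-≤ (2 ^ s) step ⟩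
    2 ^ s * (suc s * (2 * mixed d e (suc s)))
      ≡⟨ lemma₃ (2 ^ s) (suc s) (mixed d e (suc s)) ⟩
    suc s * (2 * 2 ^ s * mixed d e (suc s)) ∎)
    where
    open ≤-Reasoning
    T = d ^ suc s + e ^ suc s
    lemma₁ : ∀ s a x → suc s * (suc (suc s) * (a * x)) ≡ suc (suc s) * a * (suc s * x)
    lemma₁ = solve-∀
    lemma₂ : ∀ c a p m → c * a * (p * m) ≡ p * (c * (a * m))
    lemma₂ = solve-∀
    lemma₃ : ∀ p c m → p * (c * (2 * m)) ≡ c * (2 * p * m)
    lemma₃ = solve-∀
    lemma₄ : ∀ c M → (2 + c) * M ≡ 2 * M + c * M
    lemma₄ = solve-∀
    step : suc (suc s) * ((d + e) * mixed d e s) ≤ suc s * (2 * mixed d e (suc s))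
    step = +-cancelʳ-≤ (suc (suc s) * T) _ _ (begin
      suc (suc s) * ((d + e) * mixed d e s) + suc (suc s) * T
        ≡⟨ *-distribˡ-+ (suc (suc s)) ((d + e) * mixed d e s) T ⟨
      suc (suc s) * ((d + e) * mixed d e s + T)
        ≡⟨ cong (suc (suc s) *_) (mixed-average d e s) ⟨
      suc (suc s) * (2 * mixed d e (suc s))
        ≡⟨ +-comm (2 * mixed d e (suc s)) _ ⟩
      suc s * (2 * mixed d e (suc s)) + 2 * mixed d e (suc s)
        ≤⟨ +-monoʳ-≤ (suc s * (2 * mixed d e (suc s))) (mixed-powers d e (suc s)) ⟩
      suc s * (2 * mixed d e (suc s)) + suc (suc s) * T ∎)

  -- Bernoulli's inequality (1 - h / n) ^ s ≥ 1 - s h / n times n ^ (s + 1). Truncated subtraction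
  -- is consistent with it, as the left side vanishes once s h ≥ n.
  bernoulli-∸ : ∀ n h s → n ^ s * (n ∸ s * h) ≤ n * (n ∸ h) ^ s
  bernoulli-∸ n h zero = ≤-reflexive (trans (+-identityʳ n) (sym (*-identityʳ n)))
  bernoulli-∸ n h (suc s) = begin
    n * n ^ s * (n ∸ (h + s * h)) ≡⟨ lemma n (n ^ s) (n ∸ (h + s * h)) ⟩
    n ^ s * (n * (n ∸ (h + s * h))) ≤⟨ *-monoʳ-≤ (n ^ s) factor ⟩
    n ^ s * ((n ∸ s * h) * (n ∸ h)) ≡⟨ *-assoc (n ^ s) (n ∸ s * h) (n ∸ h) ⟨
    n ^ s * (n ∸ s * h) * (n ∸ h) ≤⟨ *-monoˡ-≤ (n ∸ h) (bernoulli-∸ n h s) ⟩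
    n * (n ∸ h) ^ s * (n ∸ h) ≡⟨ lemma′ n ((n ∸ h) ^ s) (n ∸ h) ⟩
    n * ((n ∸ h) * (n ∸ h) ^ s) ∎
    where
    open ≤-Reasoning
    lemma : ∀ n p x → n * p * x ≡ p * (n * x)
    lemma = solve-∀
    lemma′ : ∀ n p x → n * p * x ≡ n * (x * p)
    lemma′ = solve-∀
    factor : n * (n ∸ (h + s * h)) ≤ (n ∸ s * h) * (n ∸ h)
    factor with h + s * h ≤? n
    ... | no big rewrite m≤n⇒m∸n≡0 (<⇒≤ (≰⇒> big)) | *-zeroʳ n = z≤n
    ... | yes small with m≤n⇒∃[o]m+o≡n small
    ... | o , refl = begin
      (h + s * h + o) * (h + s * h + o ∸ (h + s * h)) ≡⟨ cong ((h + s * h + o) *_) (m+n∸m≡n (h + s * h) o) ⟩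
      (h + s * h + o) * o ≤⟨ m≤m+n _ (h * (s * h)) ⟩
      (h + s * h + o) * o + h * (s * h) ≡⟨ expand h (s * h) o ⟩
      (h + o) * (s * h + o)
        ≡⟨ cong₂ _*_ (sym (trans (cong (_∸ s * h) (shuffle₁ h (s * h) o)) (m+n∸m≡n (s * h) (h + o))))
             (sym (trans (cong (_∸ h) (+-assoc h (s * h) o)) (m+n∸m≡n h (s * h + o)))) ⟩
      (h + s * h + o ∸ s * h) * (h + s * h + o ∸ h) ∎
      where
      expand : ∀ h k o → (h + k + o) * o + h * k ≡ (h + o) * (k + o)
      expand = solve-∀
      shuffle₁ : ∀ h k o → h + k + o ≡ k + (h + o)
      shuffle₁ = solve-∀

  -- The first summand pays for tuples that repeat an entry or meet a list of `z` forbidden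
  -- vertices, the second for the at most `h` vertices that a vertex sees in neither of two given
  -- colours.
  loss : ℕ → ℕ → ℕ → ℕ
  loss s z h = 2 ^ s * (s * (z + s)) + suc s * (s * h)

  -- By mixed-≥ the average over all tuples is smallest for d = e, where a tuple
  -- switches for the fraction (s + 1) / 2 ^ s of the w.
  frequent-switch : ∀ s {x n h τ} (Z : List (Fin n)) (R B : Fin x → Fin n → Bool) →
    (∀ w a → R w a ≡ true → B w a ≡ false) →
    (∀ w → n ≤ sum (𝟙 ∘ R w) + sum (𝟙 ∘ B w) + h) →
    x ≤ n → 2 ^ s * τ + loss s (length Z) h < x * suc s →
    ∃ λ as → Fresh Z as × τ < sum (λ w → switch (R w) (B w) as)
  frequent-switch s {x} {n} {h} {τ} Z R B disj dense x≤n large =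
    fresh-large s Z F {B = x} F≤x (*-cancelˡ-< (2 ^ s) _ _ (begin-strict
      2 ^ s * (n ^ s * (τ * n + x * (s * (z + s))))
        ≡⟨ lemma₁ (2 ^ s) (n ^ s) (τ * n) (x * (s * (z + s))) ⟩
      n ^ s * (2 ^ s * (τ * n) + 2 ^ s * (x * (s * (z + s))))
        <⟨ *-monoʳ-< (n ^ s) {{nˢ≢0}} core ⟩
      n ^ s * (x * (suc s * (n ∸ s * h)))
        ≡⟨ lemma₂ (n ^ s) x (suc s) (n ∸ s * h) ⟩
      x * (suc s * (n ^ s * (n ∸ s * h)))
        ≤⟨ *-monoʳ-≤ x (*-monoʳ-≤ (suc s) (bernoulli-∸ n h s)) ⟩
      x * (suc s * (n * (n ∸ h) ^ s))
        ≡⟨ lemma₃ x (suc s) n ((n ∸ h) ^ s) ⟩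
      n * (x * (suc s * (n ∸ h) ^ s))
        ≡⟨ cong (n *_) (sum-const x _) ⟨
      n * sum {x} (λ w → suc s * (n ∸ h) ^ s)
        ≤⟨ *-monoʳ-≤ n (sum-mono λ w → ≤-trans (*-monoʳ-≤ (suc s) (^-monoˡ-≤ s (n∸h≤ w))) (mixed-≥ (d w) (e w) s)) ⟩
      n * sum (λ w → 2 ^ s * mixed (d w) (e w) s)
        ≡⟨ cong (n *_) (*-sum (2 ^ s) λ w → mixed (d w) (e w) s) ⟩
      n * (2 ^ s * sum (λ w → mixed (d w) (e w) s))
        ≡⟨ cong (λ y → n * (2 ^ s * y)) (sum-cong-≗ λ w → ∑ᵗ-switch (R w) (B w) s) ⟨
      n * (2 ^ s * sum (λ w → ∑ᵗ s (switch (R w) (B w))))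
        ≡⟨ cong (λ y → n * (2 ^ s * y)) (∑ᵗ-sum s (λ w → switch (R w) (B w))) ⟨
      n * (2 ^ s * ∑ᵗ s F)
        ≡⟨ lemma₄ n (2 ^ s) (∑ᵗ s F) ⟩
      2 ^ s * (n * ∑ᵗ s F) ∎))
    where
    open ≤-Reasoning
    z = length Z
    d : Fin x → ℕ
    d w = sum (𝟙 ∘ R w)
    e : Fin x → ℕ
    e w = sum (𝟙 ∘ B w)
    F : Vec (Fin n) s → ℕ
    F as = sum λ w → switch (R w) (B w) as
    F≤x : ∀ as → F as ≤ x
    F≤x as = ≤-trans (sum-mono λ w → switch≤1 (R w) (B w) (disj w) as)
      (≤-reflexive (trans (sum-const x 1) (*-identityʳ x)))
    n∸h≤ : ∀ w → n ∸ h ≤ d w + e w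
    n∸h≤ w = m≤n+o⇒m∸n≤o n h (≤-trans (dense w) (≤-reflexive (+-comm (d w + e w) h)))
    x≢0 : 0 < x
    x≢0 = n≢0⇒n>0 λ { refl → contradiction large λ () }
    instance
      n≢0 : NonZero n
      n≢0 = >-nonZero (≤-trans x≢0 x≤n)
    nˢ≢0 : NonZero (n ^ s)
    nˢ≢0 = m^n≢0 n s
    lemma₁ : ∀ q p a b → q * (p * (a + b)) ≡ p * (q * a + q * b)
    lemma₁ = solve-∀
    lemma₂ : ∀ p x s y → p * (x * (s * y)) ≡ x * (s * (p * y))
    lemma₂ = solve-∀
    lemma₃ : ∀ x s n y → x * (s * (n * y)) ≡ n * (x * (s * y))
    lemma₃ = solve-∀
    lemma₄ : ∀ n q y → n * (q * y) ≡ q * (n * y)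
    lemma₄ = solve-∀
    lemma₅ : ∀ q τ n c s k → q * (τ * n) + q * (n * c) + n * (s * k) ≡ n * (q * τ + (q * c + s * k))
    lemma₅ = solve-∀
    lemma₆ : ∀ n x s → n * (x * s) ≡ x * (s * n)
    lemma₆ = solve-∀
    -- This is `large` times `n`; in the two error terms `x` is replaced by the larger `n`, so that
    -- `n` can be factored out.
    core : 2 ^ s * (τ * n) + 2 ^ s * (x * (s * (z + s))) < x * (suc s * (n ∸ s * h))
    core = +-cancelʳ-< (x * (suc s * (s * h))) _ _ (begin-strict
      2 ^ s * (τ * n) + 2 ^ s * (x * (s * (z + s))) + x * (suc s * (s * h))
        ≤⟨ +-mono-≤ (+-monoʳ-≤ (2 ^ s * (τ * n)) (*-monoʳ-≤ (2 ^ s) (*-monoˡ-≤ (s * (z + s)) x≤n)))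
             (*-monoˡ-≤ (suc s * (s * h)) x≤n) ⟩
      2 ^ s * (τ * n) + 2 ^ s * (n * (s * (z + s))) + n * (suc s * (s * h))
        ≡⟨ lemma₅ (2 ^ s) τ n (s * (z + s)) (suc s) (s * h) ⟩
      n * (2 ^ s * τ + loss s z h)
        <⟨ *-monoʳ-< n large ⟩
      n * (x * suc s)
        ≡⟨ lemma₆ n x (suc s) ⟩
      x * (suc s * n)
        ≤⟨ *-monoʳ-≤ x (*-monoʳ-≤ (suc s) (m≤n+m∸n n (s * h))) ⟩
      x * (suc s * (s * h + (n ∸ s * h)))
        ≡⟨ lemma₇ x (suc s) (s * h) (n ∸ s * h) ⟩
      x * (suc s * (n ∸ s * h)) + x * (suc s * (s * h)) ∎)
      where
      lemma₇ : ∀ x s a b → x * (s * (a + b)) ≡ x * (s * b) + x * (s * a)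
      lemma₇ = solve-∀

-- Orderable copies of the complete bipartite graph as tuples with many hits.

module Configurations where
  open import Defs
  open FiniteSums

  open import Data.Fin using (toℕ; fromℕ<; inject≤; splitAt; _↑ˡ_; _↑ʳ_; punchIn)
  import Data.Fin as Fin
  import Data.Fin.Properties as Finₚ
  open import Data.Fin.Permutation as Perm using (Permutation′; _⟨$⟩ʳ_; _⟨$⟩ˡ_; inverseˡ; inverseʳ)
  open import Data.List.Membership.Propositional using (_∉_)
  open import Data.Vec.Properties using (tabulate-∘; lookup-map)
  open import Relation.Binary.Definitions using (DecidableEquality)

  count : ∀ {n} → (Fin n → Bool) → ℕ
  count p = sum (𝟙 ∘ p)

  record Enumeration {n} (p : Fin n → Bool) (N : ℕ) : Set where
    field
      at : Fin N → Fin n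
      injective : Injective _≡_ _≡_ at
      sound : ∀ i → p (at i) ≡ true
      index : ∀ x → p x ≡ true → Fin N
      complete : ∀ x px → at (index x px) ≡ x

  enumerate : ∀ {n} (p : Fin n → Bool) → Enumeration p (count p)
  enumerate {zero} p = record
    { at = λ () ; injective = λ { {()} } ; sound = λ () ; index = λ () ; complete = λ () }
  enumerate {suc n} p = extend (p zero) refl (enumerate (p ∘ suc))
    where
    extend : ∀ {N} b → p zero ≡ b → Enumeration (p ∘ suc) N → Enumeration p (𝟙 b + N)
    extend false p0 E = record
      { at = suc ∘ at
      ; injective = injective ∘ Finₚ.suc-injective
      ; sound = sound
      ; index = λ { zero px → contradiction (trans (sym px) p0) λ () ; (suc x) px → index x px }
      ; complete = λ { zero px → contradiction (trans (sym px) p0) λ () ; (suc x) px → cong suc (complete x px) }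
      }
      where open Enumeration E
    extend true p0 E = record
      { at = λ { zero → zero ; (suc i) → suc (at i) }
      ; injective = λ { {zero} {zero} _ → refl ; {suc i} {suc j} eq → cong suc (injective (Finₚ.suc-injective eq)) }
      ; sound = λ { zero → p0 ; (suc i) → sound i }
      ; index = λ { zero px → zero ; (suc x) px → suc (index x px) }
      ; complete = λ { zero px → refl ; (suc x) px → cong suc (complete x px) }
      }
      where open Enumeration E

  injection⇒≤count : ∀ {n t} (p : Fin n → Bool) (b : Fin t → Fin n) → Injective _≡_ _≡_ b →
    (∀ j → p (b j) ≡ true) → t ≤ count p
  injection⇒≤count p b inj pb =
    Finₚ.injective⇒≤ {f = λ j → index (b j) (pb j)} λ {i} {j} eq →
      inj (trans (sym (complete (b i) (pb i))) (trans (cong at eq) (complete (b j) (pb j))))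
    where open Enumeration (enumerate p)

  ≤count⇒injection : ∀ {n t} (p : Fin n → Bool) → t ≤ count p →
    Σ (Fin t → Fin n) λ b → Injective _≡_ _≡_ b × (∀ j → p (b j) ≡ true)
  ≤count⇒injection p t≤ =
    (λ j → at (inject≤ j t≤)) , (λ eq → Finₚ.inject≤-injective t≤ t≤ _ _ (injective eq)) , (λ j → sound _)
    where open Enumeration (enumerate p)

  fresh-∉ : ∀ {n s} {Z : List (Fin n)} (as : Vec (Fin n) s) → Fresh Z as → ∀ i → lookup as i ∉ Z
  fresh-∉ (a ∷ as) (a∉Z , _) zero = a∉Z
  fresh-∉ (a ∷ as) (_ , fr) (suc i) = fresh-∉ as fr i ∘ there

  fresh⇒injective : ∀ {n s} {Z : List (Fin n)} (as : Vec (Fin n) s) → Fresh Z as → Injective _≡_ _≡_ (lookup as)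
  fresh⇒injective (a ∷ as) (_ , fr) {zero} {zero} eq = refl
  fresh⇒injective (a ∷ as) (_ , fr) {zero} {suc j} eq = contradiction (here (sym eq)) (fresh-∉ as fr j)
  fresh⇒injective (a ∷ as) (_ , fr) {suc i} {zero} eq = contradiction (here eq) (fresh-∉ as fr i)
  fresh⇒injective (a ∷ as) (_ , fr) {suc i} {suc j} eq = cong suc (fresh⇒injective as fr eq)

  injective⇒fresh : ∀ {n s} {Z : List (Fin n)} (f : Fin s → Fin n) → Injective _≡_ _≡_ f →
    (∀ i → f i ∉ Z) → Fresh Z (tabulate f)
  injective⇒fresh {s = zero} f inj f∉Z = _
  injective⇒fresh {s = suc s} f inj f∉Z = f∉Z zero ,
    injective⇒fresh (f ∘ suc) (Finₚ.suc-injective ∘ inj)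
      λ { i (here eq) → contradiction (inj eq) λ () ; i (there fi∈Z) → f∉Z (suc i) fi∈Z }

  -- The colours from a vertex b to the ordered s-side, when c lists the colours of
  -- that side: those of the vertices before b, followed by the colour of b.
  data Allowed {A : Set} : ∀ {s} → Vec A s → Vec A s → Set where
    [] : Allowed [] []
    agree : ∀ {s c} {cs vs : Vec A s} → Allowed cs vs → Allowed (c ∷ cs) (c ∷ vs)
    flat : ∀ {s c x} {cs vs : Vec A s} → All (_≡ x) vs → Allowed (c ∷ cs) (x ∷ vs)

  allowed? : ∀ {A s} → DecidableEquality A → (cs vs : Vec A s) → Dec (Allowed cs vs)
  allowed? _≟ᴬ_ [] [] = yes []
  allowed? _≟ᴬ_ (c ∷ cs) (v ∷ vs) with All.all? (_≟ᴬ v) vs | v ≟ᴬ c | allowed? _≟ᴬ_ cs vs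
  ... | yes same | _ | _ = yes (flat same)
  ... | no _ | yes refl | yes al = yes (agree al)
  ... | no ¬same | no v≢c | _ = no λ { (agree _) → v≢c refl ; (flat same) → ¬same same }
  ... | no ¬same | yes refl | no ¬al = no λ { (agree al) → ¬al al ; (flat same) → ¬same same }

  -- The place `l` where agreement stops becomes the position of the vertex in the ordering. The
  -- argument of type `A` is the value of `x` when the derivation ends in `[]` and nothing
  -- determines it.
  allowed-threshold : ∀ {A s} {cs vs : Vec A s} → A → Allowed cs vs →
    ∃ λ l → Σ A λ x → (∀ i → toℕ i < l → lookup vs i ≡ lookup cs i) × (∀ i → l ≤ toℕ i → lookup vs i ≡ x)
  allowed-threshold d [] = 0 , d , (λ ()) , (λ ())
  allowed-threshold d (flat {x = x} same) = 0 , x , (λ _ ()) , λ { zero _ → refl ; (suc i) _ → Allₚ.lookup⁺ same i }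
  allowed-threshold d (agree al) with allowed-threshold d al
  ... | l , x , before , after = suc l , x ,
    (λ { zero _ → refl ; (suc i) (s≤s i<l) → before i i<l }) , λ { (suc i) (s≤s l≤i) → after i l≤i }

  -- To be read with `p` as the positions of the tuple in an ordering and `q` as the position of a
  -- further vertex: an edge takes its colour from its earlier end. By sortedness, once an entry
  -- lies behind `q` all later entries do, which is the `flat` part.
  threshold-allowed : ∀ {A s} (p : Fin s → ℕ) → (∀ {i j} → i Fin.< j → p i ≤ p j) →
    ∀ q → (∀ i → q ≢ p i) → (c v : Fin s → A) (x : A) →
    (∀ i → p i < q → v i ≡ c i) → (∀ i → q < p i → v i ≡ x) → Allowed (tabulate c) (tabulate v)
  threshold-allowed {s = zero} p sorted q q≢p c v x before after = []
  threshold-allowed {s = suc s} p sorted q q≢p c v x before after with p zero <? q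
  ... | yes p0<q rewrite before zero p0<q =
    agree (threshold-allowed (p ∘ suc) (sorted ∘ s≤s) q (q≢p ∘ suc) (c ∘ suc) (v ∘ suc) x (before ∘ suc) (after ∘ suc))
  ... | no p0≮q = flat (Allₚ.tabulate⁺ λ i →
    trans (after (suc i) (<-≤-trans q<p0 (sorted (s≤s z≤n)))) (sym (after zero q<p0)))
    where
    q<p0 : q < p zero
    q<p0 = ≤∧≢⇒< (≮⇒≥ p0≮q) (q≢p zero)

  module _ {n k : ℕ} (col : Fin n → Fin n → Fin k) where

    Hit : ∀ {s} → Vec (Fin n) s → Vec (Fin k) s → Fin n → Set
    Hit a c w = All (w ≢_) a × Allowed c (map (col w) a)

    hit? : ∀ {s} (a : Vec (Fin n) s) c w → Dec (Hit a c w)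
    hit? a c w = All.all? (λ x → ¬? (w Finₚ.≟ x)) a ×-dec allowed? Finₚ._≟_ c (map (col w) a)

    record Config (s t : ℕ) : Set where
      field
        a : Vec (Fin n) s
        c : Vec (Fin k) s
        b : Fin t → Fin n
        a-distinct : Fresh [] a
        b-injective : Injective _≡_ _≡_ b
        hit : ∀ j → Hit a c (b j)

    config-from-hits : ∀ {s t} (a : Vec (Fin n) s) c → Fresh [] a →
      t ≤ count (λ w → does (hit? a c w)) → Config s t
    config-from-hits a c fr t≤ with ≤count⇒injection _ t≤
    ... | b , b-inj , hits = record
      { a = a ; c = c ; b = b ; a-distinct = fr ; b-injective = b-inj
      ; hit = λ j → does⇒ (hit? a c (b j)) (hits j) }

    hits≥ : ∀ {s t} (cfg : Config s t) → let open Config cfg in t ≤ count (λ w → does (hit? a c w))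
    hits≥ cfg = injection⇒≤count _ b b-injective λ j → dec-true (hit? a c (b j)) (hit j)
      where open Config cfg

    config? : ∀ s t → Dec (Config s t)
    config? s t = map′
      (λ (a , c , fr , t≤) → config-from-hits a c fr t≤)
      (λ cfg → let open Config cfg in a , c , a-distinct , hits≥ cfg)
      (search-Vec search-Fin s λ a → search-Vec search-Fin s λ c →
        fresh? [] a ×-dec (t ≤? count (λ w → does (hit? a c w))))

  minimum : ∀ {n} (κ : Fin (suc n) → ℕ) → ∃ λ m → ∀ i → κ m ≤ κ i
  minimum {zero} κ = zero , λ { zero → ≤-refl }
  minimum {suc n} κ with minimum (κ ∘ suc)
  ... | m , m-min with ≤-total (κ zero) (κ (suc m))
  ... | inj₁ 0≤m = zero , λ { zero → ≤-refl ; (suc i) → ≤-trans 0≤m (m-min i) }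
  ... | inj₂ m≤0 = suc m , λ { zero → m≤0 ; (suc i) → m-min i }

  sort : ∀ {n} (κ : Fin n → ℕ) →
    Σ (Permutation′ n) λ π → ∀ {i j} → i Fin.< j → κ (π ⟨$⟩ʳ i) ≤ κ (π ⟨$⟩ʳ j)
  sort {zero} κ = Perm.id , λ { {()} }
  sort {suc n} κ with minimum κ
  ... | m , m-min with sort (κ ∘ punchIn m)
  ... | π , sorted = Perm.insert zero m π , λ
    { {zero} {suc j} _ → m-min _ ; {suc i} {suc j} (s≤s i<j) → sorted i<j }

  module _ {G : Graph} {A : Set} (χ : EdgeColouring G A) where
    open Graph G hiding (sym)
    open EdgeColouring χ

    -- The hypothesis is made for ≤ and not only for <, because `sort` places vertices of equal key
    -- in an arbitrary order.
    key⇒orderable : (key : Vertex → ℕ) (ĉ : Vertex → A) →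
      (∀ u w → key u ≤ key w → (e : Adj u w) → colour e ≡ ĉ u) → Orderable χ
    key⇒orderable key ĉ ok with sort key
    ... | π , sorted = π , (λ i → ĉ (π ⟨$⟩ʳ inject≤ i pred[n]≤n)) , λ i j i<j e → ok _ _ (sorted i<j) e

    orderable⇒key : A → Orderable χ →
      Σ (Vertex → ℕ) λ key → Σ (Vertex → A) λ ĉ → Injective _≡_ _≡_ key ×
      (∀ u w → key u < key w → (e : Adj u w) → colour e ≡ ĉ u)
    orderable⇒key d (π , c , ok) = key , ĉ , key-injective , ordered
      where
      key : Vertex → ℕ
      key u = toℕ (π ⟨$⟩ˡ u)
      key-injective : Injective _≡_ _≡_ key
      key-injective {u} {w} eq =
        trans (sym (inverseʳ π)) (trans (cong (π ⟨$⟩ʳ_) (Finₚ.toℕ-injective eq)) (inverseʳ π))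
      -- The last vertex of the ordering has no colour in the list and receives the default `d`; no
      -- edge leads from it to a later vertex.
      ĉ : Vertex → A
      ĉ u with key u <? pred order
      ... | yes small = c (fromℕ< small)
      ... | no _ = d
      ordered : ∀ u w → key u < key w → (e : Adj u w) → colour e ≡ ĉ u
      ordered u w u<w e with key u <? pred order
      ... | no large = contradiction (<-≤-trans u<w (<⇒≤pred (Finₚ.toℕ<n (π ⟨$⟩ˡ w)))) large
      ... | yes small = at-position u w u′≡u (inverseʳ π) e
        where
        i = fromℕ< small
        i′ = inject≤ i pred[n]≤n
        i′≡ : toℕ i′ ≡ key u
        i′≡ = trans (Finₚ.toℕ-inject≤ i pred[n]≤n) (Finₚ.toℕ-fromℕ< small)
        u′≡u : π ⟨$⟩ʳ i′ ≡ u
        u′≡u = trans (cong (π ⟨$⟩ʳ_) (Finₚ.toℕ-injective i′≡)) (inverseʳ π)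
        at-position : ∀ x y → π ⟨$⟩ʳ i′ ≡ x → π ⟨$⟩ʳ (π ⟨$⟩ˡ w) ≡ y → (e : Adj x y) → colour e ≡ c i
        at-position _ _ refl refl e = ok i (π ⟨$⟩ˡ w) (subst (_< key w) (sym i′≡) u<w) e

  side : ∀ s {t} (u : Fin (s + t)) → (∃ λ i → u ≡ i ↑ˡ t) ⊎ (∃ λ j → u ≡ s ↑ʳ j)
  side s {t} u with splitAt s u | Finₚ.join-splitAt s t u
  ... | inj₁ i | eq = inj₁ (i , sym eq)
  ... | inj₂ j | eq = inj₂ (j , sym eq)

  toℕ-↑ʳ≥ : ∀ s {t} (j : Fin t) → s ≤ toℕ (s ↑ʳ j)
  toℕ-↑ʳ≥ s j = ≤-trans (m≤m+n s (toℕ j)) (≤-reflexive (sym (Finₚ.toℕ-↑ʳ s j)))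

  toℕ-↑ˡ< : ∀ {s} t (i : Fin s) → toℕ (i ↑ˡ t) < s
  toℕ-↑ˡ< t i = subst (_< _) (sym (Finₚ.toℕ-↑ˡ i t)) (Finₚ.toℕ<n i)

  join-injective : ∀ {n} x {y} {f : Fin x → Fin n} {g : Fin y → Fin n} → Injective _≡_ _≡_ f → Injective _≡_ _≡_ g →
    (∀ i j → f i ≢ g j) → Injective _≡_ _≡_ ([ f , g ]′ ∘ splitAt x)
  join-injective x {y} f-inj g-inj f≢g {u} {v} eq with side x {y} u | side x {y} v
  ... | inj₁ (i , refl) | inj₁ (i′ , refl)
    rewrite Finₚ.splitAt-↑ˡ x i y | Finₚ.splitAt-↑ˡ x i′ y = cong (_↑ˡ y) (f-inj eq)
  ... | inj₁ (i , refl) | inj₂ (j , refl)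
    rewrite Finₚ.splitAt-↑ˡ x i y | Finₚ.splitAt-↑ʳ x y j = contradiction eq (f≢g i j)
  ... | inj₂ (j , refl) | inj₁ (i , refl)
    rewrite Finₚ.splitAt-↑ˡ x i y | Finₚ.splitAt-↑ʳ x y j = contradiction (sym eq) (f≢g i j)
  ... | inj₂ (j , refl) | inj₂ (j′ , refl)
    rewrite Finₚ.splitAt-↑ʳ x y j | Finₚ.splitAt-↑ʳ x y j′ = cong (x ↑ʳ_) (g-inj eq)

  module _ {n k : ℕ} (χ : EdgeColouring (K n) (Fin k)) (col : Fin n → Fin n → Fin k) where
    open EdgeColouring χ

    Agrees : Set
    Agrees = ∀ {u v} (e : u ≢ v) → colour e ≡ col u v

    module _ (agrees : Agrees) (d : Fin k) where

      config⇒copy : ∀ {s t} → Config col s t → OrderableCopy χ (Kᵇ s t)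
      config⇒copy {s} {t} cfg = copy , key⇒orderable (inherited χ copy) key ĉ ordered
        where
        open Config cfg
        threshold : ∀ j → _
        threshold j = allowed-threshold d (proj₂ (hit j))
        f : Fin (s + t) → Fin n
        f u = [ lookup a , b ]′ (splitAt s u)
        -- Odd keys for the tuple and even keys for the other side: entry i precedes vertex j
        -- exactly if i is below the threshold of j. Equal keys occur only within the even ones,
        -- between nonadjacent vertices.
        key : Fin (s + t) → ℕ
        key u = [ (λ i → suc (2 * toℕ i)) , (λ j → 2 * proj₁ (threshold j)) ]′ (splitAt s u)
        ĉ : Fin (s + t) → Fin k
        ĉ u = [ lookup c , (λ j → proj₁ (proj₂ (threshold j))) ]′ (splitAt s u)
        b∉a : ∀ i j → b j ≢ lookup a i
        b∉a i j = Allₚ.lookup⁺ (proj₁ (hit j)) i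
        f-injective : Injective _≡_ _≡_ f
        f-injective = join-injective s (fresh⇒injective a a-distinct) b-injective λ i j → ≢-sym (b∉a i j)
        copy : Copy (Kᵇ s t) (K n)
        copy = record
          { map = f ; injective = f-injective
          ; map-adj = λ e fu≡fv → Graph.irrefl (Kᵇ s t) (f-injective fu≡fv) e }
        lookup-row : ∀ i j → lookup (map (col (b j)) a) i ≡ col (b j) (lookup a i)
        lookup-row i j = lookup-map i (col (b j)) a
        open ≡-Reasoning
        ordered : ∀ u w → key u ≤ key w → (e : Graph.Adj (Kᵇ s t) u w) → colour (Copy.map-adj copy e) ≡ ĉ u
        ordered u w ku≤kw e with side s {t} u | side s {t} w
        ordered u w ku≤kw (inj₁ (_ , s≤w)) | _ | inj₁ (i , refl) = contradiction (toℕ-↑ˡ< t i) (≤⇒≯ s≤w)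
        ordered u w ku≤kw (inj₁ (u<s , _)) | inj₂ (j , refl) | _ = contradiction u<s (≤⇒≯ (toℕ-↑ʳ≥ s j))
        ordered u w ku≤kw (inj₂ (w<s , _)) | _ | inj₂ (j , refl) = contradiction w<s (≤⇒≯ (toℕ-↑ʳ≥ s j))
        ordered u w ku≤kw (inj₂ (_ , s≤u)) | inj₁ (i , refl) | _ = contradiction (toℕ-↑ˡ< t i) (≤⇒≯ s≤u)
        ordered u w ku≤kw e@(inj₁ _) | inj₁ (i , refl) | inj₂ (j , refl) = begin
          colour (Copy.map-adj copy e) ≡⟨ colour-sym (Copy.map-adj copy e) (≢-sym (Copy.map-adj copy e)) ⟩
          colour (≢-sym (Copy.map-adj copy e)) ≡⟨ agrees _ ⟩
          col (f (s ↑ʳ j)) (f (i ↑ˡ t)) ≡⟨ cong₂ (λ x y → col ([ lookup a , b ]′ x) ([ lookup a , b ]′ y)) eqj eqi ⟩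
          col (b j) (lookup a i) ≡⟨ lookup-row i j ⟨
          lookup (map (col (b j)) a) i ≡⟨ proj₁ (proj₂ (proj₂ (threshold j))) i (*-cancelˡ-< 2 _ _ i<l) ⟩
          lookup c i ≡⟨ cong [ lookup c , _ ]′ eqi ⟨
          ĉ (i ↑ˡ t) ∎
          where
          eqi = Finₚ.splitAt-↑ˡ s i t
          eqj = Finₚ.splitAt-↑ʳ s t j
          i<l : 2 * toℕ i < 2 * proj₁ (threshold j)
          i<l = subst₂ _≤_ (cong [ (λ i → suc (2 * toℕ i)) , _ ]′ eqi) (cong [ _ , (λ j → 2 * proj₁ (threshold j)) ]′ eqj) ku≤kw
        ordered u w ku≤kw e@(inj₂ _) | inj₂ (j , refl) | inj₁ (i , refl) = begin
          colour (Copy.map-adj copy e) ≡⟨ agrees _ ⟩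
          col (f (s ↑ʳ j)) (f (i ↑ˡ t)) ≡⟨ cong₂ (λ x y → col ([ lookup a , b ]′ x) ([ lookup a , b ]′ y)) eqj eqi ⟩
          col (b j) (lookup a i) ≡⟨ lookup-row i j ⟨
          lookup (map (col (b j)) a) i ≡⟨ proj₂ (proj₂ (proj₂ (threshold j))) i (s≤s⁻¹ (*-cancelˡ-< 2 _ _ l≤i)) ⟩
          proj₁ (proj₂ (threshold j)) ≡⟨ cong [ _ , (λ j → proj₁ (proj₂ (threshold j))) ]′ eqj ⟨
          ĉ (s ↑ʳ j) ∎
          where
          eqi = Finₚ.splitAt-↑ˡ s i t
          eqj = Finₚ.splitAt-↑ʳ s t j
          l≤i : 2 * proj₁ (threshold j) < 2 * suc (toℕ i)
          l≤i = ≤-<-trans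
            (subst₂ _≤_ (cong [ _ , (λ j → 2 * proj₁ (threshold j)) ]′ eqj) (cong [ (λ i → suc (2 * toℕ i)) , _ ]′ eqi) ku≤kw)
            (≤-reflexive (sym (*-suc 2 (toℕ i))))

      -- The tuple is the s-side sorted by its positions in the ordering, listed with the colours of
      -- these positions; then `threshold-allowed` applies to every vertex of the other side.
      copy⇒config : ∀ {s t} → OrderableCopy χ (Kᵇ s t) → Config col s t
      copy⇒config {s} {t} (f , ord) with orderable⇒key (inherited χ f) d ord
      ... | key , ĉ , key-injective , ordered with sort (λ i → key (i ↑ˡ t))
      ... | π , sorted = record
        { a = tabulate a′
        ; c = tabulate (ĉ ∘ v)
        ; b = b′
        ; a-distinct = injective⇒fresh a′ (Perm-injective ∘ Finₚ.↑ˡ-injective t _ _ ∘ injective) (λ _ ())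
        ; b-injective = Finₚ.↑ʳ-injective s _ _ ∘ injective
        ; hit = λ j → Allₚ.tabulate⁺ (λ i → b≢a i j) ,
            subst (Allowed _) (tabulate-∘ (col (b′ j)) a′)
              (threshold-allowed (key ∘ v) sorted (key (s ↑ʳ j)) (λ i eq → ↑ʳ≢↑ˡ i j (key-injective eq))
                (ĉ ∘ v) _ (ĉ (s ↑ʳ j))
                (λ i lt → trans (trans (sym (agrees (b≢a i j))) (colour-sym _ _)) (ordered (v i) (s ↑ʳ j) lt (edge i j)))
                (λ i lt → trans (sym (agrees _)) (ordered (s ↑ʳ j) (v i) lt (Graph.sym (Kᵇ s t) {v i} {s ↑ʳ j} (edge i j)))))
        }
        where
        open Copy f renaming (map to f′)
        v : Fin s → Fin (s + t)
        v i = (π ⟨$⟩ʳ i) ↑ˡ t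
        a′ : Fin s → Fin n
        a′ = f′ ∘ v
        b′ : Fin t → Fin n
        b′ j = f′ (s ↑ʳ j)
        Perm-injective : Injective _≡_ _≡_ (π ⟨$⟩ʳ_)
        Perm-injective eq = trans (sym (inverseˡ π)) (trans (cong (π ⟨$⟩ˡ_) eq) (inverseˡ π))
        edge : ∀ i j → Graph.Adj (Kᵇ s t) (v i) (s ↑ʳ j)
        edge i j = inj₁ (toℕ-↑ˡ< t (π ⟨$⟩ʳ i) , toℕ-↑ʳ≥ s j)
        ↑ʳ≢↑ˡ : ∀ i j → s ↑ʳ j ≢ v i
        ↑ʳ≢↑ˡ i j eq = Graph.irrefl (Kᵇ s t) (sym eq) (edge i j)
        b≢a : ∀ i j → b′ j ≢ a′ i
        b≢a i j eq = ↑ʳ≢↑ˡ i j (injective eq)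

-- A two-colouring with few hits, by the method of conditional expectations.

module RandomColouring where
  open FiniteSums
  open Configurations

  import Data.Fin.Properties as Finₚ
  open import Data.List using (allFin; cartesianProduct)
  open import Data.List.Membership.Propositional using (_∈_)
  open import Data.List.Membership.Propositional.Properties using (∈-allFin; ∈-cartesianProduct⁺)
  open import Data.Maybe using (Maybe; just; nothing; fromMaybe)
  open import Data.Vec.Properties using (map-const)
  open import Function.Bundles using (mk⇔)
  open import Algebra.Properties.Monoid.Sum *-1-monoid
    using () renaming (sum to product; sum-cong-≗ to product-cong)

  -- 2 ^ s times the average of F over the completions of a partial vector.
  expect : ∀ {s} → (Vec (Fin 2) s → ℕ) → Vec (Maybe (Fin 2)) s → ℕ
  expect F [] = F []
  expect F (just b ∷ v) = 2 * expect (F ∘ (b ∷_)) v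
  expect F (nothing ∷ v) = expect (F ∘ (zero ∷_)) v + expect (F ∘ (suc zero ∷_)) v

  expect-cong : ∀ {s} {F G : Vec (Fin 2) s → ℕ} → (∀ v → F v ≡ G v) → ∀ v → expect F v ≡ expect G v
  expect-cong F≡G [] = F≡G []
  expect-cong F≡G (just b ∷ v) = cong (2 *_) (expect-cong (F≡G ∘ (b ∷_)) v)
  expect-cong F≡G (nothing ∷ v) = cong₂ _+_ (expect-cong (F≡G ∘ (zero ∷_)) v) (expect-cong (F≡G ∘ (suc zero ∷_)) v)

  expect-complete : ∀ {s} (F : Vec (Fin 2) s → ℕ) v → expect F (map just v) ≡ 2 ^ s * F v
  expect-complete F [] = sym (+-identityʳ (F []))
  expect-complete {suc s} F (b ∷ v) =
    trans (cong (2 *_) (expect-complete (F ∘ (b ∷_)) v)) (sym (*-assoc 2 (2 ^ s) (F (b ∷ v))))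

  all-≡⇒allowed : ∀ {A s} (cs : Vec A s) {vs x} → All (_≡ x) vs → Allowed cs vs
  all-≡⇒allowed [] [] = []
  all-≡⇒allowed (c ∷ cs) (refl ∷ same) = flat same

  module _ (k : ℕ) where

    flatWeight : ∀ {s} → Fin 2 → Vec (Fin 2) s → ℕ
    flatWeight x v = k + 𝟙 (does (All.all? (Finₚ._≟ x) v))

    -- `k` times the factor in the exponential moment, which is 1 + 1 / k for an allowed vector and
    -- 1 otherwise.
    weight : ∀ {s} → Vec (Fin 2) s → Vec (Fin 2) s → ℕ
    weight c v = k + 𝟙 (does (allowed? Finₚ._≟_ c v))

    expect-none : ∀ s → expect {s} (λ _ → k + 0) (replicate s nothing) ≡ 2 ^ s * k
    expect-none zero = refl
    expect-none (suc s) = trans (cong₂ _+_ (expect-none s) (expect-none s)) (lemma (2 ^ s) k)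
      where
      lemma : ∀ p k → p * k + p * k ≡ 2 * p * k
      lemma = solve-∀

    expect-flat : ∀ s x → expect (flatWeight x) (replicate s nothing) ≡ 2 ^ s * k + 1
    expect-flat zero x = cong (_+ 1) (sym (+-identityʳ k))
    expect-flat (suc s) zero = trans (cong₂ _+_ (expect-flat s zero) (expect-none s)) (lemma (2 ^ s) k)
      where
      lemma : ∀ p k → (p * k + 1) + p * k ≡ 2 * p * k + 1
      lemma = solve-∀
    expect-flat (suc s) (suc zero) = trans (cong₂ _+_ (expect-none s) (expect-flat s (suc zero))) (lemma (2 ^ s) k)
      where
      lemma : ∀ p k → p * k + (p * k + 1) ≡ 2 * p * k + 1
      lemma = solve-∀

    -- A constant vector is `Allowed` for all colours, so when the first entries coincide `flat`
    -- yields nothing beyond `agree`.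
    weight-agree : ∀ {s} c (cs vs : Vec (Fin 2) s) → weight (c ∷ cs) (c ∷ vs) ≡ weight cs vs
    weight-agree c cs vs = cong (λ b → k + 𝟙 b) (does-⇔
      (mk⇔ (λ { (agree al) → al ; (flat same) → all-≡⇒allowed cs same }) agree)
      (allowed? Finₚ._≟_ (c ∷ cs) (c ∷ vs)) (allowed? Finₚ._≟_ cs vs))

    weight-flat : ∀ {s} {c x} → x ≢ c → (cs vs : Vec (Fin 2) s) → weight (c ∷ cs) (x ∷ vs) ≡ flatWeight x vs
    weight-flat {c = c} {x} x≢c cs vs = cong (λ b → k + 𝟙 b) (does-⇔
      (mk⇔ (λ { (agree _) → contradiction refl x≢c ; (flat same) → same }) flat)
      (allowed? Finₚ._≟_ (c ∷ cs) (x ∷ vs)) (All.all? (Finₚ._≟ x) vs))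

    -- Counts the s + 1 allowed vectors: a first entry equal to that of `c` leaves the allowed
    -- tails, and the other first entry forces a constant tail and adds exactly one vector.
    expect-weight : ∀ s (c : Vec (Fin 2) s) → expect (weight c) (replicate s nothing) ≡ 2 ^ s * k + suc s
    expect-weight zero [] = cong (_+ 1) (sym (+-identityʳ k))
    expect-weight (suc s) (zero ∷ cs) = trans
      (cong₂ _+_
        (trans (expect-cong (weight-agree zero cs) (replicate s nothing)) (expect-weight s cs))
        (trans (expect-cong (weight-flat (λ ()) cs) (replicate s nothing)) (expect-flat s (suc zero))))
      (lemma (2 ^ s) k s)
      where
      lemma : ∀ p k s → p * k + suc s + (p * k + 1) ≡ 2 * p * k + suc (suc s)
      lemma = solve-∀
    expect-weight (suc s) (suc zero ∷ cs) = trans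
      (cong₂ _+_
        (trans (expect-cong (weight-flat (λ ()) cs) (replicate s nothing)) (expect-flat s zero))
        (trans (expect-cong (weight-agree (suc zero) cs) (replicate s nothing)) (expect-weight s cs)))
      (lemma (2 ^ s) k s)
      where
      lemma : ∀ p k s → p * k + 1 + (p * k + suc s) ≡ 2 * p * k + suc (suc s)
      lemma = solve-∀

  ∈⇒fresh-avoids : ∀ {n s y} {Z : List (Fin n)} (as : Vec (Fin n) s) → y ∈ Z → Fresh Z as → All (y ≢_) as
  ∈⇒fresh-avoids [] y∈Z fr = []
  ∈⇒fresh-avoids (a ∷ as) y∈Z (a∉Z , fr) = (λ { refl → a∉Z y∈Z }) ∷ ∈⇒fresh-avoids as (there y∈Z) fr

  module _ {m : ℕ} where

    set : (Fin m → Maybe (Fin 2)) → Fin m → Fin 2 → Fin m → Maybe (Fin 2)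
    set ρ y b z with y Finₚ.≟ z
    ... | yes _ = just b
    ... | no _ = ρ z

    map-set : ∀ {s} ρ {y} b {as : Vec (Fin m) s} → All (y ≢_) as → map (set ρ y b) as ≡ map ρ as
    map-set ρ b [] = refl
    map-set ρ {y} b {a ∷ as} (y≢a ∷ y∉as) with y Finₚ.≟ a
    ... | yes y≡a = contradiction y≡a y≢a
    ... | no _ = cong (ρ a ∷_) (map-set ρ b y∉as)

    -- As the entries are distinct, `y` occurs at most once among them, so the expectation is
    -- averaged over the two values at `y`.
    expect-set : ∀ {s} ρ {y} Z (as : Vec (Fin m) s) F → Fresh Z as → ρ y ≡ nothing →
      2 * expect F (map ρ as) ≡ expect F (map (set ρ y zero) as) + expect F (map (set ρ y (suc zero)) as)
    expect-set ρ Z [] F fr ρy = cong (F [] +_) (+-identityʳ (F []))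
    expect-set ρ {y} Z (a ∷ as) F (_ , fr) ρy with y Finₚ.≟ a
    ... | yes refl rewrite ρy
      | map-set ρ zero (∈⇒fresh-avoids as (here refl) fr)
      | map-set ρ (suc zero) (∈⇒fresh-avoids as (here refl) fr) =
      *-distribˡ-+ 2 (expect (F ∘ (zero ∷_)) (map ρ as)) (expect (F ∘ (suc zero ∷_)) (map ρ as))
    ... | no _ with ρ a
    ... | just b = trans (cong (2 *_) (expect-set ρ (a ∷ Z) as (F ∘ (b ∷_)) fr ρy))
      (*-distribˡ-+ 2 (expect (F ∘ (b ∷_)) (map (set ρ y zero) as)) (expect (F ∘ (b ∷_)) (map (set ρ y (suc zero)) as)))
    ... | nothing = begin
      2 * (E zero ρ + E one ρ)
        ≡⟨ *-distribˡ-+ 2 (E zero ρ) (E one ρ) ⟩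
      2 * E zero ρ + 2 * E one ρ
        ≡⟨ cong₂ _+_ (expect-set ρ (a ∷ Z) as (F ∘ (zero ∷_)) fr ρy) (expect-set ρ (a ∷ Z) as (F ∘ (one ∷_)) fr ρy) ⟩
      E zero (set ρ y zero) + E zero (set ρ y one) + (E one (set ρ y zero) + E one (set ρ y one))
        ≡⟨ lemma (E zero (set ρ y zero)) _ _ _ ⟩
      E zero (set ρ y zero) + E one (set ρ y zero) + (E zero (set ρ y one) + E one (set ρ y one)) ∎
      where
      open ≡-Reasoning
      one : Fin 2
      one = suc zero
      E : Fin 2 → (Fin m → Maybe (Fin 2)) → ℕ
      E b σ = expect (F ∘ (b ∷_)) (map σ as)
      lemma : ∀ a b c d → a + b + (c + d) ≡ a + c + (b + d)
      lemma = solve-∀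

  product-average : ∀ {m} (x₀ : Fin m) (f f₀ f₁ : Fin m → ℕ) →
    (∀ x → x ≢ x₀ → f x ≡ f₀ x × f x ≡ f₁ x) → 2 * f x₀ ≡ f₀ x₀ + f₁ x₀ →
    2 * product f ≡ product f₀ + product f₁
  product-average zero f f₀ f₁ same avg = begin
    2 * (f zero * Π) ≡⟨ *-assoc 2 (f zero) Π ⟨
    2 * f zero * Π ≡⟨ cong (_* Π) avg ⟩
    (f₀ zero + f₁ zero) * Π ≡⟨ *-distribʳ-+ Π (f₀ zero) (f₁ zero) ⟩
    f₀ zero * Π + f₁ zero * Π ≡⟨ cong₂ (λ x y → f₀ zero * x + f₁ zero * y)
                                        (product-cong λ x → proj₁ (same (suc x) λ ()))
                                        (product-cong λ x → proj₂ (same (suc x) λ ())) ⟩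
    product f₀ + product f₁ ∎
    where
    open ≡-Reasoning
    Π = product (f ∘ suc)
  product-average (suc x₀) f f₀ f₁ same avg = begin
    2 * (f zero * Π) ≡⟨ lemma (f zero) Π ⟩
    f zero * (2 * Π) ≡⟨ cong (f zero *_) (product-average x₀ (f ∘ suc) (f₀ ∘ suc) (f₁ ∘ suc)
                                        (λ x x≢ → same (suc x) (x≢ ∘ Finₚ.suc-injective)) avg) ⟩
    f zero * (product (f₀ ∘ suc) + product (f₁ ∘ suc))
                                   ≡⟨ *-distribˡ-+ (f zero) (product (f₀ ∘ suc)) (product (f₁ ∘ suc)) ⟩
    f zero * product (f₀ ∘ suc) + f zero * product (f₁ ∘ suc)
                                   ≡⟨ cong₂ (λ x y → x * product (f₀ ∘ suc) + y * product (f₁ ∘ suc))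
                                        (proj₁ (same zero λ ())) (proj₂ (same zero λ ())) ⟩
    product f₀ + product f₁ ∎
    where
    open ≡-Reasoning
    Π = product (f ∘ suc)
    lemma : ∀ a p → 2 * (a * p) ≡ a * (2 * p)
    lemma = solve-∀

  product-≤ : ∀ {m B} (f : Fin m → ℕ) → (∀ x → f x ≤ B) → product f ≤ B ^ m
  product-≤ {zero} f f≤B = ≤-refl
  product-≤ {suc m} f f≤B = *-mono-≤ (f≤B zero) (product-≤ (f ∘ suc) (f≤B ∘ suc))

  -- Every hit raises its factor from at least q k to at least q (k + 1), so `t` hits gain (1 + 1 /
  -- k) ^ t over the minimal product.
  product-≥ : ∀ {m} q k t (f : Fin m → ℕ) (p : Fin m → Bool) → (∀ x → q * k ≤ f x) →
    (∀ x → p x ≡ true → q * suc k ≤ f x) → t ≤ count p → (q * k) ^ m * suc k ^ t ≤ k ^ t * product f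
  product-≥ {zero} q k .zero f p low high z≤n = ≤-refl
  product-≥ {suc m} q k t f p low high t≤ with p zero in p0 | t
  ... | true | suc t′ = begin
    q * k * (q * k) ^ m * (suc k * suc k ^ t′) ≡⟨ lemma q k ((q * k) ^ m) (suc k) (suc k ^ t′) ⟩
    k * (q * suc k) * ((q * k) ^ m * suc k ^ t′) ≤⟨ *-mono-≤ (*-monoʳ-≤ k (high zero p0))
                                                      (product-≥ q k t′ (f ∘ suc) (p ∘ suc) (low ∘ suc) (high ∘ suc) (s≤s⁻¹ t≤)) ⟩
    k * f zero * (k ^ t′ * product (f ∘ suc)) ≡⟨ lemma′ k (f zero) (k ^ t′) (product (f ∘ suc)) ⟩
    k * k ^ t′ * (f zero * product (f ∘ suc)) ∎
    where
    open ≤-Reasoning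
    lemma : ∀ q k a x y → q * k * a * (x * y) ≡ k * (q * x) * (a * y)
    lemma = solve-∀
    lemma′ : ∀ k f a p → k * f * (a * p) ≡ k * a * (f * p)
    lemma′ = solve-∀
  ... | true | zero = begin
    q * k * (q * k) ^ m * 1 ≡⟨ *-assoc (q * k) ((q * k) ^ m) 1 ⟩
    q * k * ((q * k) ^ m * 1) ≤⟨ *-mono-≤ (low zero)
                                                      (product-≥ q k 0 (f ∘ suc) (p ∘ suc) (low ∘ suc) (high ∘ suc) z≤n) ⟩
    f zero * (1 * product (f ∘ suc)) ≡⟨ cong (f zero *_) (*-identityˡ _) ⟩
    f zero * product (f ∘ suc) ≡⟨ *-identityˡ _ ⟨
    1 * (f zero * product (f ∘ suc)) ∎
    where open ≤-Reasoning
  ... | false | t′ = begin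
    q * k * (q * k) ^ m * suc k ^ t′ ≡⟨ *-assoc (q * k) ((q * k) ^ m) (suc k ^ t′) ⟩
    q * k * ((q * k) ^ m * suc k ^ t′) ≤⟨ *-mono-≤ (low zero)
                                                      (product-≥ q k t′ (f ∘ suc) (p ∘ suc) (low ∘ suc) (high ∘ suc) t≤) ⟩
    f zero * (k ^ t′ * product (f ∘ suc)) ≡⟨ lemma (f zero) (k ^ t′) (product (f ∘ suc)) ⟩
    k ^ t′ * (f zero * product (f ∘ suc)) ∎
    where
    open ≤-Reasoning
    lemma : ∀ f a p → f * (a * p) ≡ a * (f * p)
    lemma = solve-∀

  member≤∑ᵗ : ∀ {n} s (F : Vec (Fin n) s → ℕ) a → F a ≤ ∑ᵗ s F
  member≤∑ᵗ zero F [] = ≤-refl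
  member≤∑ᵗ (suc s) F (a ∷ as) =
    ≤-trans (member≤∑ᵗ s (F ∘ (a ∷_)) as) (member≤sum (λ x → ∑ᵗ s (F ∘ (x ∷_))) a)

  -- The method of conditional expectations for the random colouring of K m: the
  -- potential bounds the expectation of ((k + 1) / k) ^ (number of hits), summed
  -- over all a and c, and some colour of the next edge does not increase it.
  module _ (s k m : ℕ) where

    avoids? : ∀ {r} (x : Fin m) (a : Vec (Fin m) r) → Dec (All (x ≢_) a)
    avoids? x = All.all? λ y → ¬? (x Finₚ.≟ y)

    Partial : Set
    Partial = Fin m → Fin m → Maybe (Fin 2)

    -- A vertex of the tuple itself can never be a hit. Its constant is the weight `k` of a miss in
    -- the scale of `expect`.
    factor : Partial → Vec (Fin m) s → Vec (Fin 2) s → Fin m → ℕ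
    factor g a c x with avoids? x a
    ... | yes _ = expect (weight k c) (map (g x) a)
    ... | no _ = 2 ^ s * k

    term : Partial → Vec (Fin m) s → Vec (Fin 2) s → ℕ
    term g a c with fresh? [] a
    ... | yes _ = product (factor g a c)
    ... | no _ = 0

    potential : Partial → ℕ
    potential g = ∑ᵗ s λ a → ∑ᵗ s λ c → term g a c

    colourEdge : Partial → Fin m → Fin m → Fin 2 → Partial
    colourEdge g u v b x with x Finₚ.≟ u | x Finₚ.≟ v
    ... | yes _ | _ = set (g x) v b
    ... | no _ | yes _ = set (g x) u b
    ... | no _ | no _ = g x

    module _ (g : Partial) {u v : Fin m} (u≢v : u ≢ v) (guv : g u v ≡ nothing) (gvu : g v u ≡ nothing) where

      private
        g₀ = colourEdge g u v zero
        g₁ = colourEdge g u v (suc zero)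

      -- If `v` is not in the tuple, the edge uv can matter only for the row of `v`, namely when `u`
      -- is in the tuple. If `v` is in the tuple, its own factor is constant and only the row of `u`
      -- can change.
      factor-average : ∀ a c → Fresh [] a → ∃ λ x₀ →
        (∀ x → x ≢ x₀ → factor g a c x ≡ factor g₀ a c x × factor g a c x ≡ factor g₁ a c x) ×
        2 * factor g a c x₀ ≡ factor g₀ a c x₀ + factor g₁ a c x₀
      factor-average a c fr with avoids? v a
      ... | yes v∉a = v , unchanged , at-v
        where
        unchanged : ∀ x → x ≢ v → factor g a c x ≡ factor g₀ a c x × factor g a c x ≡ factor g₁ a c x
        unchanged x x≢v with avoids? x a
        ... | no _ = refl , refl
        ... | yes x∉a with x Finₚ.≟ u | x Finₚ.≟ v
        ... | yes refl | _ = cong (expect (weight k c)) (sym (map-set (g x) zero v∉a)) ,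
                             cong (expect (weight k c)) (sym (map-set (g x) (suc zero) v∉a))
        ... | no _ | yes x≡v = contradiction x≡v x≢v
        ... | no _ | no _ = refl , refl
        at-v : 2 * factor g a c v ≡ factor g₀ a c v + factor g₁ a c v
        at-v with avoids? v a
        ... | no _ = cong (2 ^ s * k +_) (+-identityʳ _)
        ... | yes _ with v Finₚ.≟ u | v Finₚ.≟ v
        ... | yes v≡u | _ = contradiction (sym v≡u) u≢v
        ... | no _ | yes _ = expect-set (g v) [] a (weight k c) fr gvu
        ... | no _ | no v≢v = contradiction refl v≢v
      ... | no v∈a = u , unchanged , at-u
        where
        unchanged : ∀ x → x ≢ u → factor g a c x ≡ factor g₀ a c x × factor g a c x ≡ factor g₁ a c x
        unchanged x x≢u with avoids? x a
        ... | no _ = refl , refl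
        ... | yes x∉a with x Finₚ.≟ u | x Finₚ.≟ v
        ... | yes x≡u | _ = contradiction x≡u x≢u
        ... | no _ | yes refl = contradiction x∉a v∈a
        ... | no _ | no _ = refl , refl
        at-u : 2 * factor g a c u ≡ factor g₀ a c u + factor g₁ a c u
        at-u with avoids? u a
        ... | no _ = cong (2 ^ s * k +_) (+-identityʳ _)
        ... | yes _ with u Finₚ.≟ u
        ... | yes _ = expect-set (g u) [] a (weight k c) fr guv
        ... | no u≢u = contradiction refl u≢u

      term-average : ∀ a c → 2 * term g a c ≡ term g₀ a c + term g₁ a c
      term-average a c with fresh? [] a
      ... | no _ = refl
      ... | yes fr with factor-average a c fr
      ... | x₀ , same , avg = product-average x₀ (factor g a c) (factor g₀ a c) (factor g₁ a c) same avg

      potential-average : 2 * potential g ≡ potential g₀ + potential g₁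
      potential-average = begin
        2 * ∑ᵗ s (λ a → ∑ᵗ s (term g a))
          ≡⟨ ∑ᵗ-* s 2 (λ a → ∑ᵗ s (term g a)) ⟨
        ∑ᵗ s (λ a → 2 * ∑ᵗ s (term g a))
          ≡⟨ ∑ᵗ-cong s (λ a → trans (sym (∑ᵗ-* s 2 (term g a)))
               (trans (∑ᵗ-cong s (term-average a)) (∑ᵗ-+ s (term g₀ a) (term g₁ a)))) ⟩
        ∑ᵗ s (λ a → ∑ᵗ s (term g₀ a) + ∑ᵗ s (term g₁ a))
          ≡⟨ ∑ᵗ-+ s (λ a → ∑ᵗ s (term g₀ a)) (λ a → ∑ᵗ s (term g₁ a)) ⟩
        potential g₀ + potential g₁ ∎
        where open ≡-Reasoning

      potential-decreases : ∃ λ b → potential (colourEdge g u v b) ≤ potential g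
      potential-decreases with potential g₀ ≤? potential g
      ... | yes ≤g = zero , ≤g
      ... | no ≰g = suc zero , +-cancelˡ-≤ (potential g₀) _ _ (begin
        potential g₀ + potential g₁ ≡⟨ potential-average ⟨
        2 * potential g ≡⟨ cong (potential g +_) (+-identityʳ _) ⟩
        potential g + potential g ≤⟨ +-monoˡ-≤ (potential g) (<⇒≤ (≰⇒> ≰g)) ⟩
        potential g₀ + potential g ∎)
        where open ≤-Reasoning

    module _ (g : Partial) (g-sym : ∀ x y → g x y ≡ g y x) {u v : Fin m} (u≢v : u ≢ v) (b : Fin 2) where

      set-here : ∀ (ρ : Fin m → Maybe (Fin 2)) y → set ρ y b y ≡ just b
      set-here ρ y with y Finₚ.≟ y
      ... | yes _ = refl
      ... | no y≢y = contradiction refl y≢y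

      set-elsewhere : ∀ (ρ : Fin m → Maybe (Fin 2)) {y z} → y ≢ z → set ρ y b z ≡ ρ z
      set-elsewhere ρ {y} {z} y≢z with y Finₚ.≟ z
      ... | yes y≡z = contradiction y≡z y≢z
      ... | no _ = refl

      colourEdge-uv : colourEdge g u v b u v ≡ just b
      colourEdge-uv with u Finₚ.≟ u
      ... | yes _ = set-here (g u) v
      ... | no u≢u = contradiction refl u≢u

      colourEdge-vu : colourEdge g u v b v u ≡ just b
      colourEdge-vu with v Finₚ.≟ u | v Finₚ.≟ v
      ... | yes v≡u | _ = contradiction (sym v≡u) u≢v
      ... | no _ | yes _ = set-here (g v) u
      ... | no _ | no v≢v = contradiction refl v≢v

      colourEdge-other : ∀ x y → ¬ (x ≡ u × y ≡ v) → ¬ (x ≡ v × y ≡ u) → colourEdge g u v b x y ≡ g x y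
      colourEdge-other x y ¬uv ¬vu with x Finₚ.≟ u | x Finₚ.≟ v
      ... | yes x≡u | _ = set-elsewhere (g x) λ v≡y → ¬uv (x≡u , sym v≡y)
      ... | no _ | yes x≡v = set-elsewhere (g x) λ u≡y → ¬vu (x≡v , sym u≡y)
      ... | no _ | no _ = refl

      private
        position : ∀ x y → (x ≡ u × y ≡ v) ⊎ (x ≡ v × y ≡ u) ⊎ (¬ (x ≡ u × y ≡ v) × ¬ (x ≡ v × y ≡ u))
        position x y with x Finₚ.≟ u | y Finₚ.≟ v | x Finₚ.≟ v | y Finₚ.≟ u
        ... | yes p | yes q | _ | _ = inj₁ (p , q)
        ... | _ | _ | yes p | yes q = inj₂ (inj₁ (p , q))
        ... | no p | _ | no q | _ = inj₂ (inj₂ (p ∘ proj₁ , q ∘ proj₁))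
        ... | no p | _ | yes _ | no q = inj₂ (inj₂ (p ∘ proj₁ , q ∘ proj₂))
        ... | yes _ | no p | no q | _ = inj₂ (inj₂ (p ∘ proj₂ , q ∘ proj₁))
        ... | yes _ | no p | yes _ | no q = inj₂ (inj₂ (p ∘ proj₂ , q ∘ proj₂))

      colourEdge-sym : ∀ x y → colourEdge g u v b x y ≡ colourEdge g u v b y x
      colourEdge-sym x y with position x y
      ... | inj₁ (refl , refl) = trans colourEdge-uv (sym colourEdge-vu)
      ... | inj₂ (inj₁ (refl , refl)) = trans colourEdge-vu (sym colourEdge-uv)
      ... | inj₂ (inj₂ (p , q)) = trans (colourEdge-other x y p q)
        (trans (g-sym x y) (sym (colourEdge-other y x (λ (y≡u , x≡v) → q (x≡v , y≡u)) (λ (y≡v , x≡u) → p (x≡u , y≡v)))))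

      colourEdge-extends : g u v ≡ nothing → ∀ x y {d} → g x y ≡ just d → colourEdge g u v b x y ≡ just d
      colourEdge-extends guv x y gxy with position x y
      ... | inj₁ (refl , refl) = contradiction (trans (sym gxy) guv) λ ()
      ... | inj₂ (inj₁ (refl , refl)) = contradiction (trans (sym gxy) (trans (g-sym x y) guv)) λ ()
      ... | inj₂ (inj₂ (p , q)) = trans (colourEdge-other x y p q) gxy

    colourAll : ∀ es (g : Partial) → (∀ x y → g x y ≡ g y x) →
      Σ Partial λ g′ → (∀ x y → g′ x y ≡ g′ y x) × (∀ x y {d} → g x y ≡ just d → g′ x y ≡ just d) ×
        (∀ u v → (u , v) ∈ es → u ≢ v → ∃ λ b → g′ u v ≡ just b) × potential g′ ≤ potential g
    colourAll [] g g-sym = g , g-sym , (λ x y eq → eq) , (λ _ _ ()) , ≤-refl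
    colourAll ((u , v) ∷ es) g g-sym with u Finₚ.≟ v | g u v in guv
    colourAll ((u , v) ∷ es) g g-sym | yes u≡v | _ with colourAll es g g-sym
    ... | g′ , sym′ , ext , done , ≤g = g′ , sym′ , ext ,
      (λ { _ _ (here refl) u≢v → contradiction u≡v u≢v ; x y (there e∈) → done x y e∈ }) , ≤g
    -- The list of pairs contains every edge in both directions; at its second occurrence the edge
    -- is already coloured and keeps its colour.
    colourAll ((u , v) ∷ es) g g-sym | no u≢v | just d with colourAll es g g-sym
    ... | g′ , sym′ , ext , done , ≤g = g′ , sym′ , ext ,
      (λ { _ _ (here refl) _ → d , ext u v guv ; x y (there e∈) → done x y e∈ }) , ≤g
    colourAll ((u , v) ∷ es) g g-sym | no u≢v | nothing
      with potential-decreases g u≢v guv (trans (g-sym v u) guv)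
    ... | b , ≤g with colourAll es (colourEdge g u v b) (colourEdge-sym g g-sym u≢v b)
    ... | g′ , sym′ , ext , done , ≤g₁ = g′ , sym′ ,
      (λ x y eq → ext x y (colourEdge-extends g g-sym u≢v b guv x y eq)) ,
      (λ { _ _ (here refl) _ → b , ext u v (colourEdge-uv g g-sym u≢v b) ; x y (there e∈) → done x y e∈ }) ,
      ≤-trans ≤g₁ ≤g

    uncoloured : Partial
    uncoloured _ _ = nothing

    potential-uncoloured : potential uncoloured ≤ m ^ s * (2 ^ s * (2 ^ s * k + suc s) ^ m)
    potential-uncoloured = ∑ᵗ-bound s λ a → ∑ᵗ-bound s λ c → bound a c
      where
      B = 2 ^ s * k + suc s
      factor≤ : ∀ a c x → factor uncoloured a c x ≤ B
      factor≤ a c x with avoids? x a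
      ... | yes _ = ≤-reflexive (trans (cong (expect (weight k c)) (map-const a nothing)) (expect-weight k s c))
      ... | no _ = m≤m+n (2 ^ s * k) (suc s)
      bound : ∀ a c → term uncoloured a c ≤ B ^ m
      bound a c with fresh? [] a
      ... | yes _ = product-≤ (factor uncoloured a c) (factor≤ a c)
      ... | no _ = z≤n

    -- A configuration would make its own summand of the final potential at least (2 ^ s k) ^ m (1 +
    -- 1 / k) ^ t, which by hypothesis exceeds the bound on the initial potential.
    random-colouring : ∀ {t} → k ^ t * (m ^ s * (2 ^ s * (2 ^ s * k + suc s) ^ m)) < (2 ^ s * k) ^ m * suc k ^ t →
      Σ (Fin m → Fin m → Fin 2) λ col → (∀ x y → col x y ≡ col y x) × ¬ Config col s t
    random-colouring {t} small
      with colourAll (cartesianProduct (allFin m) (allFin m)) uncoloured (λ _ _ → refl)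
    ... | g , g-sym , _ , done , ≤start = col , (λ x y → cong (fromMaybe zero) (g-sym x y)) , λ cfg → <⇒≱ small (begin
      (2 ^ s * k) ^ m * suc k ^ t ≤⟨ many-hits cfg ⟩
      k ^ t * potential g ≤⟨ *-monoʳ-≤ (k ^ t) (≤-trans ≤start potential-uncoloured) ⟩
      k ^ t * (m ^ s * (2 ^ s * (2 ^ s * k + suc s) ^ m)) ∎)
      where
      open ≤-Reasoning
      -- Only loops are still uncoloured in `g`; they get the colour `zero`.
      col : Fin m → Fin m → Fin 2
      col x y = fromMaybe zero (g x y)
      row : ∀ {r} x (a : Vec (Fin m) r) → All (x ≢_) a → map (g x) a ≡ map just (map (col x) a)
      row x [] [] = refl
      row x (a ∷ as) (x≢a ∷ x∉as)
        with done x a (∈-cartesianProduct⁺ (∈-allFin x) (∈-allFin a)) x≢a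
      ... | b , gxa rewrite gxa = cong (just b ∷_) (row x as x∉as)
      low : ∀ a c x → 2 ^ s * k ≤ factor g a c x
      low a c x with avoids? x a
      ... | no _ = ≤-refl
      ... | yes x∉a rewrite row x a x∉a | expect-complete (weight k c) (map (col x) a) =
        *-monoʳ-≤ (2 ^ s) (m≤m+n k _)
      high : ∀ a c x → does (hit? col a c x) ≡ true → 2 ^ s * suc k ≤ factor g a c x
      high a c x hits with does⇒ (hit? col a c x) hits
      ... | x∉a , al with avoids? x a
      ... | no x∈a = contradiction x∉a x∈a
      ... | yes _ rewrite row x a x∉a | expect-complete (weight k c) (map (col x) a)
        | dec-true (allowed? Finₚ._≟_ c (map (col x) a)) al = *-monoʳ-≤ (2 ^ s) (≤-reflexive (+-comm 1 k))
      term≡ : ∀ a c → Fresh [] a → term g a c ≡ product (factor g a c)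
      term≡ a c fr with fresh? [] a
      ... | yes _ = refl
      ... | no ¬fr = contradiction fr ¬fr
      many-hits : Config col s t → (2 ^ s * k) ^ m * suc k ^ t ≤ k ^ t * potential g
      many-hits cfg = begin
        (2 ^ s * k) ^ m * suc k ^ t ≤⟨ product-≥ (2 ^ s) k t (factor g a c) _ (low a c) (high a c) (hits≥ col cfg) ⟩
        k ^ t * product (factor g a c) ≡⟨ cong (k ^ t *_) (term≡ a c a-distinct) ⟨
        k ^ t * term g a c ≤⟨ *-monoʳ-≤ (k ^ t) (≤-trans (member≤∑ᵗ s (term g a) c)
                                            (member≤∑ᵗ s (λ a → ∑ᵗ s (term g a)) a)) ⟩
        k ^ t * potential g ∎
        where open Config cfg

-- Gallai's theorem: some cut of a colouring without rainbow triangle has at most two colours.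

module GallaiCut where
  open FiniteSums
  open Configurations

  open import Data.Fin.Properties using (_≟_; all?; any?; suc-injective)
  open import Data.Fin.Subset using (Subset; inside; outside; _∈_; _∉_; _⊆_; _⊂_; ∁; Nonempty) renaming (⊥ to ∅)
  open import Data.Fin.Subset.Properties using (_∈?_; _⊆?_; anySubset?; nonempty?; x∈∁p⇒x∉p; x∉p⇒x∈∁p; ∉⊥; ⊆-refl; ⊆-trans; drop-there)
  open import Data.Fin.Subset.Induction using (⊂-wellFounded)
  open import Induction.WellFounded using (Acc; acc)
  open import Data.Vec using (here; there)
  open import Data.Vec.Properties using (lookup∘tabulate; []=⇒lookup; lookup⇒[]=)

  fromDec : ∀ {n} {P : Fin n → Set} → (∀ x → Dec (P x)) → Subset n
  fromDec P? = tabulate (does ∘ P?)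

  ∈-fromDec⁺ : ∀ {n} {P : Fin n → Set} (P? : ∀ x → Dec (P x)) {x} → P x → x ∈ fromDec P?
  ∈-fromDec⁺ P? {x} px = lookup⇒[]= x _ (trans (lookup∘tabulate (does ∘ P?) x) (dec-true (P? x) px))

  ∈-fromDec⁻ : ∀ {n} {P : Fin n → Set} (P? : ∀ x → Dec (P x)) {x} → x ∈ fromDec P? → P x
  ∈-fromDec⁻ P? {x} x∈ with P? x | trans (sym (lookup∘tabulate (does ∘ P?) x)) ([]=⇒lookup x∈)
  ... | yes px | _ = px
  ... | no _ | ()

  Two : ∀ {k} → Fin k → Fin k → Fin k → Set
  Two r b x = x ≡ r ⊎ x ≡ b

  two? : ∀ {k} (r b x : Fin k) → Dec (Two r b x)
  two? r b x = (x ≟ r) ⊎-dec (x ≟ b)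

  Colours : ℕ → ℕ → Set
  Colours n k = Fin n → Fin n → Fin k

  module _ {n k} (col : Colours n k) where

    Symm : Set
    Symm = ∀ x y → col x y ≡ col y x

    RainbowFree : Set
    RainbowFree = ∀ {x y z} → x ≢ y → y ≢ z → x ≢ z →
      col x y ≡ col y z ⊎ col y z ≡ col x z ⊎ col x y ≡ col x z

    Closed : Fin k → Fin k → Subset n → Set
    Closed r b S = ∀ x y → x ∈ S → y ∉ S → Two r b (col x y)

    closed? : ∀ r b S → Dec (Closed r b S)
    closed? r b S = all? λ x → all? λ y → (x ∈? S) →-dec ((¬? (y ∈? S)) →-dec two? r b (col x y))

    -- In a symmetric colouring, the connected component of `w` in the graph of edges coloured
    -- neither `r` nor `b`; the description by minimality does without paths.
    Component : Fin k → Fin k → Fin n → Subset n → Set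
    Component r b w D = w ∈ D × Closed r b D × (∀ T → T ⊆ D → w ∈ T → Closed r b T → D ⊆ T)

    component : ∀ r b w S → w ∈ S → Closed r b S → ∃ λ D → D ⊆ S × Component r b w D
    component r b w S = shrink S (⊂-wellFounded S)
      where
      shrink : ∀ S → Acc _⊂_ S → w ∈ S → Closed r b S → ∃ λ D → D ⊆ S × Component r b w D
      shrink S (acc rec) w∈S closed
        with anySubset? (λ T → (T ⊆? S) ×-dec ¬? (S ⊆? T) ×-dec (w ∈? T) ×-dec closed? r b T)
      ... | no none = S , ⊆-refl , w∈S , closed , λ T T⊆S w∈T closedT →
        decidable-stable (S ⊆? T) λ S⊈T → none (T , T⊆S , S⊈T , w∈T , closedT)
      ... | yes (T , T⊆S , S⊈T , w∈T , closedT)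
        with shrink T (rec (T⊆S , missing)) w∈T closedT
        where
        missing : ∃ λ x → x ∈ S × x ∉ T
        missing with any? (λ x → (x ∈? S) ×-dec ¬? (x ∈? T))
        ... | yes found = found
        ... | no none = contradiction (λ {x} x∈S → decidable-stable (x ∈? T) λ x∉T → none (x , x∈S , x∉T)) S⊈T
      ... | D , D⊆T , D-comp = D , ⊆-trans D⊆T T⊆S , D-comp

    module _ (symm : Symm) (rainbowFree : RainbowFree) where

      -- The vertices of `D` that `z` sees in the colour of zw form a closed set, so they are all of
      -- `D`: if zx and zy differ, then xy has one of these two colours, and both are `r` or `b`
      -- because zx and zy leave `D`.
      component-homogeneous : ∀ {r b w D} → Component r b w D → ∀ z → z ∉ D → ∀ x → x ∈ D → col z x ≡ col z w
      component-homogeneous {r} {b} {w} {D} (w∈D , closed , minimal) z z∉D x x∈D =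
        proj₂ (∈-fromDec⁻ T? (minimal T (proj₁ ∘ ∈-fromDec⁻ T?) (∈-fromDec⁺ T? (w∈D , refl)) closedT x∈D))
        where
        T? : ∀ x → Dec (x ∈ D × col z x ≡ col z w)
        T? x = (x ∈? D) ×-dec (col z x ≟ col z w)
        T : Subset n
        T = fromDec T?
        closedT : Closed r b T
        closedT x y x∈T y∉T with ∈-fromDec⁻ T? x∈T | y ∈? D
        ... | x∈D , zx | no y∉D = closed x y x∈D y∉D
        ... | x∈D , zx | yes y∈D with rainbowFree {z} {x} {y} (λ { refl → z∉D x∈D }) (λ { refl → y∉T x∈T }) (λ { refl → z∉D y∈D })
        ... | inj₁ zx≡xy = subst (Two r b) (trans (symm x z) zx≡xy) (closed x z x∈D z∉D)
        ... | inj₂ (inj₁ xy≡zy) = subst (Two r b) (trans (symm y z) (sym xy≡zy)) (closed y z y∈D z∉D)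
        ... | inj₂ (inj₂ zx≡zy) = contradiction (∈-fromDec⁺ T? (y∈D , trans (sym zx≡zy) zx)) y∉T

      closed-∁ : ∀ {r b S} → Closed r b S → Closed r b (∁ S)
      closed-∁ {r} {b} {S} closed x y x∈ y∉ =
        subst (Two r b) (symm y x) (closed y x (decidable-stable (y ∈? S) λ y∉S → y∉ (x∉p⇒x∈∁p y∉S)) (x∈∁p⇒x∉p x∈))

  Cut : ∀ {n k} → Colours n k → Set
  Cut col = ∃ λ r → ∃ λ b → ∃ λ S → Closed col r b S × Nonempty S × ∃ λ y → y ∉ S

  module _ {n k} (col : Colours (suc n) k) (symm : Symm col) where

    isolate-zero : Fin n → ∀ r b → (∀ x → Two r b (col zero (suc x))) → Cut col
    isolate-zero x₀ r b all = r , b , inside ∷ ∅ , closed , (zero , here) , suc x₀ , ∉⊥ ∘ drop-there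
      where
      closed : Closed col r b (inside ∷ ∅)
      closed zero zero _ y∉ = contradiction here y∉
      closed zero (suc y) _ _ = all y
      closed (suc x) y (there x∈) _ = contradiction x∈ ∉⊥

    extend-cut : ∀ {r b S} → Closed (λ x y → col (suc x) (suc y)) r b S → Nonempty S →
      (∀ x → x ∈ S → Two r b (col zero (suc x))) → Cut col
    extend-cut {r} {b} {S} closed (x₀ , x₀∈S) all =
      r , b , outside ∷ S , closed′ , (suc x₀ , there x₀∈S) , zero , λ ()
      where
      closed′ : Closed col r b (outside ∷ S)
      closed′ (suc x) zero (there x∈S) _ = subst (Two r b) (symm zero (suc x)) (all x x∈S)
      closed′ (suc x) (suc y) (there x∈S) y∉ = closed x y x∈S (y∉ ∘ there)

  -- Add the vertices one at a time. If a new vertex v neither extends a cut nor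
  -- is one side of a cut, it sends a third colour into every component as well as
  -- both r and b; the third colour then makes r and b equal.
  gallai-cut : ∀ {n k} (col : Colours (2 + n) k) → Symm col → RainbowFree col → Cut col
  gallai-cut {zero} col symm rf =
    isolate-zero col symm zero (col zero (suc zero)) (col zero (suc zero)) λ { zero → inj₁ refl }
  gallai-cut {suc n} {k} col symm rf = step (gallai-cut col′ symm′ rf′)
    where
    col′ : Colours (2 + n) k
    col′ x y = col (suc x) (suc y)
    symm′ : Symm col′
    symm′ x y = symm (suc x) (suc y)
    rf′ : RainbowFree col′
    rf′ x≢y y≢z x≢z = rf (x≢y ∘ suc-injective) (y≢z ∘ suc-injective) (x≢z ∘ suc-injective)
    v-to : Fin (2 + n) → Fin k
    v-to x = col zero (suc x)
    stuck : ∀ {r b S} → Closed col′ r b S → Nonempty S → (∃ λ y → y ∉ S) →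
      (∀ D → Closed col′ r b D → Nonempty D → ∃ λ x → x ∈ D × ¬ Two r b (v-to x)) → Cut col
    stuck {r} {b} {S} closed neS (y₀ , y₀∉S) third
      with third S closed neS | third (∁ S) (closed-∁ col′ symm′ rf′ closed) (y₀ , x∉p⇒x∈∁p y₀∉S)
    ... | x , x∈S , x-third | y , y∈∁S , y-third = conclude (any? λ x → v-to x ≟ r) (any? λ x → v-to x ≟ b) (r ≟ b)
      where
      zero≢ : ∀ {x : Fin (2 + n)} → zero ≢ suc x
      zero≢ ()
      across : ∀ {D x y} → Closed col′ r b D → x ∈ D → y ∉ D → ¬ Two r b (v-to x) → ¬ Two r b (v-to y) →
        v-to x ≡ v-to y
      across {D} {x} {y} closedD x∈D y∉D x-third y-third
        with rf {zero} {suc x} {suc y} zero≢ (λ { refl → y∉D x∈D }) zero≢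
      ... | inj₁ vx≡xy = contradiction (subst (Two r b) (sym vx≡xy) (closedD x y x∈D y∉D)) x-third
      ... | inj₂ (inj₁ xy≡vy) = contradiction (subst (Two r b) xy≡vy (closedD x y x∈D y∉D)) y-third
      ... | inj₂ (inj₂ vx≡vy) = vx≡vy
      forced : ∀ {p y} → Two r b (col′ p y) → p ≢ y → Two r b (v-to p) → ¬ Two r b (v-to y) → col′ p y ≡ v-to p
      forced {p} {y} py p≢y p-two y-third
        with rf {zero} {suc p} {suc y} zero≢ (p≢y ∘ suc-injective) zero≢
      ... | inj₁ vp≡py = sym vp≡py
      ... | inj₂ (inj₁ py≡vy) = contradiction (subst (Two r b) py≡vy py) y-third
      ... | inj₂ (inj₂ vp≡vy) = contradiction (subst (Two r b) vp≡vy p-two) y-third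
      g = v-to y
      y∉S = x∈∁p⇒x∉p y∈∁S
      -- By `across`, third colours agree on opposite sides of the cut; two vertices on the same
      -- side are compared through one on the other side.
      two-or-g : ∀ z → Two r b (v-to z) ⊎ v-to z ≡ g
      two-or-g z with two? r b (v-to z) | z ∈? S
      ... | yes two | _ = inj₁ two
      ... | no z-third | yes z∈S = inj₂ (across closed z∈S y∉S z-third y-third)
      ... | no z-third | no z∉S =
        inj₂ (trans (sym (across closed x∈S z∉S x-third z-third)) (across closed x∈S y∉S x-third y-third))
      side-of : ∀ p → ∃ λ T → Closed col′ r b T × p ∈ T × ∃ λ z → z ∉ T
      side-of p with p ∈? S
      ... | yes p∈S = S , closed , p∈S , y , y∉S
      ... | no p∉S = ∁ S , closed-∁ col′ symm′ rf′ closed , x∉p⇒x∈∁p p∉S , x , λ x∈∁S → x∈∁p⇒x∉p x∈∁S x∈S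
      -- The new vertex sends `r` to p and `b` to q. By `forced`, edges in `r` or `b` from p to
      -- vertices of a third colour have colour `r`, and those from q have colour `b`. If q is in
      -- the component `D` of p, one such vertex outside `D` sees p and q alike. Otherwise a vertex
      -- of a third colour in `D` and one in the component `E` of q are used, and homogeneity of `D`
      -- and `E` identifies both colours with that of pq.
      clash : ∀ {p q} → v-to p ≡ r → v-to q ≡ b → r ≡ b
      clash {p} {q} vp vq with side-of p
      ... | T , closedT , p∈T , z , z∉T with component col′ r b p T p∈T closedT
      ... | D , D⊆T , D-comp@(p∈D , closedD , _) = by-side (q ∈? D)
        where
        same : ∀ z → z ∉ D → ∀ x → x ∈ D → col′ z x ≡ col′ z p
        same = component-homogeneous col′ symm′ rf′ D-comp
        closed∁D = closed-∁ col′ symm′ rf′ closedD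
        meets-∁D = third (∁ D) closed∁D (z , x∉p⇒x∈∁p (z∉T ∘ D⊆T))
        forced-p : ∀ {y} → y ∉ D → ¬ Two r b (v-to y) → col′ p y ≡ r
        forced-p y∉D y-third = trans (forced (closedD p _ p∈D y∉D) (λ { refl → y∉D p∈D }) (inj₁ vp) y-third) vp
        by-side : Dec (q ∈ D) → r ≡ b
        by-side (yes q∈D) with meets-∁D
        ... | y , y∈∁D , y-third = begin
          r ≡⟨ forced-p y∉D y-third ⟨
          col′ p y ≡⟨ symm′ p y ⟩
          col′ y p ≡⟨ same y y∉D q q∈D ⟨
          col′ y q ≡⟨ symm′ y q ⟩
          col′ q y ≡⟨ forced (closedD q y q∈D y∉D) (λ { refl → y∉D q∈D }) (inj₂ vq) y-third ⟩
          v-to q ≡⟨ vq ⟩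
          b ∎
          where
          open ≡-Reasoning
          y∉D = x∈∁p⇒x∉p y∈∁D
        by-side (no q∉D) with component col′ r b q (∁ D) (x∉p⇒x∈∁p q∉D) closed∁D | third D closedD (p , p∈D)
        ... | E , E⊆∁D , E-comp@(q∈E , closedE , _) | x , x∈D , x-third with third E closedE (q , q∈E)
        ... | y , y∈E , y-third = begin
          r ≡⟨ forced-p (x∈∁p⇒x∉p (E⊆∁D y∈E)) y-third ⟨
          col′ p y ≡⟨ component-homogeneous col′ symm′ rf′ E-comp p (λ p∈E → x∈∁p⇒x∉p (E⊆∁D p∈E) p∈D) y y∈E ⟩
          col′ p q ≡⟨ symm′ p q ⟩
          col′ q p ≡⟨ same q q∉D x x∈D ⟨
          col′ q x ≡⟨ forced (subst (Two r b) (symm′ x q) (closedD x q x∈D q∉D)) (λ { refl → q∉D x∈D }) (inj₂ vq) x-third ⟩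
          v-to q ≡⟨ vq ⟩
          b ∎
          where open ≡-Reasoning
      isolate : ∀ r′ → (∀ x → Two r b (v-to x) → v-to x ≡ r′) → Cut col
      isolate r′ only = isolate-zero col symm zero r′ g λ x → [ inj₁ ∘ only x , inj₂ ]′ (two-or-g x)
      conclude : Dec (∃ λ x → v-to x ≡ r) → Dec (∃ λ x → v-to x ≡ b) → Dec (r ≡ b) → Cut col
      conclude (no no-r) _ _ = isolate b λ x → [ (λ ≡r → contradiction (x , ≡r) no-r) , id ]′
      conclude _ (no no-b) _ = isolate r λ x → [ id , (λ ≡b → contradiction (x , ≡b) no-b) ]′
      conclude _ _ (yes r≡b) = isolate r λ x → [ id , (λ ≡b → trans ≡b (sym r≡b)) ]′
      conclude (yes (p , vp)) (yes (q , vq)) (no r≢b) = contradiction (clash vp vq) r≢b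
    step : Cut col′ → Cut col
    step (r , b , S , closed , neS , y₀∉S)
      with anySubset? (λ D → closed? col′ r b D ×-dec nonempty? D ×-dec all? (λ x → (x ∈? D) →-dec two? r b (v-to x)))
    ... | yes (D , closedD , neD , two) = extend-cut col symm closedD neD two
    ... | no none = stuck closed neS y₀∉S third
      where
      third : ∀ D → Closed col′ r b D → Nonempty D → ∃ λ x → x ∈ D × ¬ Two r b (v-to x)
      third D closedD neD with any? (λ x → (x ∈? D) ×-dec ¬? (two? r b (v-to x)))
      ... | yes found = found
      ... | no ¬third = contradiction
        (D , closedD , neD , λ x x∈D → decidable-stable (two? r b (v-to x)) λ x-third → ¬third (x , x∈D , x-third)) none

-- Minimal large modules and the two colours that dominate in them.

module SmallModules where
  open FiniteSums
  open Averaging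
  open Configurations
  open GallaiCut

  open import Data.Nat.Induction using (<-wellFounded)
  open import Data.Fin.Properties using (_≟_; all?; any?; injective⇒≤)
  open import Data.Fin.Subset using (Subset; _∈_; _∉_; ∁)
  open import Data.Fin.Subset.Properties using (_∈?_; anySubset?; x∈∁p⇒x∉p; x∉p⇒x∈∁p)
  open import Data.List.Membership.Propositional using () renaming (_∈_ to _∈ˡ_)
  open import Induction.WellFounded using (Acc; acc)
  open import Data.Vec.Properties using ([]=⇒lookup; lookup⇒[]=)

  pigeonhole-count : ∀ {n m} (p : Fin n → Bool) (ι : Fin m → Fin n) →
    (∀ w → p w ≡ false → ∃ λ i → w ≡ ι i) → n ≤ count p + m
  pigeonhole-count {n} {m} p ι cover = begin
    n ≡⟨ trans (sum-const n 1) (*-identityʳ n) ⟨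
    sum {n} (λ w → 1) ≤⟨ sum-mono each ⟩
    sum (λ w → 𝟙 (p w) + sum (λ i → 𝟙 (does (w ≟ ι i))))
                                 ≡⟨ ∑-distrib-+ (𝟙 ∘ p) (λ w → sum (λ i → 𝟙 (does (w ≟ ι i)))) ⟩
    count p + sum (λ w → sum (λ i → 𝟙 (does (w ≟ ι i))))
                                 ≡⟨ cong (count p +_) (∑-comm (λ w i → 𝟙 (does (w ≟ ι i)))) ⟩
    count p + sum (λ i → sum (λ w → 𝟙 (does (w ≟ ι i))))
                                 ≡⟨ cong (count p +_) (sum-cong-≗ (λ i → sum-𝟙≟ (ι i))) ⟩
    count p + sum {m} (λ i → 1) ≡⟨ cong (count p +_) (trans (sum-const m 1) (*-identityʳ m)) ⟩
    count p + m ∎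
    where
    open ≤-Reasoning
    each : ∀ w → 1 ≤ 𝟙 (p w) + sum (λ i → 𝟙 (does (w ≟ ι i)))
    each w with p w in pw
    ... | true = s≤s z≤n
    ... | false with cover w pw
    ... | i , w≡ι = ≤-trans (𝟙-true (w ≟ ι i) w≡ι) (member≤sum (λ i → 𝟙 (does (w ≟ ι i))) i)

  proper-count : ∀ {n} (p : Fin n → Bool) z → p z ≡ false → count p < n
  proper-count {n} p z pz = injective⇒≤ {f = f} f-injective
    where
    open Enumeration (enumerate p)
    z≢ : ∀ i → z ≢ at i
    z≢ i refl = contradiction (trans (sym pz) (sound i)) λ ()
    f : Fin (suc (count p)) → Fin n
    f zero = z
    f (suc i) = at i
    f-injective : Injective _≡_ _≡_ f
    f-injective {zero} {zero} eq = refl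
    f-injective {zero} {suc j} eq = contradiction eq (z≢ j)
    f-injective {suc i} {zero} eq = contradiction (sym eq) (z≢ i)
    f-injective {suc i} {suc j} eq = cong suc (injective eq)

  size : ∀ {n} → Subset n → ℕ
  size S = count (lookup S)

  map-fresh : ∀ {n m s} (ι : Fin m → Fin n) → Injective _≡_ _≡_ ι → ∀ {Z Z′} → (∀ a → ι a ∈ˡ Z′ → a ∈ˡ Z) →
    (as : Vec (Fin m) s) → Fresh Z as → Fresh Z′ (map ι as)
  map-fresh ι inj Z′⇒Z [] fr = _
  map-fresh ι inj Z′⇒Z (a ∷ as) (a∉Z , fr) = a∉Z ∘ Z′⇒Z a ,
    map-fresh ι inj (λ { x (here eq) → here (inj eq) ; x (there p) → there (Z′⇒Z x p) }) as fr

  -- Colours r and b, disregarding loops and with the second class made disjoint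
  -- from the first when r and b coincide.
  module _ {n k} (col : Colours n k) (r b : Fin k) where

    first? : ∀ w a → Dec (w ≢ a × col w a ≡ r)
    first? w a = ¬? (w ≟ a) ×-dec (col w a ≟ r)

    second? : ∀ w a → Dec (w ≢ a × col w a ≡ b × col w a ≢ r)
    second? w a = ¬? (w ≟ a) ×-dec (col w a ≟ b) ×-dec ¬? (col w a ≟ r)

    first second : Fin n → Fin n → Bool
    first w a = does (first? w a)
    second w a = does (second? w a)

    first-second-disjoint : ∀ w a → first w a ≡ true → second w a ≡ false
    first-second-disjoint w a f = dec-false (second? w a) λ (_ , _ , ≢r) → ≢r (proj₂ (does⇒ (first? w a) f))

    allIn⇒ : ∀ w {s} (as : Vec (Fin n) s) → 1 ≤ allIn (first w) (second w) as →
      All (w ≢_) as × All (_≡ b) (map (col w) as)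
    allIn⇒ w [] 1≤ = [] , []
    allIn⇒ w (a ∷ as) 1≤ with second w a in sec
    ... | true with does⇒ (second? w a) sec | allIn⇒ w as (subst (1 ≤_) (+-identityʳ _) 1≤)
    ... | w≢a , ≡b , _ | ≢as , ≡bs = w≢a ∷ ≢as , ≡b ∷ ≡bs

    switch⇒hit : ∀ w {s} (as : Vec (Fin n) s) → 1 ≤ switch (first w) (second w) as →
      Hit col as (replicate s r) w
    switch⇒hit w [] 1≤ = [] , []
    switch⇒hit w (a ∷ as) 1≤ with first w a in fst
    ... | true with does⇒ (first? w a) fst | second w a in sec
    ... | _ | true = contradiction (trans (sym sec) (first-second-disjoint w a fst)) λ ()
    ... | w≢a , refl | false
      with switch⇒hit w as (subst (1 ≤_) (trans (+-identityʳ _) (+-identityʳ _)) 1≤)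
    ... | ≢as , al = w≢a ∷ ≢as , agree al
    switch⇒hit w (a ∷ as) 1≤ | false with allIn⇒ w (a ∷ as) 1≤
    ... | ≢as , refl ∷ same = ≢as , flat same

    Dense : ℕ → Set
    Dense h = ∀ w → n ≤ count (first w) + count (second w) + h

    frequent-hit : ∀ s {x h τ} Z (at : Fin x → Fin n) → Dense h → x ≤ n →
      2 ^ s * τ + loss s (length Z) h < x * suc s →
      ∃ λ (as : Vec (Fin n) s) → Fresh Z as × τ < count (λ i → does (hit? col as (replicate s r) (at i)))
    frequent-hit s Z at dense x≤n large
      with frequent-switch s Z (first ∘ at) (second ∘ at) (first-second-disjoint ∘ at) (dense ∘ at) x≤n large
    ... | as , fr , τ< = as , fr , <-≤-trans τ< (sum-mono λ i → 𝟙-mono (hit? col as _ (at i))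
      (switch≤1 _ _ (first-second-disjoint (at i)) as) (switch⇒hit (at i) as))

  module _ {n k} (col : Colours n k) where

    Module : Subset n → Set
    Module S = ∀ z → z ∉ S → ∀ x → x ∈ S → ∀ y → y ∈ S → col z x ≡ col z y

    module? : ∀ S → Dec (Module S)
    module? S = all? λ z → ¬? (z ∈? S) →-dec all? λ x → (x ∈? S) →-dec all? λ y → (y ∈? S) →-dec (col z x ≟ col z y)

    SmallModules : ℕ → Set
    SmallModules s = ∀ S → Module S → (∃ λ z → z ∉ S) → size S < s

  restrict : ∀ {n m k} → Colours n k → (Fin m → Fin n) → Colours m k
  restrict col ι x y = col (ι x) (ι y)

  -- A module with at least `s` vertices that contains no smaller one of this kind, given by an
  -- injection so that the induced colouring again has vertices `Fin N`.
  record Core {n k} (col : Colours n k) (s N : ℕ) : Set where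
    field
      ι : Fin N → Fin n
      injective : Injective _≡_ _≡_ ι
      homogeneous : ∀ z → (∀ i → z ≢ ι i) → ∀ i j → col z (ι i) ≡ col z (ι j)
      large : s ≤ N
      small : SmallModules (restrict col ι) s

  ∉⇒lookup : ∀ {n} {S : Subset n} {z} → z ∉ S → lookup S z ≡ false
  ∉⇒lookup {S = S} {z} z∉S with lookup S z in eq
  ... | false = refl
  ... | true = contradiction (lookup⇒[]= z S eq) z∉S

  core : ∀ {n k} (col : Colours n k) s → s ≤ n → ∃ (Core col s)
  core {n} {k} col s s≤n = descend n (<-wellFounded n) id id (λ z z≢ → contradiction refl (z≢ z)) s≤n
    where
    descend : ∀ N → Acc _<_ N → (ι : Fin N → Fin n) → Injective _≡_ _≡_ ι →
      (∀ z → (∀ i → z ≢ ι i) → ∀ i j → col z (ι i) ≡ col z (ι j)) → s ≤ N → ∃ (Core col s)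
    descend N (acc rec) ι ι-inj hom s≤N
      with anySubset? (λ S → module? (restrict col ι) S ×-dec any? (λ z → ¬? (z ∈? S)) ×-dec (s ≤? size S))
    ... | no none = N , record { ι = ι ; injective = ι-inj ; homogeneous = hom ; large = s≤N
      ; small = λ S mod proper → ≰⇒> λ s≤S → none (S , mod , proper , s≤S) }
    ... | yes (S , mod , (z , z∉S) , s≤S) =
      descend (size S) (rec (proper-count (lookup S) z (∉⇒lookup z∉S))) (ι ∘ at) (E-inj ∘ ι-inj) hom′ s≤S
      where
      open Enumeration (enumerate (lookup S)) renaming (injective to E-inj)
      at∈ : ∀ i → at i ∈ S
      at∈ i = lookup⇒[]= (at i) S (sound i)
      -- A module of a module is a module of the whole: a vertex outside the smaller one is either
      -- outside the larger one or covered by `mod`.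
      hom′ : ∀ z → (∀ i → z ≢ ι (at i)) → ∀ i j → col z (ι (at i)) ≡ col z (ι (at j))
      hom′ z z≢ i j with any? (λ i → z ≟ ι i)
      ... | no z≢ι = hom z (λ i z≡ → z≢ι (i , z≡)) (at i) (at j)
      ... | yes (y , refl) = mod y
        (λ y∈S → z≢ (index y ([]=⇒lookup y∈S)) (cong ι (sym (complete y _)))) (at i) (at∈ i) (at j) (at∈ j)

  module _ {n k} (col : Colours n k) (symm : Symm col) (rf : RainbowFree col) where

    -- The sets `comp w` are the components with respect to the colours `r` and `b` of a Gallai cut.
    -- They are proper modules, so each has fewer than `s` vertices when all proper modules are that
    -- small.
    record TwoColoured (s : ℕ) : Set where
      field
        r b : Fin k
        comp : Fin n → Subset n
        own : ∀ w → w ∈ comp w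
        twin : ∀ w → Module col (comp w)
        two : ∀ w x y → x ∈ comp w → y ∉ comp w → Two r b (col x y)
        few : ∀ w → size (comp w) < s

      two-apart : ∀ w a → a ∉ comp w → Two r b (col w a)
      two-apart w a = two w w a (own w)

      outside-comp : ∀ w → n ≤ count (λ a → does (¬? (a ∈? comp w))) + s
      outside-comp w = ≤-trans
        (pigeonhole-count _ at λ a a∈ → index a ([]=⇒lookup (in-comp a a∈)) , sym (complete a _))
        (+-monoʳ-≤ _ (<⇒≤ (few w)))
        where
        open Enumeration (enumerate (lookup (comp w)))
        in-comp : ∀ a → does (¬? (a ∈? comp w)) ≡ false → a ∈ comp w
        in-comp a ≡false with a ∈? comp w
        ... | yes a∈ = a∈

      dense-from : ∀ {r′ b′} → (∀ w a → a ∉ comp w → Two r′ b′ (col w a)) → Dense col r′ b′ s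
      dense-from {r′} {b′} two′ w = begin
        n
          ≤⟨ outside-comp w ⟩
        count (λ a → does (¬? (a ∈? comp w))) + s
          ≤⟨ +-monoˡ-≤ s (sum-mono each) ⟩
        sum (λ a → 𝟙 (first col r′ b′ w a) + 𝟙 (second col r′ b′ w a)) + s
          ≡⟨ cong (_+ s) (∑-distrib-+ (𝟙 ∘ first col r′ b′ w) (𝟙 ∘ second col r′ b′ w)) ⟩
        count (first col r′ b′ w) + count (second col r′ b′ w) + s ∎
        where
        open ≤-Reasoning
        each : ∀ a → 𝟙 (does (¬? (a ∈? comp w))) ≤ 𝟙 (first col r′ b′ w a) + 𝟙 (second col r′ b′ w a)
        each a = 𝟙-≤ (¬? (a ∈? comp w)) λ a∉ → by-colour a∉ (two′ w a a∉) (col w a ≟ r′)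
          where
          by-colour : a ∉ comp w → Two r′ b′ (col w a) → Dec (col w a ≡ r′) →
            1 ≤ 𝟙 (first col r′ b′ w a) + 𝟙 (second col r′ b′ w a)
          by-colour a∉ _ (yes ≡r) =
            m≤n⇒m≤n+o _ (𝟙-true (first? col r′ b′ w a) ((λ { refl → a∉ (own w) }) , ≡r))
          by-colour a∉ (inj₁ ≡r) (no ≢r) = contradiction ≡r ≢r
          by-colour a∉ (inj₂ ≡b) (no ≢r) =
            m≤n⇒m≤o+n _ (𝟙-true (second? col r′ b′ w a) ((λ { refl → a∉ (own w) }) , ≡b , ≢r))

      dense : Dense col r b s
      dense = dense-from two-apart

      -- `twins-config` takes the colour of the larger class as the first colour, and this may be
      -- `b`.
      dense-swapped : Dense col b r s
      dense-swapped = dense-from λ w a a∉ → Data.Sum.swap (two-apart w a a∉)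

  two-coloured : ∀ {n k} (col : Colours n k) (symm : Symm col) (rf : RainbowFree col) → ∀ {s} → 2 ≤ n →
    SmallModules col s → TwoColoured col symm rf s
  two-coloured {suc zero} col symm rf (s≤s ())
  two-coloured {suc (suc n)} col symm rf {s} _ small with gallai-cut col symm rf
  ... | r , b , S , closed , (x₀ , x₀∈S) , y₀ , y₀∉S = record
    { r = r ; b = b ; comp = λ w → proj₁ (comp w)
    ; own = λ w → proj₁ (proj₂ (comp w))
    ; twin = mod
    ; two = λ w → proj₁ (proj₂ (proj₁ (proj₂ (proj₂ (comp w)))))
    ; few = λ w → small (proj₁ (comp w)) (mod w) (proj₂ (proj₂ (proj₂ (comp w))))
    }
    where
    -- The component is formed inside the side of the cut that contains `w`; a vertex of the other
    -- side shows that it is proper.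
    comp : ∀ w → ∃ λ D → w ∈ D × Component col r b w D × ∃ λ z → z ∉ D
    comp w with w ∈? S
    ... | yes w∈S with component col r b w S w∈S closed
    ... | D , D⊆S , D-comp = D , proj₁ D-comp , D-comp , y₀ , y₀∉S ∘ D⊆S
    comp w | no w∉S with component col r b w (∁ S) (x∉p⇒x∈∁p w∉S) (closed-∁ col symm rf closed)
    ... | D , D⊆∁S , D-comp = D , proj₁ D-comp , D-comp , x₀ , λ x₀∈D → x∈∁p⇒x∉p (D⊆∁S x₀∈D) x₀∈S
    mod : ∀ w → Module col (proj₁ (comp w))
    mod w z z∉D x x∈D y y∈D = trans (hom z z∉D x x∈D) (sym (hom z z∉D y y∈D))
      where hom = component-homogeneous col symm rf (proj₁ (proj₂ (proj₂ (comp w))))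

-- Configurations from outside vertices, from twins, and from two colours.

module Cases where
  open FiniteSums
  open Averaging
  open Configurations
  open RandomColouring using (all-≡⇒allowed)
  open GallaiCut
  open SmallModules

  open import Data.Fin using (splitAt; inject≤)
  open import Data.Fin.Properties using (_≟_; all?; any?; inject≤-injective)
  open import Data.Vec.Properties using (map-∘; []=⇒lookup)
  open import Data.Fin.Subset using (_∈_; _∉_)
  open import Data.Fin.Subset.Properties using (_∈?_)

  config-map : ∀ {n m k s t} (col : Colours n k) (ι : Fin m → Fin n) → Injective _≡_ _≡_ ι →
    Config (restrict col ι) s t → Config col s t
  config-map col ι inj cfg = record
    { a = map ι a ; c = c ; b = ι ∘ b
    ; a-distinct = map-fresh ι inj (λ _ ()) a a-distinct
    ; b-injective = b-injective ∘ inj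
    ; hit = λ j → hit-map (hit j) }
    where
    open Config cfg
    hit-map : ∀ {i} → Hit (restrict col ι) a c i → Hit col (map ι a) c (ι i)
    hit-map (≢a , al) = Allₚ.map⁺ (All.map (_∘ inj) ≢a) , subst (Allowed c) (map-∘ (col _) ι a) al

  restrict-rainbowFree : ∀ {n m k} {col : Colours n k} {ι : Fin m → Fin n} → Injective _≡_ _≡_ ι →
    RainbowFree col → RainbowFree (restrict col ι)
  restrict-rainbowFree inj rf x≢y y≢z x≢z = rf (x≢y ∘ inj) (y≢z ∘ inj) (x≢z ∘ inj)

  module _ {n k s N : ℕ} (col : Colours n k) (C : Core col (suc s) N) where
    open Core C

    private
      col′ = restrict col ι
      i₀ : Fin N
      i₀ = inject≤ zero large

    outside? : ∀ w → Dec (∀ i → w ≢ ι i)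
    outside? w = all? λ i → ¬? (w ≟ ι i)

    n∸N≤outside : n ∸ N ≤ count (λ w → does (outside? w))
    n∸N≤outside = m≤n+o⇒m∸n≤o n N (≤-trans (pigeonhole-count _ ι cover) (≤-reflexive (+-comm _ N)))
      where
      cover : ∀ w → does (outside? w) ≡ false → ∃ λ i → w ≡ ι i
      cover w ≡false with any? (λ i → w ≟ ι i)
      ... | yes found = found
      ... | no none = contradiction (trans (sym (dec-true (outside? w) λ i w≡ → none (i , w≡))) ≡false) λ ()

    -- A vertex outside a module sees it in one colour, hence is a hit for all
    -- tuples inside.
    outer-config : ∀ {t} (a : Vec (Fin N) (suc s)) c → Fresh [] a →
      t ≤ count (λ i → does (hit? col′ a c i)) + (n ∸ N) → Config col (suc s) t
    outer-config {t} a c fr t≤ = config-from-hits col (map ι a) c (map-fresh ι injective (λ _ ()) a fr)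
      (≤-trans t≤ (≤-trans (+-monoʳ-≤ x n∸N≤outside)
        (injection⇒≤count _ _ (join-injective x {y} {ι ∘ In.at} {Out.at} (In.injective ∘ injective) Out.injective
            (λ i j eq → does⇒ (outside? (Out.at j)) (Out.sound j) (In.at i) (sym eq)))
          (λ u → dec-true (hit? col (map ι a) c _) (hits u)))))
      where
      module In = Enumeration (enumerate λ i → does (hit? col′ a c i))
      module Out = Enumeration (enumerate λ w → does (outside? w))
      x = count λ i → does (hit? col′ a c i)
      y = count λ w → does (outside? w)
      hits : ∀ u → Hit col (map ι a) c ([ ι ∘ In.at , Out.at ]′ (splitAt x u))
      hits u with splitAt x u
      ... | inj₁ i with does⇒ (hit? col′ a c (In.at i)) (In.sound i)
      ... | ≢a , al = Allₚ.map⁺ (All.map (_∘ injective) ≢a) , subst (Allowed c) (map-∘ (col _) ι a) al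
      hits u | inj₂ j = Allₚ.map⁺ (All.universal out a) ,
        all-≡⇒allowed c (Allₚ.map⁺ (Allₚ.map⁺ (All.universal (λ i → homogeneous (Out.at j) out i i₀) a)))
        where
        out : ∀ i → Out.at j ≢ ι i
        out = does⇒ (outside? (Out.at j)) (Out.sound j)

    case-outside-large : ∀ {t} → t ≤ n ∸ N → Config col (suc s) t
    -- Vertices outside the module fit any colours; the loop colour `col′ i₀ i₀` merely supplies an
    -- element of `Fin k`.
    case-outside-large t≤ = outer-config (tabulate λ i → inject≤ i large) (replicate (suc s) (col′ i₀ i₀))
      (injective⇒fresh _ (inject≤-injective large large _ _) λ _ ()) (m≤n⇒m≤o+n _ t≤)

    module _ (symm : Symm col) (rf : RainbowFree col) where

      private
        symm′ : Symm col′
        symm′ x y = symm (ι x) (ι y)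
        rf′ : RainbowFree col′
        rf′ = restrict-rainbowFree injective rf

      case-inside : ∀ {t τ} → TwoColoured col′ symm′ rf′ (suc s) →
        2 ^ suc s * τ + loss (suc s) 0 (suc s) < N * suc (suc s) → t ≤ suc τ + (n ∸ N) → Config col (suc s) t
      case-inside {t} {τ} tc big t≤ =
        let as , fr , τ< = frequent-hit col′ r b (suc s) {N} {suc s} {τ} [] id dense ≤-refl big
        in outer-config as (replicate (suc s) r) fr (≤-trans t≤ (+-monoˡ-≤ (n ∸ N) τ<))
        where open TwoColoured tc

      -- With `z` in front of the tuple, all vertices of the module agree in the first position.
      -- Only `s` of the s + 1 positions are left to the averaging, and the fraction rises from (s +
      -- 2) / 2 ^ (s + 1) to (s + 1) / 2 ^ s.
      case-outside-nonempty : ∀ {τ} → TwoColoured col′ symm′ rf′ (suc s) → ∀ z → (∀ i → z ≢ ι i) →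
        2 ^ s * τ + loss s 0 (suc s) < N * suc s → Config col (suc s) (suc τ)
      case-outside-nonempty {τ} tc z z∉ big =
        let as , fr , τ< = frequent-hit col′ r b s {N} {suc s} {τ} [] id dense ≤-refl big
            f , f-inj , f-hits = ≤count⇒injection (λ i → does (hit? col′ as (replicate s r) i)) τ<
        in assemble as fr f f-inj λ j → does⇒ (hit? col′ as (replicate s r) (f j)) (f-hits j)
        where
        open TwoColoured tc
        prepend : ∀ {i as} → Hit col′ as (replicate s r) i →
          Hit col (z ∷ map ι as) (col z (ι i₀) ∷ replicate s r) (ι i)
        prepend {i} {as} (≢as , al) = (z∉ i ∘ sym) ∷ Allₚ.map⁺ (All.map (_∘ injective) ≢as) ,
          subst (λ x → Allowed (x ∷ replicate s r) (map (col (ι i)) (z ∷ map ι as)))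
            (trans (symm (ι i) z) (homogeneous z z∉ i i₀))
            (agree (subst (Allowed (replicate s r)) (map-∘ (col (ι i)) ι as) al))
        assemble : ∀ as → Fresh [] as → (f : Fin (suc τ) → Fin N) → Injective _≡_ _≡_ f →
          (∀ j → Hit col′ as (replicate s r) (f j)) → Config col (suc s) (suc τ)
        assemble as fr f f-inj hits = record
          { a = z ∷ map ι as
          ; c = col z (ι i₀) ∷ replicate s r
          ; b = ι ∘ f
          ; a-distinct = (λ ()) , map-fresh ι injective (λ { x (here eq) → contradiction (sym eq) (z∉ x) }) as fr
          ; b-injective = f-inj ∘ injective
          ; hit = prepend ∘ hits }

  -- A third colour on the edge uv makes u and v twins with respect to the vertices
  -- outside the component of u.
  module _ {n k : ℕ} {col : Colours n k} {symm : Symm col} {rf : RainbowFree col} {h : ℕ}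
    (tc : TwoColoured col symm rf h) {u v : Fin n} (u≢v : u ≢ v)
    (third : ¬ Two (TwoColoured.r tc) (TwoColoured.b tc) (col u v)) where
    open TwoColoured tc

    v∈comp : v ∈ comp u
    v∈comp = decidable-stable (v ∈? comp u) (third ∘ two-apart u v)

    -- For tuples of length 2 this alone excludes a third colour, since components then have fewer
    -- than 2 vertices.
    component-size : 2 ≤ size (comp u)
    component-size = injection⇒≤count (lookup (comp u)) f f-injective f∈
      where
      f : Fin 2 → Fin n
      f zero = u
      f (suc zero) = v
      f-injective : Injective _≡_ _≡_ f
      f-injective {zero} {zero} eq = refl
      f-injective {zero} {suc zero} eq = contradiction eq u≢v
      f-injective {suc zero} {zero} eq = contradiction (sym eq) u≢v
      f-injective {suc zero} {suc zero} eq = refl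
      f∈ : ∀ j → lookup (comp u) (f j) ≡ true
      f∈ zero = []=⇒lookup (own u)
      f∈ (suc zero) = []=⇒lookup v∈comp

    class? : ∀ x w → Dec (w ∉ comp u × col w u ≡ x)
    class? x w = ¬? (w ∈? comp u) ×-dec (col w u ≟ x)

    class : Fin k → ℕ
    class x = count λ w → does (class? x w)

    class≤n : ∀ x → class x ≤ n
    class≤n x = ≤-trans (sum-mono λ w → 𝟙≤1 (does (class? x w)))
      (≤-reflexive (trans (sum-const n 1) (*-identityʳ n)))

    classes-cover : n ≤ class r + class b + h
    classes-cover = ≤-trans (outside-comp u) (+-monoˡ-≤ h (≤-trans
      (sum-mono λ w → 𝟙-≤ (¬? (w ∈? comp u)) λ w∉ → by-colour w w∉ (two-apart′ w w∉))
      (≤-reflexive (∑-distrib-+ (λ w → 𝟙 (does (class? r w))) (λ w → 𝟙 (does (class? b w)))))))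
      where
      two-apart′ : ∀ w → w ∉ comp u → Two r b (col w u)
      two-apart′ w w∉ = subst (Two r b) (symm u w) (two-apart u w w∉)
      by-colour : ∀ w → w ∉ comp u → Two r b (col w u) → 1 ≤ 𝟙 (does (class? r w)) + 𝟙 (does (class? b w))
      by-colour w w∉ (inj₁ ≡r) = m≤n⇒m≤n+o _ (𝟙-true (class? r w) (w∉ , ≡r))
      by-colour w w∉ (inj₂ ≡b) = m≤n⇒m≤o+n _ (𝟙-true (class? b w) (w∉ , ≡b))

    -- The vertices of one class see both `u` and `v` in `r′`, so only `s` of the s + 2 positions
    -- are left to the averaging. The larger class has about n / 2 vertices, which gives the
    -- fraction (s + 1) / 2 ^ (s + 1) of all vertices, against (s + 3) / 2 ^ (s + 2): a gain for s ≥
    -- 2, but only a tie for s = 1.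
    twins-config : ∀ s {τ} r′ b′ → Dense col r′ b′ h → 2 ^ s * τ + loss s 2 h < class r′ * suc s →
      Config col (2 + s) (suc τ)
    twins-config s {τ} r′ b′ dense′ big =
      let as , fr , τ< = frequent-hit col r′ b′ s {class r′} {h} {τ} (v ∷ u ∷ []) at dense′ (class≤n r′) big
      in choose as fr (≤count⇒injection (λ i → does (hit? col as (replicate s r′) (at i))) τ<)
      where
      open Enumeration (enumerate λ w → does (class? r′ w)) renaming (injective to at-inj)
      prepend : ∀ as {w} → w ∉ comp u × col w u ≡ r′ → Hit col as (replicate s r′) w →
        Hit col (u ∷ v ∷ as) (r′ ∷ r′ ∷ replicate s r′) w
      prepend as {w} (w∉ , wu≡r) (≢as , al) =
        (λ { refl → w∉ (own u) }) ∷ (λ { refl → w∉ v∈comp }) ∷ ≢as ,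
        subst₂ (λ x y → Allowed (r′ ∷ r′ ∷ replicate s r′) (x ∷ y ∷ map (col w) as)) (sym wu≡r)
          (trans (sym wu≡r) (twin u w w∉ u (own u) v v∈comp)) (agree (agree al))
      choose : (as : Vec (Fin n) s) → Fresh (v ∷ u ∷ []) as →
        (Σ (Fin (suc τ) → Fin (class r′)) λ f → Injective _≡_ _≡_ f ×
          (∀ j → does (hit? col as (replicate s r′) (at (f j))) ≡ true)) → Config col (2 + s) (suc τ)
      choose as fr (f , f-inj , f-hits) = record
        { a = u ∷ v ∷ as ; c = r′ ∷ r′ ∷ replicate s r′ ; b = at ∘ f
        ; a-distinct = (λ ()) , (λ { (here eq) → u≢v (sym eq) }) , fr
        ; b-injective = f-inj ∘ at-inj
        ; hit = λ j → prepend as (does⇒ (class? r′ (at (f j))) (sound (f j)))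
            (does⇒ (hit? col as (replicate s r′) (at (f j))) (f-hits j)) }

    -- For w outside the four components, at least 4 of the 7 configurations below
    -- hit w: the colour of wu makes one of the two given by (u , v , a i) hit w, both
    -- do so if w (a i) has the same colour, and if this happens for no i then
    -- (a 0 , a 1 , a 2) hits w.
    triple-bound : ∀ t (a : Fin 3 → Fin n) → Injective _≡_ _≡_ a → (∀ i → a i ∉ comp u) →
      (∀ (as : Vec (Fin n) 3) c → Fresh [] as → count (λ w → does (hit? col as c w)) ≤ t) →
      4 * n ≤ 7 * t + 16 * h
    triple-bound t a a-inj a∉ few-hits = total
      where
      one two₃ : Fin 3
      one = suc zero
      two₃ = suc (suc zero)
      α? : ∀ i x w → Dec (Hit col (u ∷ v ∷ a i ∷ []) (x ∷ x ∷ x ∷ []) w)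
      α? i x w = hit? col (u ∷ v ∷ a i ∷ []) (x ∷ x ∷ x ∷ []) w
      β? : ∀ w → Dec (Hit col (tabulate a) (replicate 3 r) w)
      β? w = hit? col (tabulate a) (replicate 3 r) w
      α-few : ∀ i x → count (λ w → does (α? i x w)) ≤ t
      α-few i x = few-hits (u ∷ v ∷ a i ∷ []) (x ∷ x ∷ x ∷ []) ((λ ()) , (λ { (here eq) → u≢v (sym eq) }) ,
        (λ { (here eq) → a∉ i (subst (_∈ comp u) (sym eq) v∈comp)
           ; (there (here eq)) → a∉ i (subst (_∈ comp u) (sym eq) (own u)) }) , _)
      β-few : count (λ w → does (β? w)) ≤ t
      β-few = few-hits (tabulate a) (replicate 3 r) (injective⇒fresh a a-inj λ _ ())
      inComp : Fin n → Fin n → ℕ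
      inComp x w = 𝟙 (lookup (comp x) w)
      -- The terms with `inComp` count vertices of the four components fully, with weight 4, since
      -- nothing is claimed about hits there.
      A : Fin n → Fin 3 → ℕ
      A w i = 𝟙 (does (α? i r w)) + 𝟙 (does (α? i b w)) + 4 * inComp (a i) w
      B : Fin n → ℕ
      B w = 𝟙 (does (β? w)) + 4 * inComp u w

      pointwise : ∀ w → 4 ≤ sum (A w) + B w
      pointwise w = by-component (w ∈? comp u) (any? λ i → w ∈? comp (a i))
        where
        four : ∀ {x} → w ∈ comp x → 4 ≤ 4 * inComp x w
        four w∈ rewrite []=⇒lookup w∈ = ≤-refl
        by-colour : w ∉ comp u → (∀ i → w ∉ comp (a i)) → 4 ≤ sum (A w) + B w
        by-colour w∉u w∉a = ≤-trans
          (conclude (any? λ i → col w (a i) ≟ col w u))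
          (+-mono-≤ (sum-mono each) (m≤m+n (𝟙 (does (β? w))) (4 * inComp u w)))
          where
          same? : ∀ i → Dec (col w (a i) ≡ col w u)
          same? i = col w (a i) ≟ col w u
          w≢u : w ≢ u
          w≢u refl = w∉u (own u)
          w≢v : w ≢ v
          w≢v refl = w∉u v∈comp
          w≢a : ∀ i → w ≢ a i
          w≢a i refl = w∉a i (own (a i))
          wv≡wu : col w v ≡ col w u
          wv≡wu = twin u w w∉u v v∈comp u (own u)
          wu-two : Two r b (col w u)
          wu-two = subst (Two r b) (symm u w) (two-apart u w w∉u)
          wa-two : ∀ i → Two r b (col w (a i))
          wa-two i = subst (Two r b) (symm (a i) w) (two-apart (a i) w (w∉a i))
          ≢uva : ∀ i → All (w ≢_) (u ∷ v ∷ a i ∷ [])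
          ≢uva i = w≢u ∷ w≢v ∷ w≢a i ∷ []
          α-own : ∀ i x → col w u ≡ x → 1 ≤ 𝟙 (does (α? i x w))
          α-own i x refl = 𝟙-true (α? i x w) (≢uva i ,
            subst (λ y → Allowed (col w u ∷ col w u ∷ col w u ∷ []) (col w u ∷ y ∷ col w (a i) ∷ [])) (sym wv≡wu) (agree (agree (flat []))))
          α-same : ∀ i x → 𝟙 (does (same? i)) ≤ 𝟙 (does (α? i x w))
          α-same i x = 𝟙-≤ (same? i) λ wa≡wu → 𝟙-true (α? i x w) (≢uva i , flat (wv≡wu ∷ wa≡wu ∷ []))
          each : ∀ i → 1 + 𝟙 (does (same? i)) ≤ A w i
          each i = m≤n⇒m≤n+o (4 * inComp (a i) w) (both wu-two)
            where
            both : Two r b (col w u) → 1 + 𝟙 (does (same? i)) ≤ 𝟙 (does (α? i r w)) + 𝟙 (does (α? i b w))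
            both (inj₁ ≡r) = +-mono-≤ (α-own i r ≡r) (α-same i b)
            both (inj₂ ≡b) = ≤-trans (+-mono-≤ (α-own i b ≡b) (α-same i r))
              (≤-reflexive (+-comm (𝟙 (does (α? i b w))) _))
          same-sum : sum (λ i → 1 + 𝟙 (does (same? i))) ≡ 3 + sum (λ i → 𝟙 (does (same? i)))
          same-sum = ∑-distrib-+ (λ (i : Fin 3) → 1) (λ i → 𝟙 (does (same? i)))
          opposite : (∀ i → col w (a i) ≢ col w u) → ∀ i → col w (a i) ≡ col w (a zero)
          opposite ≢u i with wu-two | wa-two i | wa-two zero
          ... | inj₁ ur | inj₁ ir | _ = contradiction (trans ir (sym ur)) (≢u i)
          ... | inj₁ ur | _ | inj₁ zr = contradiction (trans zr (sym ur)) (≢u zero)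
          ... | inj₁ ur | inj₂ ib | inj₂ zb = trans ib (sym zb)
          ... | inj₂ ub | inj₂ ib | _ = contradiction (trans ib (sym ub)) (≢u i)
          ... | inj₂ ub | _ | inj₂ zb = contradiction (trans zb (sym ub)) (≢u zero)
          ... | inj₂ ub | inj₁ ir | inj₁ zr = trans ir (sym zr)
          conclude : Dec (∃ λ i → col w (a i) ≡ col w u) →
            4 ≤ sum (λ i → 1 + 𝟙 (does (same? i))) + 𝟙 (does (β? w))
          conclude (yes (i , wa≡wu)) = m≤n⇒m≤n+o _ (subst (4 ≤_) (sym same-sum)
            (+-monoʳ-≤ 3 (≤-trans (𝟙-true (same? i) wa≡wu) (member≤sum (λ i → 𝟙 (does (same? i))) i))))
          conclude (no ¬same) = +-mono-≤ (subst (3 ≤_) (sym same-sum) (m≤m+n 3 _))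
            (𝟙-true (β? w) (Allₚ.tabulate⁺ w≢a , flat (opp one ∷ opp two₃ ∷ [])))
            where opp = opposite λ i wa≡wu → ¬same (i , wa≡wu)
        by-component : Dec (w ∈ comp u) → Dec (∃ λ i → w ∈ comp (a i)) → 4 ≤ sum (A w) + B w
        by-component (yes w∈u) _ = m≤n⇒m≤o+n (sum (A w)) (m≤n⇒m≤o+n (𝟙 (does (β? w))) (four w∈u))
        by-component (no _) (yes (i , w∈a)) =
          m≤n⇒m≤n+o (B w) (≤-trans (m≤n⇒m≤o+n (𝟙 (does (α? i r w)) + 𝟙 (does (α? i b w))) (four w∈a)) (member≤sum (A w) i))
        by-component (no w∉u) (no ¬w∈a) = by-colour w∉u λ i w∈ → ¬w∈a (i , w∈)

      comp-few : ∀ x → sum (λ w → 4 * inComp x w) ≤ 4 * h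
      comp-few x = ≤-trans (≤-reflexive (*-sum 4 (inComp x))) (*-monoʳ-≤ 4 (<⇒≤ (few x)))
      open ≤-Reasoning
      A-few : ∀ i → sum (λ w → A w i) ≤ t + t + 4 * h
      A-few i = begin
        sum (λ w → A w i)
          ≡⟨ ∑-distrib-+ (λ w → 𝟙 (does (α? i r w)) + 𝟙 (does (α? i b w))) (λ w → 4 * inComp (a i) w) ⟩
        sum (λ w → 𝟙 (does (α? i r w)) + 𝟙 (does (α? i b w))) + sum (λ w → 4 * inComp (a i) w)
          ≡⟨ cong (_+ sum (λ w → 4 * inComp (a i) w))
               (∑-distrib-+ (λ w → 𝟙 (does (α? i r w))) (λ w → 𝟙 (does (α? i b w)))) ⟩
        count (λ w → does (α? i r w)) + count (λ w → does (α? i b w)) + sum (λ w → 4 * inComp (a i) w)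
          ≤⟨ +-mono-≤ (+-mono-≤ (α-few i r) (α-few i b)) (comp-few (a i)) ⟩
        t + t + 4 * h ∎
      total : 4 * n ≤ 7 * t + 16 * h
      total = begin
        4 * n ≡⟨ *-comm 4 n ⟩
        n * 4 ≡⟨ sum-const n 4 ⟨
        sum {n} (λ w → 4) ≤⟨ sum-mono pointwise ⟩
        sum (λ w → sum (A w) + B w) ≡⟨ ∑-distrib-+ (sum ∘ A) B ⟩
        sum (sum ∘ A) + sum B ≡⟨ cong₂ _+_ (∑-comm A)
                                                (∑-distrib-+ (λ w → 𝟙 (does (β? w))) (λ w → 4 * inComp u w)) ⟩
        sum (λ i → sum (λ w → A w i)) + (count (λ w → does (β? w)) + sum (λ w → 4 * inComp u w))
                                           ≤⟨ +-mono-≤ (sum-mono A-few) (+-mono-≤ β-few (comp-few u)) ⟩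
        sum {3} (λ i → t + t + 4 * h) + (t + 4 * h)
                                           ≡⟨ lemma t h ⟩
        7 * t + 16 * h ∎
        where
        lemma : ∀ t h → (t + t + 4 * h) + ((t + t + 4 * h) + ((t + t + 4 * h) + 0)) + (t + 4 * h) ≡ 7 * t + 16 * h
        lemma = solve-∀

    -- Resolves the tie of `twins-config` for tuples of length 3: some configuration of the seven
    -- has about 4 n / 7 hits, more than n / 2.
    triple-config : ∀ t → 3 + h ≤ n → 7 * t + 16 * h < 4 * n → Config col 3 t
    triple-config t 3+h≤n big = decide (config? col 3 t)
      (≤count⇒injection (λ a → does (¬? (a ∈? comp u))) (+-cancelʳ-≤ h 3 _ (≤-trans 3+h≤n (outside-comp u))))
      where
      decide : Dec (Config col 3 t) → (Σ (Fin 3 → Fin n) λ a → Injective _≡_ _≡_ a × (∀ i → does (¬? (a i ∈? comp u)) ≡ true)) →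
        Config col 3 t
      decide (yes cfg) _ = cfg
      decide (no none) (a , a-inj , a-out) = contradiction
        (triple-bound t a a-inj (λ i → does⇒ (¬? (a i ∈? comp u)) (a-out i))
          λ as c fr → ≮⇒≥ λ t< → none (config-from-hits col as c fr (<⇒≤ t<)))
        (<⇒≱ big)

  two-colours-config : ∀ {n k s t} (col : Colours n k) → Symm col → ∀ r b →
    (∀ u v → u ≢ v → Two r b (col u v)) →
    ((col₂ : Colours n 2) → Symm col₂ → Config col₂ s t) → Config col s t
  two-colours-config {n} {k} {s} {t} col symm r b all-two config₂ = record
    { a = a ; c = map name c ; b = bs ; a-distinct = a-distinct ; b-injective = b-injective
    ; hit = λ j → proj₁ (hit j) , subst (Allowed _) (row (bs j) a (proj₁ (hit j))) (allowed-map (proj₂ (hit j))) }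
    where
    -- Colours other than `r` and `b` occur only on loops, so their image does not affect any row.
    bit : Fin k → Fin 2
    bit x with x ≟ r
    ... | yes _ = zero
    ... | no _ = suc zero
    name : Fin 2 → Fin k
    name zero = r
    name (suc zero) = b
    name-bit : ∀ {x} → Two r b x → name (bit x) ≡ x
    name-bit {x} two with x ≟ r | two
    ... | yes x≡r | _ = sym x≡r
    ... | no x≢r | inj₁ x≡r = contradiction x≡r x≢r
    ... | no x≢r | inj₂ x≡b = sym x≡b
    open Config (config₂ (λ u v → bit (col u v)) (λ u v → cong bit (symm u v))) renaming (b to bs)
    row : ∀ w {m} (as : Vec (Fin n) m) → All (w ≢_) as → map name (map (λ x → bit (col w x)) as) ≡ map (col w) as
    row w [] [] = refl
    row w (x ∷ as) (w≢x ∷ w∉as) = cong₂ _∷_ (name-bit (all-two w x w≢x)) (row w as w∉as)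
    allowed-map : ∀ {m} {cs vs : Vec (Fin 2) m} → Allowed cs vs → Allowed (map name cs) (map name vs)
    allowed-map [] = []
    allowed-map (agree al) = agree (allowed-map al)
    allowed-map (flat same) = flat (Allₚ.map⁺ (All.map (cong name) same))

-- The gains of the structural cases against the error terms.

module GallaiConfiguration where
  open FiniteSums
  open Averaging
  open Configurations
  open GallaiCut
  open SmallModules
  open Cases

  open import Data.Fin.Properties using (_≟_; any?; injective⇒≤)

  private
    -- The `g` outside vertices all count on the left, but only with the fraction P / Q in the bound
    -- for `N + g`. The surplus (Q - P) g ≥ g pays for δ and `c`.
    slack-inside : ∀ {Q P} N g τ δ c → P < Q → Q * (suc τ + g) ≤ P * (N + g) + δ → δ + c < g → Q * τ + c < N * P
    slack-inside {Q} {P} N g τ δ c P<Q hyp δ+c<g = +-cancelʳ-< (P * g + δ) _ _ (begin-strict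
      Q * τ + c + (P * g + δ) ≡⟨ shuffle (Q * τ) c (P * g) δ ⟩
      Q * τ + P * g + (δ + c) <⟨ +-monoʳ-< (Q * τ + P * g) δ+c<g ⟩
      Q * τ + P * g + g ≡⟨ +-assoc (Q * τ) (P * g) g ⟩
      Q * τ + (P * g + g) ≡⟨ cong (Q * τ +_) (+-comm (P * g) g) ⟩
      Q * τ + suc P * g ≤⟨ +-mono-≤ (*-monoʳ-≤ Q (n≤1+n τ)) (*-monoˡ-≤ g P<Q) ⟩
      Q * suc τ + Q * g ≡⟨ *-distribˡ-+ Q (suc τ) g ⟨
      Q * (suc τ + g) ≤⟨ hyp ⟩
      P * (N + g) + δ ≡⟨ expand P N g δ ⟩
      N * P + (P * g + δ) ∎)
      where
      open ≤-Reasoning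
      shuffle : ∀ a c p δ → a + c + (p + δ) ≡ a + p + (δ + c)
      shuffle = solve-∀
      expand : ∀ P N g δ → P * (N + g) + δ ≡ N * P + (P * g + δ)
      expand = solve-∀

    -- Doubling the fraction s / Q to the denominator of the hypothesis gives 2 s ≥ P + 1, hence a
    -- surplus of `N`.
    slack-outside : ∀ {Q P s} N g τ δ c → P < 2 * s → 2 * Q * suc τ ≤ P * (N + g) + δ → P * g + δ + 2 * c < N →
      Q * τ + c < N * s
    slack-outside {Q} {P} {s} N g τ δ c P<2s hyp big = *-cancelˡ-< 2 _ _ (+-cancelʳ-< (P * g + δ) _ _ (begin-strict
      2 * (Q * τ + c) + (P * g + δ) ≡⟨ shuffle Q τ c (P * g + δ) ⟩
      2 * Q * τ + (P * g + δ + 2 * c) <⟨ +-mono-≤-< (*-monoʳ-≤ (2 * Q) (n≤1+n τ)) big ⟩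
      2 * Q * suc τ + N ≤⟨ +-monoˡ-≤ N hyp ⟩
      P * (N + g) + δ + N ≡⟨ expand P N g δ ⟩
      suc P * N + (P * g + δ) ≤⟨ +-monoˡ-≤ (P * g + δ) (*-monoˡ-≤ N P<2s) ⟩
      2 * s * N + (P * g + δ) ≡⟨ cong (_+ (P * g + δ)) (swap s N) ⟩
      2 * (N * s) + (P * g + δ) ∎))
      where
      open ≤-Reasoning
      shuffle : ∀ Q τ c x → 2 * (Q * τ + c) + x ≡ 2 * Q * τ + (x + 2 * c)
      shuffle = solve-∀
      expand : ∀ P N g δ → P * (N + g) + δ + N ≡ suc P * N + (P * g + δ)
      expand = solve-∀
      swap : ∀ s N → 2 * s * N ≡ 2 * (N * s)
      swap = solve-∀

    -- As before the surplus is `N`. Here `x` is the larger of two classes that miss at most `h`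
    -- vertices, which halves the fraction and costs (P + 1) h.
    slack-twins : ∀ {Q P r} N x h τ δ c → P < 2 * r → 2 * (2 * Q) * suc τ ≤ P * N + δ → N ≤ x + x + h →
      δ + suc P * h + 4 * c < N → Q * τ + c < x * r
    slack-twins {Q} {P} {r} N x h τ δ c P<2r hyp N≤ big = *-cancelˡ-< 4 _ _ (+-cancelʳ-< (suc P * h) _ _ (begin-strict
      4 * (Q * τ + c) + suc P * h ≡⟨ shuffle Q τ c (suc P * h) ⟩
      2 * (2 * Q) * τ + (suc P * h + 4 * c) ≤⟨ +-monoˡ-≤ _ (*-monoʳ-≤ (2 * (2 * Q)) (n≤1+n τ)) ⟩
      2 * (2 * Q) * suc τ + (suc P * h + 4 * c)
                                              ≤⟨ +-monoˡ-≤ _ hyp ⟩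
      P * N + δ + (suc P * h + 4 * c) ≡⟨ shuffle′ (P * N) δ (suc P * h) (4 * c) ⟩
      P * N + (δ + suc P * h + 4 * c) <⟨ +-monoʳ-< (P * N) big ⟩
      P * N + N ≡⟨ +-comm (P * N) N ⟩
      suc P * N ≤⟨ *-monoʳ-≤ (suc P) N≤ ⟩
      suc P * (x + x + h) ≡⟨ *-distribˡ-+ (suc P) (x + x) h ⟩
      suc P * (x + x) + suc P * h ≤⟨ +-monoˡ-≤ (suc P * h) (*-monoˡ-≤ (x + x) P<2r) ⟩
      2 * r * (x + x) + suc P * h ≡⟨ cong (_+ suc P * h) (swap r x) ⟩
      4 * (x * r) + suc P * h ∎))
      where
      open ≤-Reasoning
      shuffle : ∀ Q τ c x → 4 * (Q * τ + c) + x ≡ 2 * (2 * Q) * τ + (x + 4 * c)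
      shuffle = solve-∀
      shuffle′ : ∀ p δ h c → p + δ + (h + c) ≡ p + (δ + h + c)
      shuffle′ = solve-∀
      swap : ∀ r x → 2 * r * (x + x) ≡ 4 * (x * r)
      swap = solve-∀

  2+s≤2^s : ∀ s → 2 ≤ s → 2 + s ≤ 2 ^ s
  2+s≤2^s (suc (suc zero)) _ = ≤-refl
  2+s≤2^s (suc zero) (s≤s ())
  2+s≤2^s (suc (suc (suc s))) _ = begin
    suc (4 + s) ≤⟨ s≤s (2+s≤2^s (suc (suc s)) (s≤s (s≤s z≤n))) ⟩
    1 + 2 ^ suc (suc s) ≤⟨ +-monoˡ-≤ (2 ^ suc (suc s)) (m^n>0 2 (suc (suc s))) ⟩
    2 ^ suc (suc s) + 2 ^ suc (suc s) ≡⟨ cong (2 ^ suc (suc s) +_) (+-identityʳ _) ⟨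
    2 ^ suc (suc (suc s)) ∎
    where open ≤-Reasoning

  -- One bound for the constants of all cases. The losses carry the factors 1, 2, 4 of the three
  -- inequalities above, (s + 2) s is the cost of the vertices outside both twin classes, and 49
  -- exceeds the 16 * 3 of `triple-config`.
  gap : ℕ → ℕ
  gap s = loss s 0 s + 2 * loss (s ∸ 1) 0 s + 4 * loss (s ∸ 2) 2 s + (s + 2) * s + 49

  module _ {n k : ℕ} (col : Colours n k) (symm : Symm col) (rf : RainbowFree col) where

    -- Components are single vertices for s = 2, `triple-config` serves s = 3, and `twins-config`
    -- for the larger class gains from s = 4 on.
    twins-case : ∀ s {t δ} (tc : TwoColoured col symm rf s) → 2 ≤ s → 2 ^ s * t ≤ suc s * n + δ → δ + gap s < t → t ≤ n →
      ∀ u v → u ≢ v → ¬ Two (TwoColoured.r tc) (TwoColoured.b tc) (col u v) → Config col s t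
    twins-case zero tc () hyp big t≤n u v u≢v third
    twins-case (suc zero) tc (s≤s ()) hyp big t≤n u v u≢v third
    twins-case (suc (suc zero)) tc _ hyp big t≤n u v u≢v third =
      contradiction (component-size tc u≢v third) (<⇒≱ (TwoColoured.few tc u))
    twins-case (suc (suc (suc zero))) {t} {δ} tc _ hyp big t≤n u v u≢v third =
      triple-config tc u≢v third t (≤-trans (≤-trans (m≤n⇒m≤o+n δ (from-yes (6 ≤? gap 3))) (<⇒≤ big)) t≤n)
        (+-cancelʳ-< δ _ _ (begin-strict
          7 * t + 16 * 3 + δ ≡⟨ +-assoc (7 * t) 48 δ ⟩
          7 * t + (48 + δ) <⟨ +-monoʳ-< (7 * t) (≤-<-trans
                                                   (≤-trans (≤-reflexive (+-comm 48 δ)) (+-monoʳ-≤ δ (from-yes (48 ≤? gap 3)))) big) ⟩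
          7 * t + t ≡⟨ +-comm (7 * t) t ⟩
          8 * t ≤⟨ hyp ⟩
          4 * n + δ ∎))
      where open ≤-Reasoning
    twins-case s@(suc (suc r@(suc (suc r′)))) {zero} {δ} tc _ hyp () t≤n u v u≢v third
    twins-case s@(suc (suc r@(suc (suc r′)))) {suc τ} {δ} tc _ hyp big t≤n u v u≢v third =
      by-class (≤-total (cls R) (cls B))
      where
      open TwoColoured tc renaming (r to R; b to B)
      cls : Fin k → ℕ
      cls = class tc u≢v third
      c = loss r 2 s
      -- The inequality s + 1 < 2 (s - 1), which is where s ≥ 4 enters.
      P<2r : suc s < 2 * suc r
      P<2r = ≤-trans (m≤m+n (suc (suc s)) r′) (≤-reflexive (lemma r′))
        where
        lemma : ∀ r′ → suc (suc (4 + r′)) + r′ ≡ 2 * suc (2 + r′)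
        lemma = solve-∀
      fits : δ + suc (suc s) * s + 4 * c < n
      fits = <-≤-trans (≤-<-trans (≤-trans (≤-reflexive (lemma₁ δ (suc (suc s) * s) (4 * c))) (+-monoʳ-≤ δ inner)) big) t≤n
        where
        lemma₁ : ∀ δ a c → δ + a + c ≡ δ + (a + c)
        lemma₁ = solve-∀
        lemma₂ : ∀ s c x y → suc (suc s) * s + c + (x + y + 49) ≡ x + y + c + (s + 2) * s + 49
        lemma₂ = solve-∀
        inner : suc (suc s) * s + 4 * c ≤ gap s
        inner = ≤-trans (m≤m+n _ _) (≤-reflexive (lemma₂ s (4 * c) (loss s 0 s) (2 * loss (s ∸ 1) 0 s)))
      enough : ∀ x → n ≤ x + x + s → 2 ^ r * τ + c < x * suc r
      enough x n≤ = slack-twins {2 ^ r} {suc s} {suc r} n x s τ δ c P<2r hyp n≤ fits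
      cover : n ≤ cls R + cls B + s
      cover = classes-cover tc u≢v third
      by-class : cls R ≤ cls B ⊎ cls B ≤ cls R → Config col s (suc τ)
      by-class (inj₁ R≤B) = twins-config tc u≢v third r B R dense-swapped
        (enough (cls B) (≤-trans cover (+-monoˡ-≤ s (+-monoˡ-≤ (cls B) R≤B))))
      by-class (inj₂ B≤R) = twins-config tc u≢v third r R B dense
        (enough (cls R) (≤-trans cover (+-monoˡ-≤ s (+-monoʳ-≤ (cls R) B≤R))))

    whole-case : ∀ s {t δ} (tc : TwoColoured col symm rf s) → 2 ≤ s → 2 ^ s * t ≤ suc s * n + δ → δ + gap s < t → t ≤ n →
      ((col₂ : Colours n 2) → Symm col₂ → Config col₂ s t) → Config col s t
    whole-case s {t} tc 2≤s hyp big t≤n config₂ =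
      by-third (any? λ u → any? λ v → ¬? (u ≟ v) ×-dec ¬? (two? r b (col u v)))
      where
      open TwoColoured tc
      by-third : Dec (∃ λ u → ∃ λ v → u ≢ v × ¬ Two r b (col u v)) → Config col s t
      by-third (yes (u , v , u≢v , third)) = twins-case s tc 2≤s hyp big t≤n u v u≢v third
      by-third (no none) = two-colours-config col symm r b
        (λ u v u≢v → decidable-stable (two? r b (col u v)) λ third → none (u , v , u≢v , third)) config₂

  -- The first inequality says that `n` is below 2 ^ s t / (s + 1) by at most δ / (s + 1), the
  -- second that δ and all constants are small compared with `t`. The assumption on two-colourings
  -- is called upon only if the core is everything and no third colour occurs.
  gallai-config : ∀ {n k} (col : Colours n k) → Symm col → RainbowFree col → ∀ s {t δ} → 2 ≤ s → 2 ^ s * t ≤ suc s * n + δ → (3 + s) * (δ + gap s) < t →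
    ((col₂ : Colours n 2) → Symm col₂ → Config col₂ s t) → Config col s t
  gallai-config {n} col symm rf s@(suc s′@(suc s″)) {suc τ} {δ} 2≤s hyp big config₂ =
    in-core (core col s (≤-trans s≤t t≤n))
    where
    open ≤-Reasoning
    D = δ + gap s
    t = suc τ
    D<t : D < t
    D<t = ≤-<-trans (m≤m+n D _) big
    s≤t : s ≤ t
    s≤t = ≤-trans (≤-trans (≤-trans (m≤m*n s (s + 2)) (≤-reflexive (*-comm s (s + 2)))) inner) (<⇒≤ D<t)
      where
      inner : (s + 2) * s ≤ D
      inner = m≤n⇒m≤o+n δ (m≤n⇒m≤n+o 49 (m≤n⇒m≤o+n (loss s 0 s + 2 * loss s′ 0 s + 4 * loss s″ 2 s) ≤-refl))
    P<Q : suc s < 2 ^ s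
    P<Q = 2+s≤2^s s 2≤s
    t≤n : t ≤ n
    t≤n = *-cancelˡ-≤ (suc s) (+-cancelʳ-≤ t _ _ (begin
      suc s * t + t ≡⟨ +-comm (suc s * t) t ⟩
      suc (suc s) * t ≤⟨ *-monoˡ-≤ t P<Q ⟩
      2 ^ s * t ≤⟨ hyp ⟩
      suc s * n + δ ≤⟨ +-monoʳ-≤ (suc s * n) (≤-trans (m≤m+n δ (gap s)) (<⇒≤ D<t)) ⟩
      suc s * n + t ∎))
    in-core : ∃ (Core col s) → Config col s t
    in-core (N , C) = by-size (n ∸ N) refl
      where
      open Core C
      N≤n : N ≤ n
      N≤n = injective⇒≤ injective
      symm′ : Symm (restrict col ι)
      symm′ x y = symm (ι x) (ι y)
      rf′ = restrict-rainbowFree injective rf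
      tc : TwoColoured (restrict col ι) symm′ rf′ s
      tc = two-coloured (restrict col ι) symm′ rf′ (≤-trans 2≤s large) small
      by-size : ∀ g → n ∸ N ≡ g → Config col s t
      by-size zero g≡ = config-map col ι injective
        (subst-whole (≤-antisym N≤n (m∸n≡0⇒m≤n g≡)))
        where
        subst-whole : N ≡ n → Config (restrict col ι) s t
        subst-whole refl = whole-case (restrict col ι) symm′ rf′ s tc 2≤s hyp D<t t≤n config₂
      by-size g@(suc _) g≡ = by-inside (suc (δ + loss s 0 s) ≤? g) (t ≤? g)
        where
        n≡ : n ≡ N + g
        n≡ = trans (sym (m+[n∸m]≡n N≤n)) (cong (N +_) g≡)
        hyp′ : 2 ^ s * t ≤ suc s * (N + g) + δ
        hyp′ = subst (λ n → 2 ^ s * t ≤ suc s * n + δ) n≡ hyp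
        few-outside : g ≤ δ + loss s 0 s → Config col s t
        few-outside g≤ = case-outside-nonempty col C symm rf tc z z-outside
          (slack-outside {2 ^ s′} {suc s} {s} N g τ δ (loss s′ 0 s) P<2s hyp′ N-large)
          where
          someOutside : Σ (Fin 1 → Fin n) λ f → Injective _≡_ _≡_ f × (∀ j → does (outside? col C (f j)) ≡ true)
          someOutside = ≤count⇒injection (λ w → does (outside? col C w))
            (≤-trans (s≤s z≤n) (≤-trans (≤-reflexive (sym g≡)) (n∸N≤outside col C)))
          z = proj₁ someOutside zero
          z-outside : ∀ i → z ≢ ι i
          z-outside = does⇒ (outside? col C z) (proj₂ (proj₂ someOutside) zero)
          P<2s : suc s < 2 * s
          P<2s = ≤-trans (m≤m+n (4 + s″) s″) (≤-reflexive (lemma s″))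
            where
            lemma : ∀ s → 4 + s + s ≡ 2 * (2 + s)
            lemma = solve-∀
          c₁ = loss s 0 s
          c₂ = loss s′ 0 s
          rest = 4 * loss s″ 2 s + (s + 2) * s + 48
          -- At most δ + `c₁` vertices are outside, and they enter s + 2 times; together with the
          -- remaining terms this explains the factor 3 + s in `big`.
          N-large : suc s * g + δ + 2 * c₂ < N
          N-large = +-cancelʳ-< g _ _ (begin-strict
            suc s * g + δ + 2 * c₂ + g
              ≡⟨ lemma₁ s g δ (2 * c₂) ⟩
            (2 + s) * g + (δ + 2 * c₂)
              ≤⟨ +-monoˡ-≤ (δ + 2 * c₂) (*-monoʳ-≤ (2 + s) g≤) ⟩
            (2 + s) * (δ + c₁) + (δ + 2 * c₂)
              ≤⟨ m≤m+n _ ((2 + s) * (2 * c₂ + rest + 1) + (c₁ + rest + 1)) ⟩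
            (2 + s) * (δ + c₁) + (δ + 2 * c₂) + ((2 + s) * (2 * c₂ + rest + 1) + (c₁ + rest + 1))
              ≡⟨ lemma₂ s δ c₁ (2 * c₂) (4 * loss s″ 2 s) ((s + 2) * s) ⟩
            (3 + s) * D
              <⟨ big ⟩
            t ≤⟨ t≤n ⟩
            n ≡⟨ n≡ ⟩
            N + g ∎)
            where
            lemma₁ : ∀ s g δ c → suc s * g + δ + c + g ≡ (2 + s) * g + (δ + c)
            lemma₁ = solve-∀
            lemma₂ : ∀ s δ c₁ c₂ a e →
              (2 + s) * (δ + c₁) + (δ + c₂) + ((2 + s) * (c₂ + (a + e + 48) + 1) + (c₁ + (a + e + 48) + 1))
              ≡ (3 + s) * (δ + (c₁ + c₂ + a + e + 49))
            lemma₂ = solve-∀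
        many-outside : δ + loss s 0 s < g → g < t → Config col s t
        many-outside δ+c<g g<t = case-inside col C symm rf {t} {t ∸ suc g} tc
          (slack-inside {2 ^ s} {suc s} N g (t ∸ suc g) δ (loss s 0 s) P<Q
            (subst (λ t → 2 ^ s * t ≤ suc s * (N + g) + δ) (sym t≡) hyp′) δ+c<g)
          (≤-reflexive (trans (sym t≡) (cong (suc (t ∸ suc g) +_) (sym g≡))))
          where
          t≡ : suc (t ∸ suc g) + g ≡ t
          t≡ = trans (sym (+-suc (t ∸ suc g) g)) (m∸n+n≡m g<t)
        by-inside : Dec (δ + loss s 0 s < g) → Dec (t ≤ g) → Config col s t
        by-inside _ (yes t≤g) = case-outside-large col C (subst (t ≤_) (sym g≡) t≤g)
        by-inside (yes δ+c<g) (no t≰g) = many-outside δ+c<g (≰⇒> t≰g)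
        by-inside (no δ+c≮g) (no _) = few-outside (≮⇒≥ δ+c≮g)
  gallai-config col symm rf (suc zero) (s≤s ()) hyp big config₂
  gallai-config col symm rf s {zero} 2≤s hyp () config₂

-- Comparison of powers, and integer logarithms and square roots.

module Growth where
  open import Data.Nat.Properties using (suc-injective)
  open ≤-Reasoning

  bernoulli : ∀ K j → (K + j) * K ^ j ≤ K * suc K ^ j
  bernoulli K zero = ≤-reflexive (cong (_* 1) (+-identityʳ K))
  bernoulli K (suc j) = begin
    (K + suc j) * (K * K ^ j) ≤⟨ m≤m+n _ (j * K ^ j) ⟩
    (K + suc j) * (K * K ^ j) + j * K ^ j
                                        ≡⟨ lemma K j (K ^ j) ⟩
    suc K * ((K + j) * K ^ j) ≤⟨ *-monoʳ-≤ (suc K) (bernoulli K j) ⟩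
    suc K * (K * suc K ^ j) ≡⟨ lemma′ K (suc K) (suc K ^ j) ⟩
    K * (suc K * suc K ^ j) ∎
    where
    lemma : ∀ K j p → (K + suc j) * (K * p) + j * p ≡ suc K * ((K + j) * p)
    lemma = solve-∀
    lemma′ : ∀ K x p → x * (K * p) ≡ K * (x * p)
    lemma′ = solve-∀

  -- Bernoulli's inequality for the reciprocal: (1 - 1 / (K + 1)) ^ i ≥ 1 - i / (K + 1). The
  -- variable `z` replaces the difference of `suc K` and `i`.
  bernoulli-upper : ∀ K i z → z + i ≡ suc K → z * suc K ^ i ≤ suc K * K ^ i
  bernoulli-upper K zero z eq = ≤-reflexive (cong (_* 1) (trans (sym (+-identityʳ z)) eq))
  bernoulli-upper K (suc i) z eq = begin
    z * (suc K * suc K ^ i) ≡⟨ *-assoc z (suc K) (suc K ^ i) ⟨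
    z * suc K * suc K ^ i ≤⟨ *-monoˡ-≤ (suc K ^ i) factor ⟩
    K * suc z * suc K ^ i ≡⟨ *-assoc K (suc z) (suc K ^ i) ⟩
    K * (suc z * suc K ^ i) ≤⟨ *-monoʳ-≤ K (bernoulli-upper K i (suc z) (trans (sym (+-suc z i)) eq)) ⟩
    K * (suc K * K ^ i) ≡⟨ lemma K (suc K) (K ^ i) ⟩
    suc K * (K * K ^ i) ∎
    where
    lemma : ∀ K x p → K * (x * p) ≡ x * (K * p)
    lemma = solve-∀
    z≤K : z ≤ K
    z≤K = ≤-trans (m≤m+n z i) (≤-reflexive (suc-injective (trans (sym (+-suc z i)) eq)))
    factor : z * suc K ≤ K * suc z
    factor = begin
      z * suc K ≡⟨ *-suc z K ⟩
      z + z * K ≤⟨ +-mono-≤ z≤K (≤-reflexive (*-comm z K)) ⟩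
      K + K * z ≡⟨ *-suc K z ⟨
      K * suc z ∎

  ^-distribʳ-* : ∀ m a b → (a * b) ^ m ≡ a ^ m * b ^ m
  ^-distribʳ-* zero a b = refl
  ^-distribʳ-* (suc m) a b = trans (cong (a * b *_) (^-distribʳ-* m a b)) (lemma a b (a ^ m) (b ^ m))
    where
    lemma : ∀ a b x y → a * b * (x * y) ≡ a * x * (b * y)
    lemma = solve-∀

  ^-mono-ratio : ∀ {a b x y} m → a * x ≤ b * y → a ^ m * x ^ m ≤ b ^ m * y ^ m
  ^-mono-ratio {a} {b} {x} {y} m ax≤by = begin
    a ^ m * x ^ m ≡⟨ ^-distribʳ-* m a x ⟨
    (a * x) ^ m ≤⟨ ^-monoˡ-≤ m ax≤by ⟩
    (b * y) ^ m ≡⟨ ^-distribʳ-* m b y ⟩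
    b ^ m * y ^ m ∎

  module _ (Q P k : ℕ) .{{_ : NonZero Q}} .{{_ : NonZero k}} where
    private
      -- Chosen so that K P / (Q k) = P (k + 1) and K / (k + 1) = Q k are integers, the exponents in
      -- `growth-P` and `growth-Q`.
      K = Q * k * suc k
      instance
        K≢0 : NonZero K
        K≢0 = m*n≢0 (Q * k) (suc k) {{m*n≢0 Q k}}
        Qk≢0 : NonZero (Q * k)
        Qk≢0 = m*n≢0 Q k

    -- The `m`-th power of 1 + P / (Q k) ≤ (1 + 1 / K) ^ (P (k + 1)), which is `bernoulli`.
    growth-P : ∀ m → (Q * k + P) ^ m * K ^ (P * suc k * m) ≤ (Q * k) ^ m * suc K ^ (P * suc k * m)
    growth-P m = subst₂ (λ x y → (Q * k + P) ^ m * x ≤ (Q * k) ^ m * y)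
      (^-*-assoc K (P * suc k) m) (^-*-assoc (suc K) (P * suc k) m)
      (^-mono-ratio m (*-cancelˡ-≤ (suc k) (begin
        suc k * ((Q * k + P) * K ^ (P * suc k)) ≡⟨ lemma (suc k) (Q * k) P (K ^ (P * suc k)) ⟩
        (K + P * suc k) * K ^ (P * suc k) ≤⟨ bernoulli K (P * suc k) ⟩
        K * suc K ^ (P * suc k) ≡⟨ lemma′ (suc k) (Q * k) (suc K ^ (P * suc k)) ⟩
        suc k * (Q * k * suc K ^ (P * suc k)) ∎)))
      where
      lemma : ∀ k a P x → k * ((a + P) * x) ≡ (a * k + P * k) * x
      lemma = solve-∀
      lemma′ : ∀ k a x → a * k * x ≡ k * (a * x)
      lemma′ = solve-∀

    -- The `t`-th power of (1 + 1 / K) ^ (Q k) ≤ 1 + 1 / k. By `bernoulli-upper` the left side is at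
    -- most (K + 1) / (Q k² + 1), and this is at most (k + 1) / k.
    growth-Q : ∀ t → k ^ t * suc K ^ (Q * k * t) ≤ suc k ^ t * K ^ (Q * k * t)
    growth-Q t = subst₂ (λ x y → k ^ t * x ≤ suc k ^ t * y)
      (^-*-assoc (suc K) (Q * k) t) (^-*-assoc K (Q * k) t)
      (^-mono-ratio t (*-cancelˡ-≤ (suc K) (begin
        suc K * (k * suc K ^ (Q * k)) ≤⟨ m≤m+n _ (suc K ^ (Q * k)) ⟩
        suc K * (k * suc K ^ (Q * k)) + suc K ^ (Q * k)
                                                  ≡⟨ lemma k (Q * k) (suc K ^ (Q * k)) ⟩
        suc k * (suc (Q * k * k) * suc K ^ (Q * k))
                                                  ≤⟨ *-monoʳ-≤ (suc k) (bernoulli-upper K (Q * k) (suc (Q * k * k)) (lemma′ (Q * k) k)) ⟩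
        suc k * (suc K * K ^ (Q * k)) ≡⟨ lemma″ (suc k) (suc K) (K ^ (Q * k)) ⟩
        suc K * (suc k * K ^ (Q * k)) ∎)))
      where
      lemma : ∀ k a x → suc (a * suc k) * (k * x) + x ≡ suc k * (suc (a * k) * x)
      lemma = solve-∀
      lemma′ : ∀ a k → suc (a * k) + a ≡ suc (a * suc k)
      lemma′ = solve-∀
      lemma″ : ∀ k K x → k * (K * x) ≡ K * (k * x)
      lemma″ = solve-∀

    doubling : ∀ y W → K * y ≤ W → 2 ^ y * K ^ W ≤ suc K ^ W
    doubling y W Ky≤W with m≤n⇒∃[o]m+o≡n Ky≤W
    ... | o , refl = begin
      2 ^ y * K ^ (K * y + o) ≡⟨ cong (2 ^ y *_) (^-distribˡ-+-* K (K * y) o) ⟩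
      2 ^ y * (K ^ (K * y) * K ^ o) ≡⟨ *-assoc (2 ^ y) (K ^ (K * y)) (K ^ o) ⟨
      2 ^ y * K ^ (K * y) * K ^ o ≤⟨ *-mono-≤ powers (^-monoˡ-≤ o (n≤1+n K)) ⟩
      suc K ^ (K * y) * suc K ^ o ≡⟨ ^-distribˡ-+-* (suc K) (K * y) o ⟨
      suc K ^ (K * y + o) ∎
      where
      powers : 2 ^ y * K ^ (K * y) ≤ suc K ^ (K * y)
      powers = subst₂ (λ x z → 2 ^ y * x ≤ z) (^-*-assoc K K y)
        (trans (cong (_* (suc K ^ K) ^ y) (^-zeroˡ y)) (trans (*-identityˡ _) (^-*-assoc (suc K) K y)))
        (^-mono-ratio {2} {1} y (*-cancelˡ-≤ K (begin
          K * (2 * K ^ K) ≡⟨ lemma K (K ^ K) ⟩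
          (K + K) * K ^ K ≤⟨ bernoulli K K ⟩
          K * suc K ^ K ≡⟨ cong (K *_) (*-identityˡ _) ⟨
          K * (1 * suc K ^ K) ∎)))
        where
        lemma : ∀ K x → K * (2 * x) ≡ (K + K) * x
        lemma = solve-∀

    -- All powers are compared with those of 1 + 1 / K, where both 1 + P / (Q k) and
    -- 1 + 1 / k are nearly integral powers of 1 + 1 / K.
    union-bound : ∀ {M} m t y → M < 2 ^ y → P * suc k * m + K * y ≤ Q * k * t →
      k ^ t * (M * (Q * k + P) ^ m) < (Q * k) ^ m * suc k ^ t
    union-bound {M} m t y M< surplus with m≤n⇒∃[o]m+o≡n (≤-trans (m≤m+n (P * suc k * m) (K * y)) surplus)
    ... | W , eq = *-cancelʳ-< (K ^ (Q * k * t)) _ _ (begin-strict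
      k ^ t * (M * (Q * k + P) ^ m) * K ^ (Q * k * t)
        ≡⟨ cong (λ e → k ^ t * (M * (Q * k + P) ^ m) * K ^ e) (sym eq) ⟩
      k ^ t * (M * (Q * k + P) ^ m) * K ^ (e₁ + W)
        ≡⟨ cong (k ^ t * (M * (Q * k + P) ^ m) *_) (^-distribˡ-+-* K e₁ W) ⟩
      k ^ t * (M * (Q * k + P) ^ m) * (K ^ e₁ * K ^ W)
        ≡⟨ lemma₁ (k ^ t) M ((Q * k + P) ^ m) (K ^ e₁) (K ^ W) ⟩
      M * (k ^ t * K ^ W) * ((Q * k + P) ^ m * K ^ e₁)
        ≤⟨ *-monoʳ-≤ (M * (k ^ t * K ^ W)) (growth-P m) ⟩
      M * (k ^ t * K ^ W) * ((Q * k) ^ m * suc K ^ e₁)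
        ≡⟨ *-assoc M (k ^ t * K ^ W) ((Q * k) ^ m * suc K ^ e₁) ⟩
      M * (k ^ t * K ^ W * ((Q * k) ^ m * suc K ^ e₁))
        <⟨ *-monoˡ-< (k ^ t * K ^ W * ((Q * k) ^ m * suc K ^ e₁)) {{positive}} M< ⟩
      2 ^ y * (k ^ t * K ^ W * ((Q * k) ^ m * suc K ^ e₁))
        ≡⟨ lemma₂ (2 ^ y) (k ^ t) (K ^ W) ((Q * k) ^ m) (suc K ^ e₁) ⟩
      (Q * k) ^ m * (k ^ t * (suc K ^ e₁ * (2 ^ y * K ^ W)))
        ≤⟨ *-monoʳ-≤ ((Q * k) ^ m) (*-monoʳ-≤ (k ^ t) (*-monoʳ-≤ (suc K ^ e₁) (doubling y W Ky≤W))) ⟩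
      (Q * k) ^ m * (k ^ t * (suc K ^ e₁ * suc K ^ W))
        ≡⟨ cong (λ x → (Q * k) ^ m * (k ^ t * x)) (trans (sym (^-distribˡ-+-* (suc K) e₁ W)) (cong (suc K ^_) eq)) ⟩
      (Q * k) ^ m * (k ^ t * suc K ^ (Q * k * t))
        ≤⟨ *-monoʳ-≤ ((Q * k) ^ m) (growth-Q t) ⟩
      (Q * k) ^ m * (suc k ^ t * K ^ (Q * k * t))
        ≡⟨ *-assoc ((Q * k) ^ m) (suc k ^ t) (K ^ (Q * k * t)) ⟨
      (Q * k) ^ m * suc k ^ t * K ^ (Q * k * t) ∎)
      where
      e₁ = P * suc k * m
      Ky≤W : K * y ≤ W
      Ky≤W = +-cancelˡ-≤ e₁ _ _ (≤-trans surplus (≤-reflexive (sym eq)))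
      positive : NonZero (k ^ t * K ^ W * ((Q * k) ^ m * suc K ^ e₁))
      positive = m*n≢0 _ _ {{m*n≢0 _ _ {{m^n≢0 k t}} {{m^n≢0 K W}}}} {{m*n≢0 _ _ {{m^n≢0 (Q * k) m}} {{m^n≢0 (suc K) e₁}}}}
      lemma₁ : ∀ a M b c d → a * (M * b) * (c * d) ≡ M * (a * d) * (b * c)
      lemma₁ = solve-∀
      lemma₂ : ∀ y a b c d → y * (a * b * (c * d)) ≡ c * (a * (d * (y * b)))
      lemma₂ = solve-∀

  last-true : ∀ {P : ℕ → Set} → (∀ i → Dec (P i)) → P 0 → ∀ N → ¬ P N → ∃ λ i → P i × ¬ P (suc i)
  last-true P? p0 zero ¬pN = contradiction p0 ¬pN
  last-true P? p0 (suc N) ¬pN with P? N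
  ... | yes pN = N , pN , ¬pN
  ... | no ¬p = last-true P? p0 N ¬p

  n<2^n : ∀ n → n < 2 ^ n
  n<2^n zero = ≤-refl
  n<2^n (suc n) = begin-strict
    suc n ≤⟨ n<2^n n ⟩
    2 ^ n <⟨ m<m+n (2 ^ n) (m^n>0 2 n) ⟩
    2 ^ n + 2 ^ n ≡⟨ cong (2 ^ n +_) (+-identityʳ (2 ^ n)) ⟨
    2 ^ suc n ∎

  log₂ : ∀ t → 0 < t → ∃ λ L → 2 ^ L ≤ t × t < 2 ^ suc L
  log₂ t 0<t with last-true (λ i → 2 ^ i ≤? t) 0<t t (<⇒≱ (n<2^n t))
  ... | L , ≤t , ≰t = L , ≤t , ≰⇒> ≰t

  scaled-sqrt : ∀ L t → 0 < L → ∃ λ k → k * k * L ≤ t × t < suc k * suc k * L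
  scaled-sqrt L t 0<L with last-true (λ i → i * i * L ≤? t) z≤n (suc t)
    (<⇒≱ (<-≤-trans (≤-refl {suc t}) (≤-trans (m≤m*n (suc t) (suc t)) (m≤m*n (suc t * suc t) L {{>-nonZero 0<L}}))))
  ... | k , ≤t , ≰t = k , ≤t , ≰⇒> ≰t

  linear<exponential : ∀ x L → 2 * x < L → x * L < 2 ^ L
  linear<exponential x L 2x<L with m≤n⇒∃[o]m+o≡n 2x<L
  ... | o , refl = begin-strict
    x * suc (2 * x + o) <⟨ *-monoˡ-< (suc (2 * x + o)) (n<2^n x) ⟩
    2 ^ x * suc (2 * x + o) ≤⟨ *-monoʳ-≤ (2 ^ x) small ⟩
    2 ^ x * 2 ^ suc (x + o) ≡⟨ ^-distribˡ-+-* 2 x (suc (x + o)) ⟨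
    2 ^ (x + suc (x + o)) ≡⟨ cong (2 ^_) (lemma x o) ⟩
    2 ^ suc (2 * x + o) ∎
    where
    lemma : ∀ x o → x + suc (x + o) ≡ suc (2 * x + o)
    lemma = solve-∀
    lemma′ : ∀ x o → suc (2 * x + o) + suc o ≡ 2 * suc (x + o)
    lemma′ = solve-∀
    small : suc (2 * x + o) ≤ 2 * 2 ^ (x + o)
    small = begin
      suc (2 * x + o) ≤⟨ m≤m+n _ (suc o) ⟩
      suc (2 * x + o) + suc o ≡⟨ lemma′ x o ⟩
      2 * suc (x + o) ≤⟨ *-monoʳ-≤ 2 (n<2^n (x + o)) ⟩
      2 * 2 ^ (x + o) ∎

-- The number of vertices and the weight of a hit in the random colouring.

module ParameterChoice where
  open Growth

  open ≤-Reasoning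

  -- The number of vertices is m = (2 ^ s t) / (s + 1) - C₁ k L, where L is close to
  -- log t and k to √ (t / L).
  C₁ : ℕ → ℕ
  C₁ s = 2 ^ s * (4 + 2 * (s * s + 3 * s + 1))

  -- `sparse` is the hypothesis of `random-colouring`. As the Ramsey number will exceed `m`, the
  -- fields `m-large` and `loss<t` give those of `gallai-config` with `G` as the gap and δ =
  -- `suc s * C₁ s * (k * L)`. The first two inequalities are for `√-≥`.
  record Parameters (s G t : ℕ) : Set where
    field
      L k m : ℕ
      2^L≤t : 2 ^ L ≤ t
      k²L≤t : k * L * (k * L) ≤ t * L
      sparse : k ^ t * (m ^ s * (2 ^ s * (2 ^ s * k + suc s) ^ m)) < (2 ^ s * k) ^ m * suc k ^ t
      m-large : 2 ^ s * t ≤ suc s * suc m + suc s * C₁ s * (k * L)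
      loss<t : (3 + s) * (suc s * C₁ s * (k * L) + G) < t

  square-cancel-< : ∀ {a b} → a * a < b * b → a < b
  square-cancel-< {a} {b} a²<b² = ≰⇒> λ b≤a → <⇒≱ a²<b² (*-mono-≤ b≤a b≤a)

  -- Forces 2 X² < L, hence X² L < 2 ^ L ≤ t and (X k L)² ≤ X² t L < t², from which `loss<t`
  -- follows.
  threshold : ℕ → ℕ → ℕ
  threshold s G = 2 ^ suc (2 * (X * X))
    where X = (3 + s) * (suc s * C₁ s + G)

  parameters : ∀ s G t → threshold s G ≤ t → Parameters s G t
  parameters s G t t₀≤t = with-L (log₂ t (≤-trans (m^n>0 2 (suc (2 * (X * X)))) t₀≤t))
    where
    X = (3 + s) * (suc s * C₁ s + G)
    P = suc s
    Q = 2 ^ s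
    c = s * s + 3 * s + 1
    instance
      Q≢0 : NonZero Q
      Q≢0 = m^n≢0 2 s
    with-L : (∃ λ L → 2 ^ L ≤ t × t < 2 ^ suc L) → Parameters s G t
    with-L (L , 2^L≤t , t<) = with-k (scaled-sqrt L t 0<L)
      where
      2X²<L : 2 * (X * X) < L
      2X²<L = ≰⇒> λ L≤ → <⇒≱ t< (≤-trans (^-monoʳ-≤ 2 (s≤s L≤)) t₀≤t)
      0<L : 0 < L
      0<L = ≤-trans (s≤s z≤n) 2X²<L
      with-k : (∃ λ k → k * k * L ≤ t × t < suc k * suc k * L) → Parameters s G t
      with-k (zero , _ , t<L) = contradiction (≤-trans (≤-trans (<⇒≤ (n<2^n L)) 2^L≤t) ≤-refl)
        (<⇒≱ (<-≤-trans t<L (≤-reflexive (+-identityʳ L))))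
      with-k (k@(suc k-1) , k²L≤t , t<k²L) = with-m (last-true (λ m → P * m + E ≤? Q * t) E≤Qt (suc (Q * t))
          (<⇒≱ (≤-trans (m≤n*m (suc (Q * t)) P) (m≤m+n _ E))))
        where
        E = P * C₁ s * (k * L)
        kL²≤ : k * L * (k * L) ≤ t * L
        kL²≤ = begin
          k * L * (k * L) ≡⟨ lemma k L ⟩
          k * k * L * L ≤⟨ *-monoˡ-≤ L k²L≤t ⟩
          t * L ∎
          where
          lemma : ∀ k L → k * L * (k * L) ≡ k * k * L * L
          lemma = solve-∀
        XkL<t : X * (k * L) < t
        XkL<t = square-cancel-< (begin-strict
          X * (k * L) * (X * (k * L)) ≡⟨ lemma X (k * L) ⟩
          X * X * (k * L * (k * L)) ≤⟨ *-monoʳ-≤ (X * X) kL²≤ ⟩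
          X * X * (t * L) ≡⟨ lemma′ (X * X) t L ⟩
          t * (X * X * L) <⟨ *-monoʳ-< t {{>-nonZero (≤-trans (m^n>0 2 L) 2^L≤t)}} (<-≤-trans (linear<exponential (X * X) L 2X²<L) 2^L≤t) ⟩
          t * t ∎)
          where
          lemma : ∀ X y → X * y * (X * y) ≡ X * X * (y * y)
          lemma = solve-∀
          lemma′ : ∀ x t L → x * (t * L) ≡ t * (x * L)
          lemma′ = solve-∀
        loss<t : (3 + s) * (E + G) < t
        loss<t = ≤-<-trans (begin
          (3 + s) * (E + G) ≤⟨ *-monoʳ-≤ (3 + s) (+-monoʳ-≤ E (m≤m*n G (k * L) {{>-nonZero (*-mono-≤ {1} {k} (s≤s z≤n) 0<L)}})) ⟩
          (3 + s) * (E + G * (k * L)) ≡⟨ lemma (3 + s) (P * C₁ s) G (k * L) ⟩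
          X * (k * L) ∎) XkL<t
          where
          lemma : ∀ a c G y → a * (c * y + G * y) ≡ a * (c + G) * y
          lemma = solve-∀
        E≤Qt : P * 0 + E ≤ Q * t
        E≤Qt = begin
          P * 0 + E ≡⟨ cong (_+ E) (*-zeroʳ P) ⟩
          E ≤⟨ ≤-trans (m≤m+n E G) (m≤n*m (E + G) (3 + s)) ⟩
          (3 + s) * (E + G) ≤⟨ <⇒≤ loss<t ⟩
          t ≤⟨ m≤n*m t Q ⟩
          Q * t ∎
        -- As m ≤ 2 ^ (s + L + 1), there are fewer than 2 ^ y pairs of a tuple and a colour vector.
        y = suc ((s + suc L) * s + s)
        y≤cL : y ≤ c * L
        y≤cL = positive L 0<L
          where
          lemma : ∀ s l → suc ((s + suc (suc l)) * s + s) + (s * s + 2 * s + 1) * l ≡ (s * s + 3 * s + 1) * suc l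
          lemma = solve-∀
          positive : ∀ L → 0 < L → suc ((s + suc L) * s + s) ≤ c * L
          positive (suc L-1) _ = ≤-trans (m≤m+n _ ((s * s + 2 * s + 1) * L-1)) (≤-reflexive (lemma s L-1))
        -- Source of `C₁`: with k + 1 ≤ 2 k and t < (2 k)² L, the union bound costs at most 2 c Q k²
        -- L and the term `Q * t` at most 4 Q k² L.
        budget : Q * k * suc k * y + Q * t ≤ k * E
        budget = begin
          Q * k * suc k * y + Q * t
            ≤⟨ +-mono-≤ (*-mono-≤ (*-monoʳ-≤ (Q * k) 1+k≤) y≤cL)
                 (*-monoʳ-≤ Q (≤-trans (<⇒≤ t<k²L) (*-monoˡ-≤ L (*-mono-≤ 1+k≤ 1+k≤)))) ⟩
          Q * k * (k + k) * (c * L) + Q * ((k + k) * (k + k) * L)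
            ≡⟨ lemma Q k c L ⟩
          k * (Q * (4 + 2 * c) * (k * L))
            ≤⟨ *-monoʳ-≤ k (*-monoˡ-≤ (k * L) (m≤n*m (C₁ s) P)) ⟩
          k * E ∎
          where
          1+k≤ : suc k ≤ k + k
          1+k≤ = +-monoˡ-≤ k (s≤s (z≤n {k-1}))
          lemma : ∀ Q k c L → Q * k * (k + k) * (c * L) + Q * ((k + k) * (k + k) * L) ≡ k * (Q * (4 + 2 * c) * (k * L))
          lemma = solve-∀
        with-m : (∃ λ m → P * m + E ≤ Q * t × ¬ (P * suc m + E ≤ Q * t)) → Parameters s G t
        with-m (m , low , ¬high) = record
          { L = L ; k = k ; m = m ; 2^L≤t = 2^L≤t ; k²L≤t = kL²≤
          ; sparse = subst (_< (Q * k) ^ m * suc k ^ t)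
              (cong (k ^ t *_) (*-assoc (m ^ s) Q ((Q * k + P) ^ m)))
              (union-bound Q P k m t y tuples surplus)
          ; m-large = <⇒≤ (≰⇒> ¬high) ; loss<t = loss<t }
          where
          -- The choice of `m` gives P m + E ≤ Q t. Taken `k` times it lacks one more P m, which is
          -- at most Q t and is covered by `k * E`, just like the union bound.
          surplus : P * suc k * m + Q * k * suc k * y ≤ Q * k * t
          surplus = +-cancelʳ-≤ (Q * t) _ _ (begin
            P * suc k * m + Q * k * suc k * y + Q * t ≡⟨ +-assoc (P * suc k * m) (Q * k * suc k * y) (Q * t) ⟩
            P * suc k * m + (Q * k * suc k * y + Q * t) ≤⟨ +-monoʳ-≤ (P * suc k * m) budget ⟩
            P * suc k * m + k * E ≡⟨ lemma P k m E ⟩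
            k * (P * m + E) + P * m ≤⟨ +-mono-≤ (*-monoʳ-≤ k low) (≤-trans (m≤m+n (P * m) E) low) ⟩
            k * (Q * t) + Q * t ≡⟨ cong (_+ Q * t) (lemma′ k Q t) ⟩
            Q * k * t + Q * t ∎)
            where
            lemma : ∀ P k m E → P * suc k * m + k * E ≡ k * (P * m + E) + P * m
            lemma = solve-∀
            lemma′ : ∀ k Q t → k * (Q * t) ≡ Q * k * t
            lemma′ = solve-∀
          m≤ : m ≤ 2 ^ (s + suc L)
          m≤ = begin
            m ≤⟨ m≤n*m m P ⟩
            P * m ≤⟨ ≤-trans (m≤m+n (P * m) E) low ⟩
            Q * t ≤⟨ *-monoʳ-≤ Q (<⇒≤ t<) ⟩
            Q * 2 ^ suc L ≡⟨ ^-distribˡ-+-* 2 s (suc L) ⟨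
            2 ^ (s + suc L) ∎
          tuples : m ^ s * Q < 2 ^ y
          tuples = begin-strict
            m ^ s * Q ≤⟨ *-monoˡ-≤ Q (^-monoˡ-≤ s m≤) ⟩
            (2 ^ (s + suc L)) ^ s * Q ≡⟨ cong (_* Q) (^-*-assoc 2 (s + suc L) s) ⟩
            2 ^ ((s + suc L) * s) * Q ≡⟨ ^-distribˡ-+-* 2 ((s + suc L) * s) s ⟨
            2 ^ ((s + suc L) * s + s) <⟨ ^-monoʳ-< 2 ≤-refl (n<1+n ((s + suc L) * s + s)) ⟩
            2 ^ y ∎

-- Construction of the minima and their equality.

module RamseyNumbers where
  open import Defs
  open FiniteSums
  open Averaging
  open Configurations
  open RandomColouring using (random-colouring)
  open GallaiCut
  open SmallModules
  open Cases using (config-map)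
  open GallaiConfiguration
  open Growth using (last-true)
  open ParameterChoice

  open import Data.Fin using (inject≤)
  open import Data.Fin.Properties using (_≟_; all?; any?; injective⇒≤; inject≤-injective)
  open import Data.Vec.Properties using (lookup∘tabulate; map-cong)

  config-cong : ∀ {n k s t} {col col′ : Colours n k} → (∀ u v → col u v ≡ col′ u v) → Config col s t → Config col′ s t
  config-cong eq cfg = record
    { a = a ; c = c ; b = b ; a-distinct = a-distinct ; b-injective = b-injective
    ; hit = λ j → proj₁ (hit j) , subst (Allowed c) (map-cong (eq (b j)) a) (proj₂ (hit j)) }
    where open Config cfg

  colouring : ∀ {n k} (col : Colours n k) → Symm col → EdgeColouring (K n) (Fin k)
  colouring col symm = record { colour = λ {u} {v} _ → col u v ; colour-sym = λ {u} {v} _ _ → symm u v }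

  module _ {n k} (χ : EdgeColouring (K n) (Fin k)) (d : Fin k) where
    open EdgeColouring χ

    -- Loops receive the colour d.
    table : Colours n k
    table u v with u ≟ v
    ... | yes _ = d
    ... | no e = colour e

    table-agrees : Agrees χ table
    table-agrees {u} {v} e with u ≟ v
    ... | yes u≡v = contradiction u≡v e
    ... | no e′ = trans (colour-sym e (≢-sym e)) (colour-sym (≢-sym e) e′)

    table-symm : Symm table
    table-symm u v with u ≟ v | v ≟ u
    ... | yes _ | yes _ = refl
    ... | yes u≡v | no v≢u = contradiction (sym u≡v) v≢u
    ... | no u≢v | yes v≡u = contradiction (sym v≡u) u≢v
    ... | no e | no e′ = colour-sym e e′

  module _ (s t : ℕ) where

    Forced : ℕ → Set
    Forced n = (col : Colours n 2) → Symm col → Config col s t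

    Arrows : ℕ → Set
    Arrows n = (χ : EdgeColouring (K n) (Fin 2)) → OrderableCopy χ (Kᵇ s t)

    forced⇒arrows : ∀ {n} → Forced n → Arrows n
    forced⇒arrows forced χ = config⇒copy χ (table χ zero) (table-agrees χ zero) zero
      (forced (table χ zero) (table-symm χ zero))

    arrows⇒forced : ∀ {n} → Arrows n → Forced n
    arrows⇒forced arrows col symm = copy⇒config χ col (λ _ → refl) zero (arrows χ)
      where χ = colouring col symm

    -- The least `n` has to be found constructively. Colourings are represented by matrices, which
    -- can be searched, and a function agrees with its matrix pointwise, whence `config-cong`.
    forced? : ∀ n → Dec (Forced n)
    forced? n = decide (search-Vec (search-Vec search-Fin n) n λ M → symm? (entry M) ×-dec ¬? (config? (entry M) s t))
      where
      entry : Vec (Vec (Fin 2) n) n → Colours n 2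
      entry M u v = lookup (lookup M u) v
      symm? : ∀ col → Dec (Symm col)
      symm? col = all? λ u → all? λ v → col u v ≟ col v u
      decide : Dec (∃ λ M → Symm (entry M) × ¬ Config (entry M) s t) → Dec (Forced n)
      decide (yes (M , symm , ¬cfg)) = no λ forced → ¬cfg (forced (entry M) symm)
      decide (no none) = yes λ col symm →
        let M = tabulate λ u → tabulate (col u)
            same : ∀ u v → entry M u v ≡ col u v
            same u v = trans (cong (λ row → lookup row v) (lookup∘tabulate (λ u → tabulate (col u)) u)) (lookup∘tabulate (col u) v)
        in config-cong same (decidable-stable (config? (entry M) s t) λ ¬cfg →
             none (M , (λ u v → trans (same u v) (trans (symm u v) (sym (same v u)))) , ¬cfg))

    -- With two colours in all, a vertex misses only its own loop, so the averaging applies to the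
    -- whole graph with defect 1.
    forced-upper : ∀ {n} → 2 ^ s * t + loss s 0 1 < n * suc s → Forced n
    forced-upper {n} big col symm =
      let as , fr , t< = frequent-hit col zero (suc zero) s {n} {1} {t} [] id dense ≤-refl big
      in config-from-hits col as (replicate s zero) fr (<⇒≤ t<)
      where
      dense : Dense col zero (suc zero) 1
      dense w = ≤-trans (pigeonhole-count (λ a → does (¬? (w ≟ a))) (λ (_ : Fin 1) → w) loop)
        (+-monoˡ-≤ 1 (≤-trans (sum-mono λ a → 𝟙-≤ (¬? (w ≟ a)) λ w≢a → by-colour a w≢a (col w a) refl)
          (≤-reflexive (∑-distrib-+ (𝟙 ∘ first col zero (suc zero) w) (𝟙 ∘ second col zero (suc zero) w)))))
        where
        loop : ∀ a → does (¬? (w ≟ a)) ≡ false → Σ (Fin 1) λ _ → a ≡ w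
        loop a eq with w ≟ a
        ... | yes w≡a = zero , sym w≡a
        by-colour : ∀ a → w ≢ a → ∀ x → col w a ≡ x →
          1 ≤ 𝟙 (first col zero (suc zero) w a) + 𝟙 (second col zero (suc zero) w a)
        by-colour a w≢a zero wa≡ = m≤n⇒m≤n+o _ (𝟙-true (first? col zero (suc zero) w a) (w≢a , wa≡))
        by-colour a w≢a (suc zero) wa≡ = m≤n⇒m≤o+n _ (𝟙-true (second? col zero (suc zero) w a)
          (w≢a , wa≡ , λ wa≡0 → contradiction (trans (sym wa≡) wa≡0) λ ()))

    forced-lower : ∀ {m n} (col : Colours m 2) → Symm col → ¬ Config col s t → Forced n → m < n
    forced-lower col symm ¬cfg forced = ≰⇒> λ n≤m → ¬cfg (config-map col (λ i → inject≤ i n≤m)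
      (inject≤-injective n≤m n≤m _ _) (forced _ λ u v → symm _ _))

    forced⇒s≤n : ∀ {n} → Forced n → s ≤ n
    forced⇒s≤n forced = injective⇒≤ (fresh⇒injective a a-distinct)
      where open Config (forced (λ _ _ → zero) λ _ _ → refl)

  least : ∀ {P : ℕ → Set} → (∀ n → Dec (P n)) → ∀ N → P N → ∃ λ n → P n × ∀ m → P m → n ≤ m
  least P? zero p = zero , p , λ _ _ → z≤n
  least P? (suc N) p with P? zero
  ... | yes p₀ = zero , p₀ , λ _ _ → z≤n
  ... | no ¬p₀ with least (P? ∘ suc) N p
  ... | n , pn , min = suc n , pn , λ { zero p₀ → contradiction p₀ ¬p₀ ; (suc m) pm → s≤s (min m pm) }

  three-injective : ∀ {A : Set} (f : Fin 3 → A) → f zero ≢ f (suc zero) → f (suc zero) ≢ f (suc (suc zero)) →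
    f zero ≢ f (suc (suc zero)) → Injective _≡_ _≡_ f
  three-injective f p q r {zero} {zero} eq = refl
  three-injective f p q r {zero} {suc zero} eq = contradiction eq p
  three-injective f p q r {zero} {suc (suc zero)} eq = contradiction eq r
  three-injective f p q r {suc zero} {zero} eq = contradiction (sym eq) p
  three-injective f p q r {suc zero} {suc zero} eq = refl
  three-injective f p q r {suc zero} {suc (suc zero)} eq = contradiction eq q
  three-injective f p q r {suc (suc zero)} {zero} eq = contradiction (sym eq) r
  three-injective f p q r {suc (suc zero)} {suc zero} eq = contradiction (sym eq) q
  three-injective f p q r {suc (suc zero)} {suc (suc zero)} eq = refl

  -- Names an edge of the triangle by the third vertex; the value on loops is arbitrary.
  opposite : Fin 3 → Fin 3 → Fin 3
  opposite zero (suc zero) = suc (suc zero)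
  opposite (suc zero) zero = suc (suc zero)
  opposite zero (suc (suc zero)) = suc zero
  opposite (suc (suc zero)) zero = suc zero
  opposite _ _ = zero

  SameEdge : (u v x y : Fin 3) → Set
  SameEdge u v x y = (u ≡ x × v ≡ y) ⊎ (u ≡ y × v ≡ x)

  opposite-injective : ∀ u v x y → u ≢ v → x ≢ y → opposite u v ≡ opposite x y → SameEdge u v x y
  opposite-injective = from-yes (all? λ u → all? λ v → all? λ x → all? λ y →
    ¬? (u ≟ v) →-dec (¬? (x ≟ y) →-dec ((opposite u v ≟ opposite x y) →-dec
      (((u ≟ x) ×-dec (v ≟ y)) ⊎-dec ((u ≟ y) ×-dec (v ≟ x))))))

  module _ {n k} (χ : EdgeColouring (K n) (Fin k)) (col : Colours n k) (agrees : Agrees χ col) (symm : Symm col) where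

    Triangle : Fin n → Fin n → Fin n → Set
    Triangle x y z = (x ≢ y × y ≢ z × x ≢ z) × (col x y ≢ col y z × col y z ≢ col x z × col x y ≢ col x z)

    triangle? : ∀ x y z → Dec (Triangle x y z)
    triangle? x y z = (¬? (x ≟ y) ×-dec ¬? (y ≟ z) ×-dec ¬? (x ≟ z)) ×-dec
      (¬? (col x y ≟ col y z) ×-dec ¬? (col y z ≟ col x z) ×-dec ¬? (col x y ≟ col x z))

    rainbow-triangle : ∀ {x y z} → Triangle x y z → RainbowCopy χ (K 3)
    rainbow-triangle {x} {y} {z} ((x≢y , y≢z , x≢z) , (xy≢yz , yz≢xz , xy≢xz)) =
      copy , λ {u} {v} {u′} {v′} e e′ differ same → differ (opposite-injective u v u′ v′ e e′
        (edge-injective (trans (sym (edge-colour u v e)) (trans (sym (agrees _)) (trans same (trans (agrees _) (edge-colour u′ v′ e′)))))))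
      where
      corner : Fin 3 → Fin n
      corner zero = x
      corner (suc zero) = y
      corner (suc (suc zero)) = z
      corner-injective : Injective _≡_ _≡_ corner
      corner-injective = three-injective corner x≢y y≢z x≢z
      copy : Copy (K 3) (K n)
      copy = record { map = corner ; injective = corner-injective ; map-adj = λ u≢v → u≢v ∘ corner-injective }
      edge : Fin 3 → Fin k
      edge zero = col y z
      edge (suc zero) = col x z
      edge (suc (suc zero)) = col x y
      edge-injective : Injective _≡_ _≡_ edge
      edge-injective = three-injective edge yz≢xz (≢-sym xy≢xz) (≢-sym xy≢yz)
      edge-colour : ∀ u v → u ≢ v → col (corner u) (corner v) ≡ edge (opposite u v)
      edge-colour zero zero e = contradiction refl e
      edge-colour zero (suc zero) e = refl
      edge-colour zero (suc (suc zero)) e = refl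
      edge-colour (suc zero) zero e = symm y x
      edge-colour (suc zero) (suc zero) e = contradiction refl e
      edge-colour (suc zero) (suc (suc zero)) e = refl
      edge-colour (suc (suc zero)) zero e = symm z x
      edge-colour (suc (suc zero)) (suc zero) e = symm z y
      edge-colour (suc (suc zero)) (suc (suc zero)) e = contradiction refl e

    rainbow-or-free : RainbowCopy χ (K 3) ⊎ RainbowFree col
    rainbow-or-free with any? (λ x → any? λ y → any? λ z → triangle? x y z)
    ... | yes (x , y , z , triangle) = inj₁ (rainbow-triangle triangle)
    ... | no none = inj₂ free
      where
      free : RainbowFree col
      free {x} {y} {z} x≢y y≢z x≢z with col x y ≟ col y z | col y z ≟ col x z | col x y ≟ col x z
      ... | yes p | _ | _ = inj₁ p
      ... | no _ | yes p | _ = inj₂ (inj₁ p)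
      ... | no _ | no _ | yes p = inj₂ (inj₂ p)
      ... | no p | no q | no r = contradiction (x , y , z , (x≢y , y≢z , x≢z) , (p , q , r)) none

  no-rainbow-triangle : ∀ {n} (χ : EdgeColouring (K n) (Fin 2)) → ¬ RainbowCopy χ (K 3)
  no-rainbow-triangle χ (f , rainbow) = contradiction (injective⇒≤ (three-injective edge
    (rainbow {zero} {suc zero} {suc zero} {suc (suc zero)} (λ ()) (λ ()) λ { (inj₁ (() , _)) ; (inj₂ (() , _)) })
    (rainbow {suc zero} {suc (suc zero)} {zero} {suc (suc zero)} (λ ()) (λ ()) λ { (inj₁ (() , _)) ; (inj₂ (() , _)) })
    (rainbow {zero} {suc zero} {zero} {suc (suc zero)} (λ ()) (λ ()) λ { (inj₁ (_ , ())) ; (inj₂ (() , _)) })))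
    λ { (s≤s (s≤s ())) }
    where
    open EdgeColouring (inherited χ f)
    edge : Fin 3 → Fin 2
    edge zero = colour {zero} {suc zero} λ ()
    edge (suc zero) = colour {suc zero} {suc (suc zero)} λ ()
    edge (suc (suc zero)) = colour {zero} {suc (suc zero)} λ ()

  CanonicalArrows : ℕ → ℕ → ℕ → Set
  CanonicalArrows s t n = ∀ k (χ : EdgeColouring (K n) (Fin k)) → OrderableCopy χ (Kᵇ s t) ⊎ RainbowCopy χ (K 3)

  canonical⇒arrows : ∀ {s t n} → CanonicalArrows s t n → Arrows s t n
  canonical⇒arrows canonical χ with canonical 2 χ
  ... | inj₁ copy = copy
  ... | inj₂ rainbow = contradiction rainbow (no-rainbow-triangle χ)

  arrows⇒canonical : ∀ {s t n δ} → 2 ≤ s → 2 ^ s * t ≤ suc s * n + δ → (3 + s) * (δ + gap s) < t →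
    Forced s t n → CanonicalArrows s t n
  arrows⇒canonical {s} {t} {n} 2≤s hyp big forced k χ = conclude (rainbow-or-free χ col (table-agrees χ d) (table-symm χ d))
    where
    2≤n : 2 ≤ n
    2≤n = ≤-trans 2≤s (forced⇒s≤n s t forced)
    -- Loops need some colour, and `Fin k` is not known to be inhabited; since n ≥ 2 an edge
    -- provides one.
    d : Fin k
    d = EdgeColouring.colour χ {inject≤ zero 2≤n} {inject≤ (suc zero) 2≤n}
      λ eq → contradiction (inject≤-injective 2≤n 2≤n _ _ eq) λ ()
    col = table χ d
    conclude : RainbowCopy χ (K 3) ⊎ RainbowFree col → OrderableCopy χ (Kᵇ s t) ⊎ RainbowCopy χ (K 3)
    conclude (inj₁ rainbow) = inj₂ rainbow
    conclude (inj₂ rf) = inj₁ (config⇒copy χ col (table-agrees χ d) d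
      (gallai-config col (table-symm χ d) rf s 2≤s hyp big forced))

  record RamseyNumber (s t : ℕ) : Set where
    field
      n k L : ℕ
      r′₂ : r′₂[ Kᵇ s t ]≔ n
      CR : CR[ Kᵇ s t , K 3 ]≔ n
      upper : suc s * n ≤ 2 ^ s * t + (loss s 0 1 + suc s)
      lower : 2 ^ s * t ≤ suc s * n + suc s * C₁ s * (k * L)
      2^L≤t : 2 ^ L ≤ t
      k²L≤t : k * L * (k * L) ≤ t * L

  -- `forced-upper` starts the search for the least `n`. The random colouring shows m < n, and it is
  -- this lower bound that lets `arrows⇒canonical` transfer the property to any number of colours at
  -- the same `n`.
  ramsey-number : ∀ s → 2 ≤ s → ∀ t → threshold s (gap s) ≤ t → RamseyNumber s t
  ramsey-number s 2≤s t t₀≤t =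
    with-upper (last-true (λ i → i * suc s ≤? bound) z≤n (suc bound) (<⇒≱ (m≤m*n (suc bound) (suc s))))
    where
    open Parameters (parameters s (gap s) t t₀≤t)
    bound = 2 ^ s * t + loss s 0 1
    with-upper : (∃ λ i → i * suc s ≤ bound × ¬ suc i * suc s ≤ bound) → RamseyNumber s t
    with-upper (i , ≤bound , ≰bound) =
      assemble (least (forced? s t) (suc i) forced-i) (random-colouring s k m sparse)
      where
      forced-i : Forced s t (suc i)
      forced-i = forced-upper s t (≰⇒> ≰bound)
      lemma : ∀ a b c → c + (a + b) ≡ a + (b + c)
      lemma = solve-∀
      assemble : (∃ λ n → Forced s t n × ∀ m → Forced s t m → n ≤ m) →
        (Σ (Colours m 2) λ col → (∀ x y → col x y ≡ col y x) × ¬ Config col s t) → RamseyNumber s t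
      assemble (n , forced , min) (col , symm , ¬cfg) = record
        { n = n ; k = k ; L = L
        ; r′₂ = forced⇒arrows s t forced , min′
        ; CR = arrows⇒canonical 2≤s lower loss<t forced , λ m canonical → min′ m (canonical⇒arrows canonical)
        ; upper = ≤-trans (*-monoʳ-≤ (suc s) (min (suc i) forced-i))
            (≤-trans (≤-reflexive (*-comm (suc s) (suc i)))
              (≤-trans (+-monoʳ-≤ (suc s) ≤bound) (≤-reflexive (lemma (2 ^ s * t) (loss s 0 1) (suc s)))))
        ; lower = lower ; 2^L≤t = 2^L≤t ; k²L≤t = k²L≤t }
        where
        min′ : ∀ m → Arrows s t m → n ≤ m
        min′ m arrows = min m (arrows⇒forced s t arrows)
        lower : 2 ^ s * t ≤ suc s * n + suc s * C₁ s * (k * L)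
        lower = ≤-trans m-large (+-monoˡ-≤ _ (*-monoʳ-≤ (suc s) (forced-lower s t col symm ¬cfg forced)))

-- The bounds in terms of the square root and the logarithm.

open import Defs
open Averaging using (loss)
open GallaiConfiguration using (gap)
open ParameterChoice using (C₁; threshold)
open RamseyNumbers using (RamseyNumber; ramsey-number)
open RealBounds

open import Data.Nat as ℕ using (ℕ; suc)
import Data.Nat.Properties as ℕₚ
open import Data.Integer using (+_)
open import Data.Rational as ℚ using (ℚ; 0ℚ)
open import Data.Product using (∃; _×_; _,_)

theorem1p7 : ∀ (s : ℕ) → 2 ℕ.≤ s →
    ∃ λ (C : ℚ) → 0ℚ ℚ.< C × ∃ λ (t₀ : ℕ) →
    ∀ (t : ℕ) → t₀ ℕ.≤ t →
    ∃ λ (n : ℕ) →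
    (r′₂[ Kᵇ s t ]≔ n) ×
    (CR[ Kᵇ s t , K 3 ]≔ n) ×
    ((+ (2 ℕ.^ s) ℚ./ suc s) ℚ.* fromℕ t ℚ.- fromℕ n ≤ᶜ C · √ (fromℕ t · ln t)) ×
    (fromℕ n ℚ.≤ (+ (2 ℕ.^ s) ℚ./ suc s) ℚ.* fromℕ t ℚ.+ C)
theorem1p7 s 2≤s = fromℕ (2 ℕ.* suc C) , 0<fromℕ-suc (C ℕ.+ 1 ℕ.* suc C) , threshold s (gap s) , λ t t₀≤t → bounds t (ramsey-number s 2≤s t t₀≤t)
  where
  -- `C₁ s` serves the lower bound and the other summands the upper bound. In the final constant,
  -- the successor ensures positivity and the factor 2 undoes the halving in `√-≥`.
  C = C₁ s ℕ.+ (loss s 0 1 ℕ.+ suc s)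
  bounds : ∀ t → RamseyNumber s t → ∃ λ n → _
  bounds t R = n , r′₂ , CR ,
    (+ (k ℕ.* L) ℚ./ 2 , √-≥ {t} {L} {k ℕ.* L} 2^L≤t k²L≤t ,
      lower-bound s (2 ℕ.^ s) t n (suc C) (k ℕ.* L) (ℕₚ.≤-trans lower (ℕₚ.+-monoʳ-≤ (suc s ℕ.* n)
        (ℕₚ.≤-trans (ℕₚ.≤-reflexive (ℕₚ.*-assoc (suc s) (C₁ s) (k ℕ.* L)))
          (ℕₚ.*-monoʳ-≤ (suc s) (ℕₚ.*-monoˡ-≤ (k ℕ.* L) (ℕₚ.m≤n⇒m≤1+n (ℕₚ.m≤m+n (C₁ s) _)))))))) ,
    upper-bound s (2 ℕ.^ s) t n (2 ℕ.* suc C) (ℕₚ.≤-trans upper (ℕₚ.+-monoʳ-≤ (2 ℕ.^ s ℕ.* t)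
      (ℕₚ.≤-trans (ℕₚ.m≤n+m (loss s 0 1 ℕ.+ suc s) (C₁ s)) (ℕₚ.≤-trans (ℕₚ.n≤1+n C) (ℕₚ.m≤m+n (suc C) _)))))
    where open RamseyNumber R
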